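{- Let $\sigma=\lambda/\nu$ be a balanced skew shape of height $a$ and width $b$, and let $w\in\mathfrak{S}_n$ be a skew vexillary permutation of shape $\sigma$. Then the weak order interval $[e,w]$ is CDE with edge density $ab/(a+b)$; that is, $$\mathbb{E}(\mathrm{uni}_{[e,w]};\mathrm{ddeg})=\mathbb{E}(\mathrm{maxchain}_{[e,w]};\mathrm{ddeg})=\frac{ab}{a+b}.$$
   Context: CDE: For a finite poset $P$, $\mathrm{ddeg}(p)$ is the number of elements of $P$ covered by $p$. $\mathrm{uni}_P$ is the uniform distribution on $P$; $\mathrm{maxchain}_P$ is the distribution in which $p$ has probability proportional to the number of maximal chains of $P$ containing $p$. $\mathbb{E}(\mu;f)$ is the expectation of a statistic $f$ with respect to a distribution $\mu$. $P$ is CDE (has the coincidental down-degree expectations property) if $\mathbb{E}(\mathrm{uni}_P;\mathrm{ddeg})=\mathbb{E}(\mathrm{maxchain}_P;\mathrm{ddeg})$. The edge density of $P$ is $\mathbb{E}(\mathrm{uni}_P;\mathrm{ddeg})$, i.e. the number of cover relations divided by $\#P$. Weak order: For $w\in\mathfrak{S}_n$, $\mathrm{Inv}(w)=\{(i,j): 1\le i<j\le n,\ w(i)>w(j)\}$ and $\mathrm{Inv}^{ -1}(w)=\mathrm{Inv}(w^{ -1})$. Weak order on $\mathfrak{S}_n$ is: $u\le w$ iff $\mathrm{Inv}^{ -1}(u)\subseteq \mathrm{Inv}^{ -1}(w)$; equivalently, it is the partial order whose cover relations are $u\lessdot us_k$ with $u(k)<u(k+1)$, $s_k$ the simple transposition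 of $k,k+1$. $e$ is the identity; $[e,w]=\{u:e\le u\le w\}$ with the induced order. Shapes: A diagram is a finite subset of $\mathbb{Z}^2$ of boxes $(i,j)$ in matrix coordinates ($i$ = row, increasing downwards; $j$ = column, increasing rightwards). A partition $\lambda$ is identified with its Young diagram $\{(i,j):1\le i\le \ell(\lambda),1\le j\le\lambda_i\}$. For partitions with $\nu_i\le\lambda_i$ for all $i$, the skew shape $\sigma=\lambda/\nu$ is the set difference of the Young diagrams. $\sigma$ is connected if the Hasse diagram of the poset on its boxes (with order induced from the componentwise order on $\mathbb{Z}^2$) is connected (in particular nonempty). A connected $\sigma$ has height $a$ and width $b$ if $[a]\times[b]$ is the smallest rectangle containing $\sigma$ up to translation. Translate $\sigma$ into $[a]\times[b]$; its main antidiagonal is the line joining the northeast and southwest corners of the boundary of this rectangle. A corner of $\sigma$ is a point where two line segments that are part of the boundary of $\sigma$ meet; it is outward if no box of $\sigma$ intersects both line segments (except at the corner point). (Equivalently, outward corners are the lattice points, at the southeast corner of position $(p,q)$, such that exactly three of $(p,q),(p,q+1),(p+1,q),(p+1,q+1)$ lie in $\sigma$; such a point is on the main antidiagonal iff $pb+qa=ab$.) $\sigma$ is balanced if it is connected and all its outward corners lie exactly on its main antidiagonal. Skew vexillary: The Rothe diagram of $w$ is $\{(i,w(j)):(i,j)\in \mathrm{Inv}(w)\}$. $w$ is skew vexillary of shape $\sigma$ if its Rothe diagram can be transformed to $\sigma$ by some permutation of rows and columns (rows and columns being permuted separately). -}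

module Defs where

open import Level using (0ℓ)
open import Data.Fin.Base as Fin using (Fin; zero; suc; toℕ)
open import Data.Fin.Permutation as Perm
  using (Permutation′; _⟨$⟩ʳ_; _⟨$⟩ˡ_; flip; insert; remove; insert-remove; remove-insert; inverseˡ; inverseʳ)
import Data.Fin.Properties as Fin
open import Data.Integer.Base using (+_)
open import Data.List.Base
  using (List; []; _∷_; map; _++_; filter; length; foldr; allFin; cartesianProductWith)
open import Data.List.Membership.Propositional.Properties using (∈-allFin)
import Data.List.Membership.DecSetoid as DecMembership
open import Data.List.Membership.Setoid.Properties using (∈-cartesianProductWith⁺; ∈-resp-≈)
open import Data.List.Relation.Unary.All using (All; []; _∷_; all?)
open import Data.List.Relation.Unary.AllPairs using (AllPairs; []; _∷_; allPairs?)
open import Data.List.Relation.Unary.Any as Any using (Any; here; there; any?)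
open import Data.List.Relation.Unary.Linked using (Linked)
import Data.List.Relation.Binary.Subset.DecSetoid as DecSubset
import Data.List.Relation.Unary.Enumerates.Setoid as Enumerates
import Data.List.Relation.Unary.Unique.Setoid as Unique
import Data.List.Relation.Unary.Unique.Setoid.Properties as Uniqueₚ
import Data.List.Relation.Unary.Unique.Propositional.Properties as Unique≡ₚ
open import Data.Nat.Base using (ℕ; zero; suc; _+_; _*_; _≤_; _<_; _≥_; z≤n; NonZero)
open import Data.Nat.ListAction using (sum)
import Data.Nat.Properties as ℕ
open import Data.Product using (∃!)
open import Data.Product.Base using (Σ; ∃₂; ∃-syntax; _×_; _,_; proj₁; proj₂)
import Data.Product.Base as Product
open import Data.Product.Relation.Binary.Pointwise.NonDependent using (×-poset)
open import Data.Rational.Base as ℚ using (ℚ; 0ℚ)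
open import Data.Sum.Base using (_⊎_)
open import Function.Bundles using (_↔_; _⇔_; Inverse)
open import Relation.Binary.Bundles using (Setoid; Poset; DecPoset)
open import Relation.Binary.Core using (Rel; _⇒_)
open import Relation.Binary.Construct.Closure.Equivalence using (EqClosure)
import Relation.Binary.Construct.On as On
open import Relation.Binary.Definitions as B using (tri<; tri≈; tri>)
import Relation.Binary.Properties.Poset as Posetₚ
open import Relation.Binary.PropositionalEquality
  using (_≡_; refl; sym; trans; cong; subst; subst₂) renaming (setoid to ≡-setoid)
open import Relation.Nullary using (¬_; yes; no; contradiction)
open import Relation.Nullary.Decidable using (map′; ¬?; _×-dec_; _⊎-dec_; _→-dec_)
open import Relation.Unary using (Pred; Decidable; _⊆_; _∈_)

------------------------------------------------------------------------
-- Rational arithmetic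

infixl 7 _÷_

-- The value 0 at denominator 0 is a junk value.
_÷_ : ℕ → ℕ → ℚ
m ÷ zero  = 0ℚ
m ÷ suc n = + m ℚ./ suc n

sumℚ : List ℚ → ℚ
sumℚ = foldr ℚ._+_ 0ℚ

------------------------------------------------------------------------
-- Posets

module Covering (P : Poset 0ℓ 0ℓ 0ℓ) where
  open Poset P using (Carrier; _≈_) public
  open Posetₚ P using () renaming (_<_ to _≺_) public

  infix 4 _⋖_

  _⋖_ : Rel Carrier 0ℓ
  x ⋖ y = x ≺ y × (∀ z → ¬ (x ≺ z × z ≺ y))

  -- The Hasse diagram is nonempty and connected; the vertices of that graph
  -- are the elements of P up to _≈_.
  Connected : Set
  Connected = Carrier × (∀ x y → EqClosure (λ u v → u ≈ v ⊎ u ⋖ v) x y)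

record FinitePoset : Set₁ where
  field
    decPoset : DecPoset 0ℓ 0ℓ 0ℓ

  open DecPoset decPoset public
  open Covering poset using (_≺_; _⋖_) public

  field
    elements : List Carrier
    complete : Enumerates.IsEnumeration Eq.setoid elements
    unique   : Unique.Unique Eq.setoid elements

module Restriction (P : FinitePoset) {Q : Pred (FinitePoset.Carrier P) 0ℓ} (Q? : Decidable Q)
                   (resp : ∀ {x y} → FinitePoset._≈_ P x y → Q x → Q y) where
  open FinitePoset P

  induced : DecPoset 0ℓ 0ℓ 0ℓ
  induced = On.decPoset decPoset (proj₁ {B = Q})

  open DecPoset induced using () renaming (_≈_ to _≈ᵢ_; module Eq to Eqᵢ)

  sift : List Carrier → List (Σ Carrier Q)
  sift []       = []
  sift (x ∷ xs) with Q? x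
  ... | yes q = (x , q) ∷ sift xs
  ... | no  _ = sift xs

  sift-complete : ∀ {x} (q : Q x) xs → Any (x ≈_) xs → Any ((x , q) ≈ᵢ_) (sift xs)
  sift-complete q (y ∷ xs) x∈ with Q? y
  sift-complete q (y ∷ xs) (here x≈y) | yes _ = here x≈y
  sift-complete q (y ∷ xs) (there x∈) | yes _ = there (sift-complete q xs x∈)
  sift-complete q (y ∷ xs) (here x≈y) | no ¬q = contradiction (resp x≈y q) ¬q
  sift-complete q (y ∷ xs) (there x∈) | no _  = sift-complete q xs x∈

  sift-fresh : ∀ {x} (q : Q x) {xs} → All (λ y → ¬ x ≈ y) xs → All (λ y → ¬ (x , q) ≈ᵢ y) (sift xs)
  sift-fresh q []               = []
  sift-fresh q {y ∷ _} (x≉y ∷ ps) with Q? y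
  ... | yes _ = x≉y ∷ sift-fresh q ps
  ... | no  _ = sift-fresh q ps

  sift-unique : ∀ {xs} → Unique.Unique Eq.setoid xs → Unique.Unique Eqᵢ.setoid (sift xs)
  sift-unique []                   = []
  sift-unique {x ∷ _} (x∉ ∷ xs!) with Q? x
  ... | yes q = sift-fresh q x∉ ∷ sift-unique xs!
  ... | no  _ = sift-unique xs!

  restrict : FinitePoset
  restrict = record
    { decPoset = induced
    ; elements = sift elements
    ; complete = λ (x , q) → sift-complete q elements (complete x)
    ; unique   = sift-unique unique
    }

interval : (P : FinitePoset) (x y : FinitePoset.Carrier P) → FinitePoset
interval P x y = Restriction.restrict P
  {λ z → x ≤ₚ z × z ≤ₚ y}
  (λ z → (x ≤? z) ×-dec (z ≤? y))
  (λ z≈z′ → Product.map (≤-respʳ-≈ z≈z′) (≤-respˡ-≈ z≈z′))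
  where open FinitePoset P renaming (_≤_ to _≤ₚ_)

-- If xs has no repetitions, every subset of its elements is listed exactly once.
sublists : {A : Set} → List A → List (List A)
sublists []       = [] ∷ []
sublists (x ∷ xs) = map (x ∷_) (sublists xs) ++ sublists xs

------------------------------------------------------------------------
-- Coincidental down-degree expectations

module CDE (P : FinitePoset) where
  open FinitePoset P renaming (_≤_ to _≤ₚ_)
  open DecMembership Eq.decSetoid using (_∈?_)
  open DecSubset Eq.decSetoid using (_⊆?_) renaming (_⊆_ to _⊆ₗ_)

  _≺?_ : B.Decidable _≺_
  x ≺? y = (x ≤? y) ×-dec ¬? (x ≟ y)

  _⋖?_ : B.Decidable _⋖_
  x ⋖? y = (x ≺? y) ×-dec map′
    (λ none z x≺z≺y → none (Any.map (respects x≺z≺y) (complete z)))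
    (λ none ∃z → let (z , x≺z≺y) = Any.satisfied ∃z in none z x≺z≺y)
    (¬? (any? (λ z → (x ≺? z) ×-dec (z ≺? y)) elements))
    where
    respects : ∀ {z z′} → x ≺ z × z ≺ y → z ≈ z′ → x ≺ z′ × z′ ≺ y
    respects ((x≤z , x≉z) , (z≤y , z≉y)) z≈z′ =
      (≤-respʳ-≈ z≈z′ x≤z , λ x≈z′ → x≉z (Eq.trans x≈z′ (Eq.sym z≈z′))) ,
      (≤-respˡ-≈ z≈z′ z≤y , λ z′≈y → z≉y (Eq.trans z≈z′ z′≈y))

  size : ℕ
  size = length elements

  ddeg : Carrier → ℕ
  ddeg p = length (filter (_⋖? p) elements)

  Chain : List Carrier → Set
  Chain = AllPairs (λ x y → x ≤ₚ y ⊎ y ≤ₚ x)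

  chain? : Decidable Chain
  chain? = allPairs? (λ x y → (x ≤? y) ⊎-dec (y ≤? x))

  MaximalChain : List Carrier → Set
  MaximalChain C = Chain C × All (λ D → Chain D → C ⊆ₗ D → D ⊆ₗ C) (sublists elements)

  maximalChain? : Decidable MaximalChain
  maximalChain? C =
    chain? C ×-dec all? (λ D → chain? D →-dec ((C ⊆? D) →-dec (D ⊆? C))) (sublists elements)

  maximalChains : List (List Carrier)
  maximalChains = filter maximalChain? (sublists elements)

  #maximalChainsThrough : Carrier → ℕ
  #maximalChainsThrough p = length (filter (p ∈?_) maximalChains)

  Distribution : Set
  Distribution = Carrier → ℚ

  -- Both denominators below are positive when P is nonempty.
  uni : Distribution
  uni p = 1 ÷ size

  maxchain : Distribution
  maxchain p = #maximalChainsThrough p ÷ sum (map #maximalChainsThrough elements)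

  𝔼 : Distribution → (Carrier → ℚ) → ℚ
  𝔼 μ f = sumℚ (map (λ p → μ p ℚ.* f p) elements)

  ddegℚ : Carrier → ℚ
  ddegℚ p = ddeg p ÷ 1

  edgeDensity : ℚ
  edgeDensity = 𝔼 uni ddegℚ

  IsCDE : Set
  IsCDE = 𝔼 uni ddegℚ ≡ 𝔼 maxchain ddegℚ

------------------------------------------------------------------------
-- Permutations and weak order

-- Positions and values are 0, …, n - 1.
Inv : ∀ {n} → Permutation′ n → Rel (Fin n) 0ℓ
Inv w i j = i Fin.< j × w ⟨$⟩ʳ j Fin.< w ⟨$⟩ʳ i

Inv⁻¹ : ∀ {n} → Permutation′ n → Rel (Fin n) 0ℓ
Inv⁻¹ w = Inv (flip w)

module _ {n : ℕ} where

  infix 4 _≤ʷ_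

  _≤ʷ_ : Rel (Permutation′ n) 0ℓ
  u ≤ʷ w = Inv⁻¹ u ⇒ Inv⁻¹ w

  inv? : (w : Permutation′ n) → B.Decidable (Inv w)
  inv? w i j = (i Fin.<? j) ×-dec ((w ⟨$⟩ʳ j) Fin.<? (w ⟨$⟩ʳ i))

  _≟ʷ_ : B.Decidable (Perm._≈_ {n} {n})
  u ≟ʷ w = Fin.all? (λ i → (u ⟨$⟩ʳ i) Fin.≟ (w ⟨$⟩ʳ i))

  _≤ʷ?_ : B.Decidable _≤ʷ_
  u ≤ʷ? w = map′ (λ h {i} {j} → h i j) (λ h i j → h {i} {j})
    (Fin.all? (λ i → Fin.all? (λ j → inv? (flip u) i j →-dec inv? (flip w) i j)))

  permSetoid : Setoid 0ℓ 0ℓ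
  permSetoid = record
    { Carrier       = Permutation′ n
    ; _≈_           = Perm._≈_
    ; isEquivalence = record
      { refl  = λ _ → refl
      ; sym   = λ p i → sym (p i)
      ; trans = λ p q i → trans (p i) (q i)
      }
    }

  ≈-flip : ∀ {u w : Permutation′ n} → u Perm.≈ w → ∀ i → flip u ⟨$⟩ʳ i ≡ flip w ⟨$⟩ʳ i
  ≈-flip {u} {w} u≈w i =
    trans (sym (inverseˡ w)) (cong (w ⟨$⟩ˡ_) (trans (sym (u≈w (u ⟨$⟩ˡ i))) (inverseʳ u)))

  ≤ʷ-reflexive : ∀ {u w : Permutation′ n} → u Perm.≈ w → u ≤ʷ w
  ≤ʷ-reflexive {u} {w} u≈w {i} {j} (i<j , uj<ui) =
    i<j , subst₂ Fin._<_ (≈-flip {u} {w} u≈w j) (≈-flip {u} {w} u≈w i) uj<ui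

  ⟨$⟩ʳ-injective : ∀ (w : Permutation′ n) {i j} → w ⟨$⟩ʳ i ≡ w ⟨$⟩ʳ j → i ≡ j
  ⟨$⟩ʳ-injective w eq = trans (sym (inverseˡ w)) (trans (cong (w ⟨$⟩ˡ_) eq) (inverseˡ w))

  order-transfer : ∀ {u w : Permutation′ n} → u ≤ʷ w → w ≤ʷ u →
                   ∀ {i j} → flip u ⟨$⟩ʳ i Fin.< flip u ⟨$⟩ʳ j → flip w ⟨$⟩ʳ i Fin.< flip w ⟨$⟩ʳ j
  order-transfer {u} {w} u≤w w≤u {i} {j} ui<uj with Fin.<-cmp i j
  ... | tri≈ _ refl _ = contradiction ui<uj (ℕ.<-irrefl refl)
  ... | tri> _ _ j<i  = proj₂ (u≤w (j<i , ui<uj))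
  ... | tri< i<j _ _ with Fin.<-cmp (flip w ⟨$⟩ʳ i) (flip w ⟨$⟩ʳ j)
  ...   | tri< wi<wj _ _ = wi<wj
  ...   | tri≈ _ eq _    = contradiction (cong toℕ (⟨$⟩ʳ-injective (flip w) eq))
                             (λ eq′ → ℕ.<⇒≢ i<j eq′)
  ...   | tri> _ _ wj<wi = contradiction ui<uj (ℕ.<-asym (proj₂ (w≤u (i<j , wj<wi))))

  increasing⇒≥id : ∀ (f : Fin n → Fin n) → (∀ {i j} → i Fin.< j → f i Fin.< f j) →
                   ∀ k (i : Fin n) → toℕ i ≡ k → k ≤ toℕ (f i)
  increasing⇒≥id f f-inc zero    i _  = z≤n
  increasing⇒≥id f f-inc (suc k) i eq =
    ℕ.≤-<-trans (increasing⇒≥id f f-inc k i⁻ toℕi⁻) (f-inc (ℕ.≤-reflexive (trans (cong suc toℕi⁻) (sym eq))))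
    where
    k<n : k < n
    k<n = ℕ.<-trans (ℕ.≤-reflexive (sym eq)) (Fin.toℕ<n i)
    i⁻ : Fin n
    i⁻ = Fin.fromℕ< k<n
    toℕi⁻ : toℕ i⁻ ≡ k
    toℕi⁻ = Fin.toℕ-fromℕ< k<n

  ≤ʷ-below : ∀ {u w : Permutation′ n} → u ≤ʷ w → w ≤ʷ u → ∀ i → toℕ (u ⟨$⟩ˡ i) ≤ toℕ (w ⟨$⟩ˡ i)
  ≤ʷ-below {u} {w} u≤w w≤u i =
    subst (λ x → toℕ (u ⟨$⟩ˡ i) ≤ toℕ (w ⟨$⟩ˡ x)) (inverseʳ u)
      (increasing⇒≥id (λ x → w ⟨$⟩ˡ (u ⟨$⟩ʳ x)) f-inc _ (u ⟨$⟩ˡ i) refl)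
    where
    f-inc : ∀ {x y} → x Fin.< y → w ⟨$⟩ˡ (u ⟨$⟩ʳ x) Fin.< w ⟨$⟩ˡ (u ⟨$⟩ʳ y)
    f-inc x<y = order-transfer {u} {w} u≤w w≤u (subst₂ Fin._<_ (sym (inverseˡ u)) (sym (inverseˡ u)) x<y)

  ≤ʷ-antisym : ∀ {u w : Permutation′ n} → u ≤ʷ w → w ≤ʷ u → u Perm.≈ w
  ≤ʷ-antisym {u} {w} u≤w w≤u = ≈-flip {flip u} {flip w} λ i →
    Fin.toℕ-injective (ℕ.≤-antisym (≤ʷ-below {u} {w} u≤w w≤u i) (≤ʷ-below {w} {u} w≤u u≤w i))

  weakDecPoset : DecPoset 0ℓ 0ℓ 0ℓ
  weakDecPoset = record
    { Carrier           = Permutation′ n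
    ; _≈_               = Perm._≈_
    ; _≤_               = _≤ʷ_
    ; isDecPartialOrder = record
      { isPartialOrder = record
        { isPreorder = record
          { isEquivalence = Setoid.isEquivalence permSetoid
          ; reflexive     = λ {u} {w} → ≤ʷ-reflexive {u} {w}
          ; trans         = λ {u} {v} {w} u≤v v≤w x → v≤w (u≤v x)
          }
        ; antisym = λ {u} {w} → ≤ʷ-antisym {u} {w}
        }
      ; _≟_  = _≟ʷ_
      ; _≤?_ = _≤ʷ?_
      }
    }

permutations : ∀ n → List (Permutation′ n)
permutations zero    = Perm.id ∷ []
permutations (suc n) = cartesianProductWith (insert zero) (allFin (suc n)) (permutations n)

insert-cong : ∀ {n j k} {π ρ : Permutation′ n} → j ≡ k → π Perm.≈ ρ →
              insert zero j π Perm.≈ insert zero k ρ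
insert-cong         refl π≈ρ zero    = refl
insert-cong {j = j} refl π≈ρ (suc i) = cong (Fin.punchIn j) (π≈ρ i)

insert-injective : ∀ {n j k} {π ρ : Permutation′ n} →
                   insert zero j π Perm.≈ insert zero k ρ → j ≡ k × π Perm.≈ ρ
insert-injective {j = j} {k} {π} {ρ} eq with eq zero
... | refl = refl , λ i → Fin.punchIn-injective j (π ⟨$⟩ʳ i) (ρ ⟨$⟩ʳ i) (eq (suc i))

permutations-complete : ∀ n → Enumerates.IsEnumeration permSetoid (permutations n)
permutations-complete zero    π = here λ ()
permutations-complete (suc n) π = ∈-resp-≈ permSetoid
  {x = insert zero (π ⟨$⟩ʳ zero) (remove zero π)} {π} (insert-remove zero π)
  (∈-cartesianProductWith⁺ (≡-setoid (Fin (suc n))) permSetoid permSetoid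
    (λ {j} {k} {ρ} {τ} → insert-cong {π = ρ} {τ})
    (∈-allFin (π ⟨$⟩ʳ zero)) (permutations-complete n (remove zero π)))

permutations-unique : ∀ n → Unique.Unique permSetoid (permutations n)
permutations-unique zero    = [] ∷ []
permutations-unique (suc n) = Uniqueₚ.cartesianProductWith⁺ (≡-setoid (Fin (suc n))) permSetoid permSetoid
  (insert zero) (λ {j} {k} {ρ} {τ} → insert-injective {π = ρ} {τ})
  (Unique≡ₚ.allFin⁺ (suc n)) (permutations-unique n)

weakOrder : ℕ → FinitePoset
weakOrder n = record
  { decPoset = weakDecPoset
  ; elements = permutations n
  ; complete = permutations-complete n
  ; unique   = permutations-unique n
  }

[e,_] : ∀ {n} → Permutation′ n → FinitePoset
[e,_] {n} w = interval (weakOrder n) Perm.id w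

------------------------------------------------------------------------
-- Diagrams and skew shapes

-- Matrix coordinates (row , column), counted from 0.
Box : Set
Box = ℕ × ℕ

Diagram : Set₁
Diagram = Pred Box 0ℓ

record Partition : Set where
  field
    parts      : List ℕ
    decreasing : Linked _≥_ parts
    positive   : All NonZero parts

nth : List ℕ → ℕ → ℕ
nth []       _       = 0
nth (x ∷ xs) zero    = x
nth (x ∷ xs) (suc i) = nth xs i

part : Partition → ℕ → ℕ
part μ = nth (Partition.parts μ)

young : Partition → Diagram
young μ (i , j) = j < part μ i

record SkewShape : Set where
  field
    outer inner : Partition
    inner⊆outer : ∀ i → part inner i ≤ part outer i

  boxes : Diagram
  boxes x = x ∈ young outer × ¬ (x ∈ young inner)

open SkewShape using (boxes)

boxPoset : Diagram → Poset 0ℓ 0ℓ 0ℓ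
boxPoset σ = On.poset (×-poset ℕ.≤-poset ℕ.≤-poset) (proj₁ {B = σ})

ConnectedDiagram : Diagram → Set
ConnectedDiagram σ = Covering.Connected (boxPoset σ)

record Rectangle : Set where
  field
    top left height width : ℕ

  interior : Diagram
  interior (i , j) = (top ≤ i × i < top + height) × (left ≤ j × j < left + width)

open Rectangle using (height; width; interior)

IsBoundingRectangle : Diagram → Rectangle → Set
IsBoundingRectangle σ R =
  σ ⊆ interior R × (∀ R′ → σ ⊆ interior R′ → height R ≤ height R′ × width R ≤ width R′)

HasDimensions : Diagram → ℕ → ℕ → Set
HasDimensions σ a b = ∃[ R ] (IsBoundingRectangle σ R × height R ≡ a × width R ≡ b)

-- The lattice point (p , q) is the northwest corner of the box (p , q).
Point : Set
Point = ℕ × ℕ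

-- A unit segment going east, respectively south, from the given point.
data Segment : Set where
  horizontal vertical : Point → Segment

data Endpoint : Segment → Point → Set where
  west  : ∀ {p q} → Endpoint (horizontal (p , q)) (p , q)
  east  : ∀ {p q} → Endpoint (horizontal (p , q)) (p , suc q)
  north : ∀ {p q} → Endpoint (vertical (p , q)) (p , q)
  south : ∀ {p q} → Endpoint (vertical (p , q)) (suc p , q)

data Side : Box → Segment → Set where
  top    : ∀ {i j} → Side (i , j) (horizontal (i , j))
  bottom : ∀ {i j} → Side (i , j) (horizontal (suc i , j))
  left   : ∀ {i j} → Side (i , j) (vertical (i , j))
  right  : ∀ {i j} → Side (i , j) (vertical (i , suc j))

-- Exactly one of the (at most two) boxes having s as a side lies in σ.
Boundary : Diagram → Segment → Set
Boundary σ s = ∃! _≡_ λ x → x ∈ σ × Side x s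

-- A horizontal and a vertical boundary segment meet at v, and no box of σ
-- touches both of them away from v. A unit box touches both of two
-- perpendicular unit segments away from their common endpoint iff both
-- segments are sides of it.
OutwardCorner : Diagram → Point → Set
OutwardCorner σ v = ∃₂ λ h k →
  let s = horizontal h
      t = vertical k
  in  Boundary σ s × Boundary σ t × Endpoint s v × Endpoint t v ×
      (∀ x → x ∈ σ → ¬ (Side x s × Side x t))

-- In an a × b rectangle, the line through the northeast and southwest corners
-- consists of the points at distance p from the top and q from the left with
-- p/a + q/b = 1.
OnAntidiagonal : Rectangle → Point → Set
OnAntidiagonal R v = ∃₂ λ p q →
  v ≡ (Rectangle.top R + p , Rectangle.left R + q) ×
  p * width R + q * height R ≡ height R * width R

Balanced : Diagram → Set
Balanced σ = ConnectedDiagram σ ×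
  (∀ R → IsBoundingRectangle σ R → ∀ v → OutwardCorner σ v → OnAntidiagonal R v)

------------------------------------------------------------------------
-- Skew vexillary permutations

Rothe : ∀ {n} → Permutation′ n → Diagram
Rothe w x = ∃₂ λ i j → Inv w i j × x ≡ (toℕ i , toℕ (w ⟨$⟩ʳ j))

-- The rows and columns permuted are those of the whole grid, so that empty
-- rows and columns of the skew shape play no role.
IsSkewVexillary : ∀ {n} → Permutation′ n → SkewShape → Set
IsSkewVexillary w σ = ∃₂ λ (ρ γ : ℕ ↔ ℕ) →
  ∀ i j → (i , j) ∈ Rothe w ⇔ (Inverse.to ρ i , Inverse.to γ j) ∈ boxes σ

{-# OPTIONS --safe #-}

-- Call a weight N on the words u ≤ w toggle symmetric if, for every inversion {x , y} of w, the words with x just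
-- before y and those with y just before x carry the same weight, also after restriction by a statistic that is
-- insensitive to the exchange of x and y. The uniform weight is toggle symmetric because exchanging x and y is a
-- bijection. The number of maximal chains through u is: a saturated chain exchanges x and y exactly once, and
-- exchanging the values x and y maps the saturated chains between two words with x just before y bijectively onto
-- those between the exchanged words.
--
-- Let (x₀ , y₀) be a box of the Rothe diagram whose row and column span a full rectangle. Then every letter of
-- u ≤ w standing between x₀ and y₀ is either a column of the row of y₀ or a row of the column of x₀, and counting the
-- changes of type on the way from x₀ to y₀ gives an identity that toggle symmetry turns into: the weight of the
-- descents in the row of y₀ plus that of the descents in the column of x₀ is the total weight.
--
-- In a balanced shape every box crossed by the main antidiagonal is of this kind, since an obstruction would be an
-- outward corner off the antidiagonal. Cut the antidiagonal of the a × b rectangle into a b equal pieces: each row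
-- meets b of them and each column a of them, so summing over the pieces gives (a + b) 𝔼 ddeg = a b for both weights.
module Submission where

open import Defs
open import Data.Bool.Base using (if_then_else_)
open import Data.Empty using (⊥-elim)
open import Data.Fin.Base as Fin using (Fin; zero; suc; toℕ; fromℕ<)
open import Data.Fin.Permutation as Perm
  using (Permutation′; _⟨$⟩ʳ_; _⟨$⟩ˡ_; _∘ₚ_; transpose; inverseˡ; inverseʳ; flip)
import Data.Fin.Permutation.Components as Components
import Data.Fin.Properties as Fin
import Data.Integer.Base as ℤ
import Data.Integer.Properties as ℤ
open import Data.List.Base
  using (List; []; _∷_; map; filter; length; allFin; concatMap; _++_; upTo; applyUpTo)
import Data.List.Membership.DecSetoid as DecMembership
import Data.List.Membership.Propositional as ≡ₗ
open import Data.List.Membership.Propositional.Properties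
  using (∈-allFin; ∈-filter⁺; ∈-filter⁻; ∈-map⁺; ∈-map⁻; ∈-++⁺ˡ; ∈-++⁺ʳ; ∈-++⁻; ∈-concatMap⁺; ∈-concatMap⁻)
open import Data.List.Membership.Propositional.Properties.WithK using (unique∧set⇒bag)
import Data.List.Membership.Setoid.Properties as Membershipₚ
open import Data.List.Properties as List
  using (filter-accept; filter-reject; ∷-injectiveʳ; map-applyUpTo)
open import Data.List.Relation.Binary.BagAndSetEquality using (∼bag⇒↭)
open import Data.List.Relation.Binary.Permutation.Propositional using (_↭_)
open import Data.List.Relation.Binary.Permutation.Propositional.Properties using (map⁺)
open import Data.List.Relation.Binary.Pointwise as Pointwise using (Pointwise; []; _∷_)
open import Data.List.Relation.Unary.All as All using (All; []; _∷_)
open import Data.List.Relation.Unary.All.Properties as All using (¬Any⇒All¬)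
open import Data.List.Relation.Unary.AllPairs as AllPairs using (AllPairs; []; _∷_)
import Data.List.Relation.Unary.AllPairs.Properties as AllPairs
open import Data.List.Relation.Unary.Any as Any using (Any; here; there; satisfied; any?)
import Data.List.Relation.Unary.Enumerates.Setoid as Enumerates
open import Data.List.Relation.Unary.Linked using (Linked; []; [-]; _∷_)
import Data.List.Relation.Unary.Unique.Propositional.Properties as Unique≡ₚ
import Data.List.Relation.Unary.Unique.Setoid as Unique
open import Data.Nat.Base
  using (ℕ; zero; suc; _+_; _*_; _≤_; _<_; _≥_; z≤n; s≤s; z<s; _∸_; _/_; s<s⁻¹; NonZero; pred; >-nonZero)
open import Data.Nat.DivMod
  using (m<n⇒m/n≡0; +-distrib-/-∣ˡ; n/n≡1; m/n*n≤m; m<n*o⇒m/o<n; m%n<n; m≡m%n+[m/n]*n)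
open import Data.Nat.Divisibility using (∣-refl)
open import Data.Nat.ListAction using (sum)
open import Data.Nat.ListAction.Properties using (sum-++; sum-↭)
import Data.Nat.Properties as ℕ
open import Data.Nat.Solver using (module +-*-Solver)
open import Data.Product.Base using (∃; _×_; _,_; proj₁; proj₂; ∃₂)
open import Data.Rational.Base as ℚ using (fromℚᵘ; toℚᵘ)
import Data.Rational.Properties as ℚ
open import Data.Rational.Unnormalised.Base as ℚᵘ using (mkℚᵘ; *≡*)
import Data.Rational.Unnormalised.Properties as ℚᵘ
open import Data.Sum.Base as Sum using (_⊎_; inj₁; inj₂)
open import Function.Base using (_∘_; id)
open import Function.Bundles using (mk⇔; Inverse; Equivalence; _↔_)
open import Level using (0ℓ)
open import Relation.Binary.Bundles using (DecSetoid)
open import Relation.Binary.Construct.Closure.Equivalence using (EqClosure)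
open import Relation.Binary.Construct.Closure.ReflexiveTransitive using (ε; _◅_)
open import Relation.Binary.Construct.Closure.Symmetric using (fwd; bwd)
open import Relation.Binary.Definitions using (tri<; tri≈; tri>)
open import Relation.Binary.PropositionalEquality
  using (_≡_; _≢_; refl; sym; trans; cong; cong₂; subst; subst₂; module ≡-Reasoning)
  renaming (decSetoid to ≡-decSetoid)
open import Relation.Nullary using (Dec; yes; no; does; ¬_; contradiction)
open import Relation.Nullary.Decidable using (_×-dec_; dec-true; dec-false; _⊎-dec_; _→-dec_; ¬?)
open import Relation.Unary using (Pred; Decidable)
open import Algebra.Properties.CommutativeSemigroup ℕ.+-commutativeSemigroup using (interchange)
open import Algebra.Properties.CommutativeSemigroup ℕ.*-commutativeSemigroup using (x∙yz≈y∙xz)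

-- Division is postponed to the end: weights are natural numbers on all permutations, zero outside
-- the interval, so that exchanging two values reindexes every sum. For chains the exchange cannot
-- keep the marked word. A chain marked at `u`, with `x` just before `y`, leaves that order only at
-- a later word `m`; its partner exchanges the two letters already at `u`, follows the exchanged
-- stretch and is marked at the image of `m`. Hence a statistic may enter the symmetry only if it
-- agrees at `u` and `m`. The statistics come from the walk between `x₀` and `y₀`, on which the
-- changes of type in one direction exceed those in the other by one. Each change between letters
-- `x` and `y` is recorded by two comparisons of positions, of `x` with `x₀` and of `y` with `y₀`.
-- Under the symmetry a comparison is added to its opposite, so a pair contributes a constant. The
-- comparisons being weak, this constant is larger by one for each of the equalities `x = x₀` and
-- `y = y₀`, and only these excesses survive the cancellation.

-- Indicators and finite sums

opaque

  -- Iverson bracket. Cardinalities become sums of these, and double counting becomes an exchange of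
  -- sums.
  ⟦_⟧ : {P : Set} → Dec P → ℕ
  ⟦ P? ⟧ = if does P? then 1 else 0

  ⟦⟧-yes : {P : Set} (P? : Dec P) → P → ⟦ P? ⟧ ≡ 1
  ⟦⟧-yes P? p = cong (if_then 1 else 0) (dec-true P? p)

  ⟦⟧-no : {P : Set} (P? : Dec P) → ¬ P → ⟦ P? ⟧ ≡ 0
  ⟦⟧-no P? ¬p = cong (if_then 1 else 0) (dec-false P? ¬p)

  -- The indicator supplies the hypothesis: the other factors need to agree only where it is
  -- nonzero.
  ⟦⟧-*-cong : {P : Set} (P? : Dec P) {a b : ℕ} → (P → a ≡ b) → ⟦ P? ⟧ * a ≡ ⟦ P? ⟧ * b
  ⟦⟧-*-cong (yes p) eq = cong (_+ 0) (eq p)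
  ⟦⟧-*-cong (no _)  eq = refl

  ⟦⟧-*-vanish : {P : Set} (P? : Dec P) {a : ℕ} → (P → a ≡ 0) → ⟦ P? ⟧ * a ≡ 0
  ⟦⟧-*-vanish P? eq = trans (⟦⟧-*-cong P? eq) (ℕ.*-zeroʳ ⟦ P? ⟧)

  ⟦⟧-*-≤ : {P : Set} (P? : Dec P) (a : ℕ) → ⟦ P? ⟧ * a ≤ a
  ⟦⟧-*-≤ (yes _) a = ℕ.≤-reflexive (ℕ.*-identityˡ a)
  ⟦⟧-*-≤ (no _)  a = z≤n

  ⟦⟧-⇔ : {P Q : Set} (P? : Dec P) (Q? : Dec Q) → (P → Q) → (Q → P) → ⟦ P? ⟧ ≡ ⟦ Q? ⟧
  ⟦⟧-⇔ (yes p) Q? f g = sym (⟦⟧-yes Q? (f p))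
  ⟦⟧-⇔ (no ¬p) Q? f g = sym (⟦⟧-no Q? (¬p ∘ g))

  ⟦⟧-× : {P Q : Set} (P? : Dec P) (Q? : Dec Q) → ⟦ P? ×-dec Q? ⟧ ≡ ⟦ P? ⟧ * ⟦ Q? ⟧
  ⟦⟧-× (yes _) (yes _) = refl
  ⟦⟧-× (yes _) (no _)  = refl
  ⟦⟧-× (no _)  _       = refl

  ⟦⟧-disjoint : {P Q R : Set} (P? : Dec P) (Q? : Dec Q) (R? : Dec R) →
                (P → R) → (Q → R) → (P → ¬ Q) → ⟦ P? ⟧ + ⟦ Q? ⟧ ≤ ⟦ R? ⟧
  ⟦⟧-disjoint (yes p) (yes q) R? f g disj = contradiction q (disj p)
  ⟦⟧-disjoint (yes p) (no _)  R? f g disj = ℕ.≤-reflexive (sym (⟦⟧-yes R? (f p)))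
  ⟦⟧-disjoint (no _)  (yes q) R? f g disj = ℕ.≤-reflexive (sym (⟦⟧-yes R? (g q)))
  ⟦⟧-disjoint (no _)  (no _)  R? f g disj = z≤n

module _ {A : Set} where

  ∑ : List A → (A → ℕ) → ℕ
  ∑ xs f = sum (map f xs)

  infix 5 ∑
  syntax ∑ xs (λ x → e) = ∑[ x ∈ xs ] e

  ∑-cong : {f g : A → ℕ} → (∀ x → f x ≡ g x) → ∀ xs → ∑ xs f ≡ ∑ xs g
  ∑-cong f≗g xs = cong sum (List.map-cong f≗g xs)

  ∑-0 : ∀ xs → ∑ xs (λ (_ : A) → 0) ≡ 0
  ∑-0 []       = refl
  ∑-0 (_ ∷ xs) = ∑-0 xs

  ∑-vanish : {f : A → ℕ} → (∀ x → f x ≡ 0) → ∀ xs → ∑ xs f ≡ 0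
  ∑-vanish f≗0 xs = trans (∑-cong f≗0 xs) (∑-0 xs)

  ∑-+ : (f g : A → ℕ) → ∀ xs → (∑[ x ∈ xs ] (f x + g x)) ≡ ∑ xs f + ∑ xs g
  ∑-+ f g []       = refl
  ∑-+ f g (x ∷ xs) = trans (cong (f x + g x +_) (∑-+ f g xs)) (interchange (f x) (g x) _ _)

  ∑-*ˡ : ∀ c (f : A → ℕ) xs → (∑[ x ∈ xs ] (c * f x)) ≡ c * ∑ xs f
  ∑-*ˡ c f []       = sym (ℕ.*-zeroʳ c)
  ∑-*ˡ c f (x ∷ xs) = trans (cong (c * f x +_) (∑-*ˡ c f xs)) (sym (ℕ.*-distribˡ-+ c (f x) _))

  ∑-*ʳ : ∀ c (f : A → ℕ) xs → (∑[ x ∈ xs ] (f x * c)) ≡ ∑ xs f * c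
  ∑-*ʳ c f xs = trans (∑-cong (λ x → ℕ.*-comm (f x) c) xs) (trans (∑-*ˡ c f xs) (ℕ.*-comm c _))

  ∑-++ : (f : A → ℕ) → ∀ xs ys → ∑ (xs ++ ys) f ≡ ∑ xs f + ∑ ys f
  ∑-++ f xs ys = trans (cong sum (List.map-++ f xs ys)) (sum-++ (map f xs) _)

  ∑-const : ∀ c xs → ∑ xs (λ (_ : A) → c) ≡ length xs * c
  ∑-const c []       = refl
  ∑-const c (_ ∷ xs) = cong (c +_) (∑-const c xs)

  opaque
    unfolding ⟦_⟧

    length-filter : {P : Pred A 0ℓ} (P? : Decidable P) → ∀ xs → length (filter P? xs) ≡ ∑[ x ∈ xs ] ⟦ P? x ⟧
    length-filter P? []       = refl
    length-filter P? (x ∷ xs) with P? x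
    ... | yes _ = cong suc (length-filter P? xs)
    ... | no  _ = length-filter P? xs

    ∑-filter : {P : Pred A 0ℓ} (P? : Decidable P) (f : A → ℕ) →
               ∀ xs → ∑ (filter P? xs) f ≡ ∑[ x ∈ xs ] (⟦ P? x ⟧ * f x)
    ∑-filter P? f []       = refl
    ∑-filter P? f (x ∷ xs) with P? x
    ... | yes _ = cong₂ _+_ (sym (ℕ.+-identityʳ (f x))) (∑-filter P? f xs)
    ... | no  _ = ∑-filter P? f xs

  ∑-mono : {f g : A → ℕ} → (∀ x → f x ≤ g x) → ∀ xs → ∑ xs f ≤ ∑ xs g
  ∑-mono f≤g []       = z≤n
  ∑-mono f≤g (x ∷ xs) = ℕ.+-mono-≤ (f≤g x) (∑-mono f≤g xs)

∑-map : {A B : Set} (g : B → A) (f : A → ℕ) → ∀ xs → ∑ (map g xs) f ≡ ∑[ x ∈ xs ] f (g x)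
∑-map g f xs = cong sum (sym (List.map-∘ xs))

∑-concatMap : {A B : Set} (g : B → List A) (f : A → ℕ) → ∀ xs → ∑ (concatMap g xs) f ≡ ∑[ x ∈ xs ] ∑ (g x) f
∑-concatMap g f []       = refl
∑-concatMap g f (x ∷ xs) = trans (∑-++ f (g x) _) (cong (∑ (g x) f +_) (∑-concatMap g f xs))

∑-swap : {A B : Set} (f : A → B → ℕ) → ∀ xs ys →
         (∑[ x ∈ xs ] ∑[ y ∈ ys ] f x y) ≡ (∑[ y ∈ ys ] ∑[ x ∈ xs ] f x y)
∑-swap f []       ys = sym (∑-0 ys)
∑-swap f (x ∷ xs) ys = trans (cong (∑ ys (f x) +_) (∑-swap f xs ys)) (sym (∑-+ (f x) _ ys))

-- Sums over a repetition-free enumeration up to equivalence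

module Enumerated (S : DecSetoid 0ℓ 0ℓ) (xs : List (DecSetoid.Carrier S))
                  (complete : Enumerates.IsEnumeration (DecSetoid.setoid S) xs)
                  (unique : Unique.Unique (DecSetoid.setoid S) xs) where

  open DecSetoid S using (_≈_; _≟_) renaming (Carrier to A)
  private module Eq = DecSetoid S

  Respectful : (A → ℕ) → Set
  Respectful f = ∀ {x y} → x ≈ y → f x ≡ f y

  ∑-δ-fresh : ∀ {u} (f : A → ℕ) {ys} → All (λ y → ¬ u ≈ y) ys → (∑[ v ∈ ys ] (⟦ u ≟ v ⟧ * f v)) ≡ 0
  ∑-δ-fresh         f []                        = refl
  ∑-δ-fresh {u = u} f {ys = y ∷ _} (u≉y ∷ u∉ys) =
    cong₂ _+_ (cong (_* f y) (⟦⟧-no (u ≟ y) u≉y)) (∑-δ-fresh f u∉ys)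

  ∑-δ : ∀ u {f} → Respectful f → (∑[ v ∈ xs ] (⟦ u ≟ v ⟧ * f v)) ≡ f u
  ∑-δ u {f} resp = go unique (complete u)
    where
    go : ∀ {ys} → AllPairs (λ x y → ¬ x ≈ y) ys → Any (u ≈_) ys → (∑[ v ∈ ys ] (⟦ u ≟ v ⟧ * f v)) ≡ f u
    go {y ∷ ys} (y∉ys ∷ _) (here u≈y) =
      trans (cong₂ _+_ (trans (cong (_* f y) (⟦⟧-yes (u ≟ y) u≈y)) (ℕ.*-identityˡ (f y)))
                       (∑-δ-fresh f (All.map (λ y≉z u≈z → y≉z (Eq.trans (Eq.sym u≈y) u≈z)) y∉ys)))
            (trans (ℕ.+-identityʳ (f y)) (resp (Eq.sym u≈y)))
    go {y ∷ ys} (y∉ys ∷ ys!) (there u∈ys) =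
      cong₂ _+_ (cong (_* f y) (⟦⟧-no (u ≟ y) (λ u≈y → absurd y∉ys u∈ys u≈y))) (go ys! u∈ys)
      where
      absurd : ∀ {zs} → All (λ z → ¬ y ≈ z) zs → Any (u ≈_) zs → ¬ (u ≈ y)
      absurd (y≉z ∷ _) (here u≈z)  u≈y = y≉z (Eq.trans (Eq.sym u≈y) u≈z)
      absurd (_ ∷ ys)  (there u∈) u≈y = absurd ys u∈ u≈y

  ∑-δ1 : ∀ u → (∑[ v ∈ xs ] ⟦ u ≟ v ⟧) ≡ 1
  ∑-δ1 u = trans (∑-cong (λ v → sym (ℕ.*-identityʳ ⟦ u ≟ v ⟧)) xs) (∑-δ u (λ _ → refl))

  -- Expand `f (φ u)` against the indicator of `φ u ≈ v` and exchange the sums: every `v` is then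
  -- hit exactly once, by `ψ v`. The two maps need to be inverse only up to `_≈_`.
  ∑-reindex : ∀ {f} → Respectful f → (φ ψ : A → A) →
              (∀ {u v} → φ u ≈ v → ψ v ≈ u) → (∀ {u v} → ψ v ≈ u → φ u ≈ v) →
              (∑[ u ∈ xs ] f (φ u)) ≡ ∑ xs f
  ∑-reindex {f} resp φ ψ φ⇒ψ ψ⇒φ = begin
    (∑[ u ∈ xs ] f (φ u))  ≡⟨ ∑-cong (λ u → sym (∑-δ (φ u) resp)) xs ⟩
    (∑[ u ∈ xs ] ∑[ v ∈ xs ] (⟦ φ u ≟ v ⟧ * f v))  ≡⟨ ∑-swap (λ u v → ⟦ φ u ≟ v ⟧ * f v) xs xs ⟩
    (∑[ v ∈ xs ] ∑[ u ∈ xs ] (⟦ φ u ≟ v ⟧ * f v))  ≡⟨ ∑-cong (λ v → ∑-*ʳ (f v) (λ u → ⟦ φ u ≟ v ⟧) xs) xs ⟩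
    (∑[ v ∈ xs ] ((∑[ u ∈ xs ] ⟦ φ u ≟ v ⟧) * f v))  ≡⟨ ∑-cong (λ v → cong (_* f v) (count v)) xs ⟩
    (∑[ v ∈ xs ] (1 * f v))  ≡⟨ ∑-cong (λ v → ℕ.*-identityˡ (f v)) xs ⟩
    ∑ xs f  ∎
    where
    open ≡-Reasoning
    count : ∀ v → (∑[ u ∈ xs ] ⟦ φ u ≟ v ⟧) ≡ 1
    count v = trans (∑-cong (λ u → ⟦⟧-⇔ (φ u ≟ v) (ψ v ≟ u) φ⇒ψ ψ⇒φ) xs) (∑-δ1 (ψ v))

  -- Serves for partial functions, such as the neighbour of a letter in a word: `P` says when the
  -- unique solution of `Q` exists.
  ∑-∃! : ∀ {P : Set} {Q : A → Set} (P? : Dec P) (Q? : ∀ x → Dec (Q x)) →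
         (∀ {x y} → x ≈ y → Q x → Q y) → (∀ {x y} → Q x → Q y → x ≈ y) →
         (P → Any Q xs) → (∀ {x} → Q x → P) → (∑[ x ∈ xs ] ⟦ Q? x ⟧) ≡ ⟦ P? ⟧
  ∑-∃! P? Q? resp uniq wit back with P?
  ... | no ¬p = trans (∑-vanish (λ x → ⟦⟧-no (Q? x) (λ q → ¬p (back q))) xs) (sym (⟦⟧-no (no ¬p) ¬p))
  ... | yes p = trans (go (satisfied (wit p))) (sym (⟦⟧-yes (yes p) p))
    where
    go : ∃ _ → (∑[ x ∈ xs ] ⟦ Q? x ⟧) ≡ 1
    go (x , qx) = trans (∑-cong (λ y → ⟦⟧-⇔ (Q? y) (x ≟ y) (uniq qx) (λ x≈y → resp x≈y qx)) xs) (∑-δ1 x)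

  ∑-≥ : ∀ u {f} → Respectful f → f u ≤ ∑ xs f
  ∑-≥ u {f} resp = ℕ.≤-trans (ℕ.≤-reflexive (sym (∑-δ u resp))) (∑-mono le xs)
    where
    le : ∀ v → ⟦ u ≟ v ⟧ * f v ≤ f v
    le v = ⟦⟧-*-≤ (u ≟ v) (f v)

module FinSum (n : ℕ) =
  Enumerated (≡-decSetoid (Fin._≟_ {n})) (allFin n) ∈-allFin (Unique≡ₚ.allFin⁺ n)

-- Fractions of natural numbers

÷-cong : ∀ {m m′} d d′ → m * suc d′ ≡ m′ * suc d → m ÷ suc d ≡ m′ ÷ suc d′
÷-cong {m} {m′} d d′ eq = ℚ.fromℚᵘ-cong {mkℚᵘ (ℤ.+ m) d} {mkℚᵘ (ℤ.+ m′) d′}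
  (*≡* (trans (sym (ℤ.pos-* m (suc d′))) (trans (cong ℤ.+_ eq) (ℤ.pos-* m′ (suc d)))))

fromℚᵘ-homo-+ : ∀ p q → fromℚᵘ p ℚ.+ fromℚᵘ q ≡ fromℚᵘ (p ℚᵘ.+ q)
fromℚᵘ-homo-+ p q = ℚ.toℚᵘ-injective (begin
  toℚᵘ (fromℚᵘ p ℚ.+ fromℚᵘ q)           ≈⟨ ℚ.toℚᵘ-homo-+ (fromℚᵘ p) (fromℚᵘ q) ⟩
  toℚᵘ (fromℚᵘ p) ℚᵘ.+ toℚᵘ (fromℚᵘ q)   ≈⟨ ℚᵘ.+-cong (ℚ.toℚᵘ-fromℚᵘ p) (ℚ.toℚᵘ-fromℚᵘ q) ⟩
  p ℚᵘ.+ q                               ≈⟨ ℚᵘ.≃-sym (ℚ.toℚᵘ-fromℚᵘ (p ℚᵘ.+ q)) ⟩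
  toℚᵘ (fromℚᵘ (p ℚᵘ.+ q))  ∎)
  where open ℚᵘ.≃-Reasoning

fromℚᵘ-homo-* : ∀ p q → fromℚᵘ p ℚ.* fromℚᵘ q ≡ fromℚᵘ (p ℚᵘ.* q)
fromℚᵘ-homo-* p q = ℚ.toℚᵘ-injective (begin
  toℚᵘ (fromℚᵘ p ℚ.* fromℚᵘ q)           ≈⟨ ℚ.toℚᵘ-homo-* (fromℚᵘ p) (fromℚᵘ q) ⟩
  toℚᵘ (fromℚᵘ p) ℚᵘ.* toℚᵘ (fromℚᵘ q)   ≈⟨ ℚᵘ.*-cong (ℚ.toℚᵘ-fromℚᵘ p) (ℚ.toℚᵘ-fromℚᵘ q) ⟩
  p ℚᵘ.* q                               ≈⟨ ℚᵘ.≃-sym (ℚ.toℚᵘ-fromℚᵘ (p ℚᵘ.* q)) ⟩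
  toℚᵘ (fromℚᵘ (p ℚᵘ.* q))  ∎)
  where open ℚᵘ.≃-Reasoning

÷-+ : ∀ m m′ d → (m ÷ suc d) ℚ.+ (m′ ÷ suc d) ≡ (m + m′) ÷ suc d
÷-+ m m′ d = trans (fromℚᵘ-homo-+ (mkℚᵘ (ℤ.+ m) d) (mkℚᵘ (ℤ.+ m′) d))
  (ℚ.fromℚᵘ-cong {mkℚᵘ (ℤ.+ m) d ℚᵘ.+ mkℚᵘ (ℤ.+ m′) d} {mkℚᵘ (ℤ.+ (m + m′)) d} (*≡* (begin
    (ℤ.+ m ℤ.* D ℤ.+ ℤ.+ m′ ℤ.* D) ℤ.* D  ≡⟨ cong (ℤ._* D) (sym (ℤ.*-distribʳ-+ D (ℤ.+ m) (ℤ.+ m′))) ⟩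
    (ℤ.+ m ℤ.+ ℤ.+ m′) ℤ.* D ℤ.* D  ≡⟨ ℤ.*-assoc (ℤ.+ m ℤ.+ ℤ.+ m′) D D ⟩
    ℤ.+ (m + m′) ℤ.* (D ℤ.* D)  ∎)))
  where
  open ≡-Reasoning
  D = ℤ.+ suc d

÷-* : ∀ m k d → (m ÷ suc d) ℚ.* (k ÷ 1) ≡ (m * k) ÷ suc d
÷-* m k d = trans (fromℚᵘ-homo-* (mkℚᵘ (ℤ.+ m) d) (mkℚᵘ (ℤ.+ k) 0))
  (ℚ.fromℚᵘ-cong {mkℚᵘ (ℤ.+ m) d ℚᵘ.* mkℚᵘ (ℤ.+ k) 0} {mkℚᵘ (ℤ.+ (m * k)) d}
    (*≡* (cong₂ ℤ._*_ (sym (ℤ.pos-* m k)) (cong (λ e → ℤ.+ suc e) (sym (ℕ.*-identityʳ d))))))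

sumℚ-÷ : ∀ {A : Set} (m k : A → ℕ) d xs →
         sumℚ (map (λ x → (m x ÷ suc d) ℚ.* (k x ÷ 1)) xs) ≡ (∑[ x ∈ xs ] (m x * k x)) ÷ suc d
sumℚ-÷ m k d []       = ÷-cong {0} {0} 0 d refl
sumℚ-÷ m k d (x ∷ xs) = trans (cong₂ ℚ._+_ (÷-* (m x) (k x) d) (sumℚ-÷ m k d xs)) (÷-+ (m x * k x) _ d)

-- Saturated chains and maximal chains of a finite poset

module Paths (Q : FinitePoset) where
  open FinitePoset Q renaming (_≤_ to _≤ₚ_; refl to ≤ₚ-refl; trans to ≤ₚ-trans; reflexive to ≤ₚ-reflexive; antisym to ≤ₚ-antisym)
  open CDE Q using (_≺?_; _⋖?_)
  open Enumerated Eq.decSetoid elements complete unique public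

  ≺-trans : ∀ {x y z} → x ≺ y → y ≺ z → x ≺ z
  ≺-trans (x≤y , x≉y) (y≤z , _) =
    ≤ₚ-trans x≤y y≤z , λ x≈z → x≉y (≤ₚ-antisym x≤y (≤ₚ-trans y≤z (≤ₚ-reflexive (Eq.sym x≈z))))

  ≺-resp : ∀ {x x′ y y′} → x ≈ x′ → y ≈ y′ → x ≺ y → x′ ≺ y′
  ≺-resp x≈x′ y≈y′ (x≤y , x≉y) =
    ≤-respʳ-≈ y≈y′ (≤-respˡ-≈ x≈x′ x≤y) , λ x′≈y′ → x≉y (Eq.trans x≈x′ (Eq.trans x′≈y′ (Eq.sym y≈y′)))

  ⋖-resp : ∀ {x x′ y y′} → x ≈ x′ → y ≈ y′ → x ⋖ y → x′ ⋖ y′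
  ⋖-resp x≈x′ y≈y′ (x≺y , empty) =
    ≺-resp x≈x′ y≈y′ x≺y ,
    λ z (x′≺z , z≺y′) → empty z (≺-resp (Eq.sym x≈x′) Eq.refl x′≺z , ≺-resp Eq.refl (Eq.sym y≈y′) z≺y′)

  opaque

    -- A strictly monotone measure, not necessarily a rank function; it bounds all recursion along
    -- `_≺_`.
    height : Carrier → ℕ
    height v = ∑[ z ∈ elements ] ⟦ z ≺? v ⟧

    height-mono : ∀ {u v} → u ≺ v → height u < height v
    height-mono {u} {v} u≺v = begin
      suc (height u)  ≡⟨ cong (_+ height u) (sym (∑-δ1 u)) ⟩
      (∑[ z ∈ elements ] ⟦ u ≟ z ⟧) + (∑[ z ∈ elements ] ⟦ z ≺? u ⟧)  ≡⟨ sym (∑-+ _ _ elements) ⟩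
      (∑[ z ∈ elements ] (⟦ u ≟ z ⟧ + ⟦ z ≺? u ⟧))  ≤⟨ ∑-mono step elements ⟩
      height v  ∎
      where
      open ℕ.≤-Reasoning
      step : ∀ z → ⟦ u ≟ z ⟧ + ⟦ z ≺? u ⟧ ≤ ⟦ z ≺? v ⟧
      step z = ⟦⟧-disjoint (u ≟ z) (z ≺? u) (z ≺? v)
        (λ u≈z → ≺-resp u≈z Eq.refl u≺v) (λ z≺u → ≺-trans z≺u u≺v) (λ u≈z (_ , z≉u) → z≉u (Eq.sym u≈z))

  ≺-rec : (R : Carrier → Set) → (∀ v → (∀ m → m ≺ v → R m) → R v) → ∀ v → R v
  ≺-rec R step v = go (suc (height v)) v ℕ.≤-refl
    where
    go : ∀ k v → height v < k → R v
    go (suc k) v (s≤s hv≤k) = step v (λ m m≺v → go k m (ℕ.<-≤-trans (height-mono m≺v) hv≤k))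

  opaque

    -- The number of saturated chains from u to v, provided that k exceeds the height of v.
    pathsWithin : ℕ → Carrier → Carrier → ℕ
    pathsWithin zero    u v = 0
    pathsWithin (suc k) u v = ⟦ u ≟ v ⟧ + (∑[ m ∈ elements ] (⟦ m ⋖? v ⟧ * pathsWithin k u m))

    paths : Carrier → Carrier → ℕ
    paths u v = pathsWithin (suc (height v)) u v

    pathsWithin-stable : ∀ {k l} u v → height v < k → height v < l → pathsWithin k u v ≡ pathsWithin l u v
    pathsWithin-stable {suc k} {suc l} u v (s≤s v≤k) (s≤s v≤l) = cong (⟦ u ≟ v ⟧ +_)
      (∑-cong (λ m → ⟦⟧-*-cong (m ⋖? v) λ (m≺v , _) →
        pathsWithin-stable u m (ℕ.<-≤-trans (height-mono m≺v) v≤k) (ℕ.<-≤-trans (height-mono m≺v) v≤l)) elements)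

    paths-rec : ∀ u v → paths u v ≡ ⟦ u ≟ v ⟧ + (∑[ m ∈ elements ] (⟦ m ⋖? v ⟧ * paths u m))
    paths-rec u v = cong (⟦ u ≟ v ⟧ +_)
      (∑-cong (λ m → ⟦⟧-*-cong (m ⋖? v) λ (m≺v , _) →
        pathsWithin-stable u m (height-mono m≺v) ℕ.≤-refl) elements)

  paths-resp : ∀ {u u′ v v′} → u ≈ u′ → v ≈ v′ → paths u v ≡ paths u′ v′
  paths-resp {u} {u′} {v} {v′} u≈u′ v≈v′ = ≺-rec R step v v′ v≈v′
    where
    R : Carrier → Set
    R v = ∀ v′ → v ≈ v′ → paths u v ≡ paths u′ v′
    step : ∀ v → (∀ m → m ≺ v → R m) → R v
    step v ih v′ v≈v′ = trans (paths-rec u v) (trans (cong₂ _+_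
      (⟦⟧-⇔ (u ≟ v) (u′ ≟ v′) (λ u≈v → Eq.trans (Eq.sym u≈u′) (Eq.trans u≈v v≈v′))
                              (λ u′≈v′ → Eq.trans u≈u′ (Eq.trans u′≈v′ (Eq.sym v≈v′))))
      (∑-cong (λ m → trans (⟦⟧-*-cong (m ⋖? v) (λ (m≺v , _) → ih m m≺v m Eq.refl))
        (cong (_* paths u′ m) (⟦⟧-⇔ (m ⋖? v) (m ⋖? v′) (⋖-resp Eq.refl v≈v′) (⋖-resp Eq.refl (Eq.sym v≈v′)))))
        elements))
      (sym (paths-rec u′ v′)))

  ∑-paths-vanish : ∀ u v → ¬ u ≺ v → (∑[ m ∈ elements ] (⟦ m ⋖? v ⟧ * paths u m)) ≡ 0
  paths-vanish : ∀ u v → ¬ u ≤ₚ v → paths u v ≡ 0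
  paths-vanish u = ≺-rec (λ v → ¬ u ≤ₚ v → paths u v ≡ 0) λ v ih u≰v →
    trans (paths-rec u v) (cong₂ _+_ (⟦⟧-no (u ≟ v) (u≰v ∘ ≤ₚ-reflexive))
      (∑-vanish (λ m → ⟦⟧-*-vanish (m ⋖? v) λ (m≺v , _) →
        ih m m≺v (λ u≤m → u≰v (≤ₚ-trans u≤m (proj₁ m≺v)))) elements))
  ∑-paths-vanish u v u⊀v = ∑-vanish (λ m → ⟦⟧-*-vanish (m ⋖? v) λ ((m≤v , m≉v) , _) →
    paths-vanish u m (λ u≤m → u⊀v (≤ₚ-trans u≤m m≤v ,
      λ u≈v → m≉v (≤ₚ-antisym m≤v (≤-respˡ-≈ u≈v u≤m))))) elements

  paths-≈ : ∀ {u v} → u ≈ v → paths u v ≡ 1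
  paths-≈ {u} {v} u≈v = trans (paths-rec u v)
    (cong₂ _+_ (⟦⟧-yes (u ≟ v) u≈v) (∑-paths-vanish u v (λ (_ , u≉v) → u≉v u≈v)))

  module _ {R : Pred Carrier 0ℓ} (R? : Decidable R) (R-resp : ∀ {x y} → x ≈ y → R x → R y) where

    maximalIn : ∀ xs → Any R xs → ∃ λ m → Any (m ≡_) xs × R m × All (λ z → R z → ¬ m ≺ z) xs
    maximalIn (x ∷ xs) any with any? R? xs | any
    ... | no none | there some = contradiction some none
    ... | no none | here rx    = x , here refl , rx ,
      (λ _ (_ , x≉x) → x≉x Eq.refl) ∷ All.map (λ ¬rz rz → contradiction rz ¬rz) (¬Any⇒All¬ xs none)
    ... | yes some | _ with maximalIn xs some | R? x
    ...   | (m , m∈ , rm , max) | no ¬rx = m , there m∈ , rm , (λ rx → contradiction rx ¬rx) ∷ max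
    ...   | (m , m∈ , rm , max) | yes rx with m ≺? x
    ...     | no m⊀x  = m , there m∈ , rm , (λ _ → m⊀x) ∷ max
    ...     | yes m≺x = x , here refl , rx ,
      (λ _ (_ , x≉x) → x≉x Eq.refl) ∷ All.map (λ h rz x≺z → h rz (≺-trans m≺x x≺z)) max

    maximal : ∀ xs → Any R xs →
              ∃ λ m → Any (m ≡_) xs × R m × (∀ {z} → Any (z ≈_) xs → R z → ¬ m ≺ z)
    maximal xs some = let (m , m∈ , rm , max) = maximalIn xs some in
      m , m∈ , rm , λ z∈ rz m≺z → let (h , z≈) = All.lookupAny max z∈ in
        h (R-resp z≈ rz) (≺-resp Eq.refl z≈ m≺z)

  -- A maximal element of the half-open interval from `u` up to `v` is covered by `v`, since
  -- anything strictly between would lie in the same set.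
  ∃-coatom : ∀ {u v} → u ≺ v → ∃ λ m → u ≤ₚ m × m ⋖ v
  ∃-coatom {u} {v} u≺v = let (m , _ , (u≤m , m≺v) , max) = found in
    m , u≤m , m≺v , λ z (m≺z , z≺v) → max (complete z) (≤ₚ-trans u≤m (proj₁ m≺z) , z≺v) m≺z
    where
    found = maximal {R = λ z → u ≤ₚ z × z ≺ v} (λ z → (u ≤? z) ×-dec (z ≺? v))
      (λ x≈y (u≤x , x≺v) → ≤-respʳ-≈ x≈y u≤x , ≺-resp x≈y Eq.refl x≺v)
      elements (Any.map (λ u≈z → ≤ₚ-reflexive u≈z , ≺-resp u≈z Eq.refl u≺v) (complete u))

  paths-positive : ∀ u v → u ≤ₚ v → 0 < paths u v
  paths-positive u = ≺-rec (λ v → u ≤ₚ v → 0 < paths u v) step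
    where
    step : ∀ v → (∀ m → m ≺ v → u ≤ₚ m → 0 < paths u m) → u ≤ₚ v → 0 < paths u v
    step v ih u≤v with u ≟ v
    ... | yes u≈v = ℕ.≤-reflexive (sym (paths-≈ u≈v))
    ... | no u≉v = let (m , u≤m , m⋖v) = ∃-coatom (u≤v , u≉v) in begin
      1  ≤⟨ ih m (proj₁ m⋖v) u≤m ⟩
      paths u m  ≡⟨ sym (ℕ.*-identityˡ _) ⟩
      1 * paths u m  ≡⟨ cong (_* paths u m) (sym (⟦⟧-yes (m ⋖? v) m⋖v)) ⟩
      ⟦ m ⋖? v ⟧ * paths u m  ≤⟨ ∑-≥ m (λ {x} {y} x≈y → cong₂ _*_
                                                                 (⟦⟧-⇔ (x ⋖? v) (y ⋖? v) (⋖-resp x≈y Eq.refl) (⋖-resp (Eq.sym x≈y) Eq.refl))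
                                                                 (paths-resp Eq.refl x≈y)) ⟩
      (∑[ m ∈ elements ] (⟦ m ⋖? v ⟧ * paths u m))  ≤⟨ ℕ.m≤n+m _ ⟦ u ≟ v ⟧ ⟩
      ⟦ u ≟ v ⟧ + (∑[ m ∈ elements ] (⟦ m ⋖? v ⟧ * paths u m)) ≡⟨ sym (paths-rec u v) ⟩
      paths u v  ∎
      where open ℕ.≤-Reasoning

-- Sublists of a list without repetitions

open ≡ₗ using () renaming (_∈_ to _∈≡_)

module _ {A : Set} where

  AllPairs-strengthen : {P : A → Set} {R S : A → A → Set} → (∀ {x y} → P x → P y → R x y → S x y) →
                        ∀ {xs} → All P xs → AllPairs R xs → AllPairs S xs
  AllPairs-strengthen f []         []         = []
  AllPairs-strengthen f (px ∷ pxs) (rx ∷ rxs) =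
    All.zipWith (λ (py , rxy) → f px py rxy) (pxs , rx) ∷ AllPairs-strengthen f pxs rxs

  AllPairs-full : {P : A → Set} {R : A → A → Set} → (∀ {x y} → P x → P y → R x y) →
                  ∀ {xs} → All P xs → AllPairs R xs
  AllPairs-full f []         = []
  AllPairs-full f (px ∷ pxs) = All.map (f px) pxs ∷ AllPairs-full f pxs

  AllPairs-lookup : {R : A → A → Set} → (∀ {x} → R x x) → (∀ {x y} → R x y → R y x) →
                    ∀ {xs} → AllPairs R xs → ∀ {x y} → x ∈≡ xs → y ∈≡ xs → R x y
  AllPairs-lookup r s (_ ∷ _)   (here refl) (here refl) = r
  AllPairs-lookup r s (rx ∷ _)  (here refl) (there y∈)  = All.lookup rx y∈
  AllPairs-lookup r s (rx ∷ _)  (there x∈)  (here refl) = s (All.lookup rx x∈)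
  AllPairs-lookup r s (_ ∷ rxs) (there x∈)  (there y∈)  = AllPairs-lookup r s rxs x∈ y∈

  filter∈sublists : {P : Pred A 0ℓ} (P? : Decidable P) → ∀ xs → filter P? xs ∈≡ sublists xs
  filter∈sublists P? []       = here refl
  filter∈sublists P? (x ∷ xs) with P? x
  ... | yes _ = ∈-++⁺ˡ (∈-map⁺ (x ∷_) (filter∈sublists P? xs))
  ... | no  _ = ∈-++⁺ʳ (map (x ∷_) (sublists xs)) (filter∈sublists P? xs)

  sublists-All : ∀ {C} (xs : List A) → C ∈≡ sublists xs → All (_∈≡ xs) C
  sublists-All []       (here refl) = []
  sublists-All (x ∷ xs) C∈ with ∈-++⁻ (map (x ∷_) (sublists xs)) C∈
  ... | inj₂ C∈′ = All.map there (sublists-All xs C∈′)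
  ... | inj₁ C∈′ with ∈-map⁻ (x ∷_) C∈′
  ...   | (D , D∈ , refl) = here refl ∷ All.map there (sublists-All xs D∈)

  sublists-unique : ∀ {xs} → AllPairs _≢_ xs → AllPairs _≢_ (sublists xs)
  sublists-unique []                       = [] ∷ []
  sublists-unique {x ∷ xs} (x∉xs ∷ xs!) = AllPairs.++⁺
    (AllPairs.map⁺ (AllPairs.map (_∘ ∷-injectiveʳ) (sublists-unique xs!)))
    (sublists-unique xs!)
    (All.map⁺ (All.tabulate λ _ → All.tabulate λ where
      D∈ refl → All.lookup x∉xs (All.head (sublists-All xs D∈)) refl))

  -- A sublist keeps the order of the list, so without repetitions it is determined by its set of
  -- members.
  sublist-determined : {P : Pred A 0ℓ} (P? : Decidable P) → ∀ {C} xs → AllPairs _≢_ xs → C ∈≡ sublists xs →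
                       (∀ {x} → x ∈≡ C → P x) → (∀ {x} → x ∈≡ xs → P x → x ∈≡ C) → C ≡ filter P? xs
  sublist-determined P? []       _ (here refl) _ _ = refl
  sublist-determined P? (x ∷ xs) (x∉xs ∷ xs!) C∈ C⊆P P⊆C with ∈-++⁻ (map (x ∷_) (sublists xs)) C∈
  ... | inj₂ C∈′ = trans
    (sublist-determined P? xs xs! C∈′ C⊆P (P⊆C ∘ there))
    (sym (filter-reject P? (λ px → All.lookup x∉xs (All.lookup (sublists-All xs C∈′) (P⊆C (here refl) px)) refl)))
  ... | inj₁ C∈′ with ∈-map⁻ (x ∷_) C∈′
  ...   | (D , D∈ , refl) = trans
    (cong (x ∷_) (sublist-determined P? xs xs! D∈ (C⊆P ∘ there)
      (λ {y} y∈ py → Any.tail (λ y≡x → All.lookup x∉xs y∈ (sym y≡x)) (P⊆C (there y∈) py))))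
    (sym (filter-accept P? (C⊆P (here refl))))

-- Maximal chains as saturated chains from bottom to top

module MaximalChains (Q : FinitePoset) (bot top : FinitePoset.Carrier Q)
                     (bot≤ : ∀ v → FinitePoset._≤_ Q bot v) (≤top : ∀ v → FinitePoset._≤_ Q v top) where
  open FinitePoset Q
    renaming (_≤_ to _≤ₚ_; refl to ≤ₚ-refl; trans to ≤ₚ-trans; reflexive to ≤ₚ-reflexive; antisym to ≤ₚ-antisym)
  open CDE Q
  open Paths Q
  open DecMembership Eq.decSetoid using (_∈_; _∈?_)

  elements-≢ : AllPairs _≢_ elements
  elements-≢ = AllPairs.map (λ x≉y x≡y → x≉y (Eq.reflexive x≡y)) unique

  ∈-resp : ∀ {x y xs} → x ≈ y → x ∈ xs → y ∈ xs
  ∈-resp x≈y = Any.map (Eq.trans (Eq.sym x≈y))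

  ≡⇒∈ : ∀ {x xs} → x ∈≡ xs → x ∈ xs
  ≡⇒∈ = Any.map λ { refl → Eq.refl }

  ∈⇒≡ : ∀ {x xs} → x ∈ xs → ∃ λ y → y ∈≡ xs × x ≈ y
  ∈⇒≡ (here x≈y)  = _ , here refl , x≈y
  ∈⇒≡ (there x∈) = let (y , y∈ , x≈y) = ∈⇒≡ x∈ in y , there y∈ , x≈y

  Comparable : Carrier → Carrier → Set
  Comparable x y = x ≤ₚ y ⊎ y ≤ₚ x

  Comparable-resp : ∀ {x x′ y y′} → x ≈ x′ → y ≈ y′ → Comparable x y → Comparable x′ y′
  Comparable-resp x≈ y≈ = Sum.map (≤-respʳ-≈ y≈ ∘ ≤-respˡ-≈ x≈) (≤-respʳ-≈ x≈ ∘ ≤-respˡ-≈ y≈)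

  chain-comparable : ∀ {C} → Chain C → ∀ {x y} → x ∈ C → y ∈ C → Comparable x y
  chain-comparable chain x∈ y∈ =
    let (x′ , x′∈ , x≈) = ∈⇒≡ x∈
        (y′ , y′∈ , y≈) = ∈⇒≡ y∈
    in Comparable-resp (Eq.sym x≈) (Eq.sym y≈) (AllPairs-lookup {R = Comparable} (inj₁ ≤ₚ-refl) Sum.swap chain x′∈ y′∈)

  _∩elements : List Carrier → List Carrier
  D ∩elements = filter (_∈? D) elements

  ∈-∩⁻ : ∀ {x D} → x ∈ D ∩elements → x ∈ D
  ∈-∩⁻ {D = D} x∈ = proj₂ (Membershipₚ.∈-filter⁻ Eq.setoid (_∈? D) ∈-resp {xs = elements} x∈)

  ∈-∩⁺ : ∀ {x D} → x ∈ D → x ∈ D ∩elements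
  ∈-∩⁺ {x} {D} x∈ = Membershipₚ.∈-filter⁺ Eq.setoid (_∈? D) ∈-resp (complete x) x∈

  ∩-chain : ∀ {D} → (∀ {x y} → x ∈ D → y ∈ D → Comparable x y) → Chain (D ∩elements)
  ∩-chain {D} cmp = AllPairs-full cmp (All.tabulate λ x∈ → ∈-∩⁻ {D = D} (≡⇒∈ x∈))

  module Maximal {C} (C∈ : C ∈≡ sublists elements) (C-max : MaximalChain C) where

    comparable : ∀ {x y} → x ∈ C → y ∈ C → Comparable x y
    comparable = chain-comparable (proj₁ C-max)

    -- Maximality speaks only of members of `sublists elements`, so it is tested on the chain
    -- `z ∷ C` relisted in the order of `elements`.
    absorbs : ∀ z → (∀ {c} → c ∈ C → Comparable z c) → z ∈ C
    absorbs z cmp = All.lookup (proj₂ C-max) (filter∈sublists (_∈? (z ∷ C)) elements)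
      (∩-chain cmp′) (λ c∈ → ∈-∩⁺ (there c∈)) (∈-∩⁺ (here Eq.refl))
      where
      cmp′ : ∀ {x y} → x ∈ z ∷ C → y ∈ z ∷ C → Comparable x y
      cmp′ (here x≈z)  (here y≈z)  = inj₁ (≤ₚ-reflexive (Eq.trans x≈z (Eq.sym y≈z)))
      cmp′ (here x≈z)  (there y∈)  = Comparable-resp (Eq.sym x≈z) Eq.refl (cmp y∈)
      cmp′ (there x∈)  (here y≈z)  = Sum.swap (Comparable-resp (Eq.sym y≈z) Eq.refl (cmp x∈))
      cmp′ (there x∈)  (there y∈)  = comparable x∈ y∈

  -- v ∷ s is a saturated chain listed downwards, ending at bot.
  Saturated : Carrier → List Carrier → Set
  Saturated v []      = bot ≈ v
  Saturated v (m ∷ s) = m ⋖ v × Saturated m s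

  saturated-≤ : ∀ {v q} s → Saturated v s → q ∈ v ∷ s → q ≤ₚ v
  saturated-≤ s       _           (here q≈v) = ≤ₚ-reflexive q≈v
  saturated-≤ (m ∷ s) (m⋖v , sat) (there q∈) = ≤ₚ-trans (saturated-≤ s sat q∈) (proj₁ (proj₁ m⋖v))

  saturated-comparable : ∀ {v p q} s → Saturated v s → p ∈ v ∷ s → q ∈ v ∷ s → Comparable p q
  saturated-comparable s sat (here p≈v) q∈ = inj₂ (≤-respʳ-≈ (Eq.sym p≈v) (saturated-≤ s sat q∈))
  saturated-comparable s sat (there p∈) (here q≈v) = inj₁ (≤-respʳ-≈ (Eq.sym q≈v) (saturated-≤ s sat (there p∈)))
  saturated-comparable (m ∷ s) (_ , sat) (there p∈) (there q∈) = saturated-comparable s sat p∈ q∈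

  -- Descend while `d` is below the next element. At the first cover `m ⋖ v` where it is not,
  -- comparability puts `d` between `m` and `v`, so it equals one of them; at the end of the chain
  -- only `bot` remains.
  saturated-absorbs : ∀ {v d} s → Saturated v s → d ≤ₚ v → (∀ {q} → q ∈ v ∷ s → Comparable d q) → d ∈ v ∷ s
  saturated-absorbs [] bot≈v d≤v _ = here (≤ₚ-antisym d≤v (≤ₚ-trans (≤ₚ-reflexive (Eq.sym bot≈v)) (bot≤ _)))
  saturated-absorbs {v} {d} (m ∷ s) (m⋖v , sat) d≤v cmp with cmp (there (here Eq.refl))
  ... | inj₁ d≤m = there (saturated-absorbs s sat d≤m (cmp ∘ there))
  ... | inj₂ m≤d with d ≟ v | m ≟ d
  ...   | yes d≈v | _       = here d≈v
  ...   | no _    | yes m≈d = there (here (Eq.sym m≈d))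
  ...   | no d≉v  | no m≉d  = contradiction ((m≤d , m≉d) , (d≤v , d≉v)) (proj₂ m⋖v d)

  -- `m` and `m′` are both the largest member other than the top, so equal sets of members force
  -- agreement from the top downwards.
  saturated-determined : ∀ {v v′} s s′ → v ≈ v′ → Saturated v s → Saturated v′ s′ →
                         (∀ {p} → p ∈ v ∷ s → p ∈ v′ ∷ s′) → (∀ {p} → p ∈ v′ ∷ s′ → p ∈ v ∷ s) →
                         Pointwise _≈_ s s′
  saturated-determined [] [] _ _ _ _ _ = []
  saturated-determined [] (m ∷ _) v≈v′ bot≈v (((m≤v′ , m≉v′) , _) , _) _ _ =
    contradiction (≤ₚ-antisym m≤v′ (≤-respˡ-≈ (Eq.trans bot≈v v≈v′) (bot≤ m))) m≉v′
  saturated-determined (m ∷ _) [] v≈v′ (((m≤v , m≉v) , _) , _) bot≈v′ _ _ =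
    contradiction (≤ₚ-antisym m≤v (≤-respˡ-≈ (Eq.trans bot≈v′ (Eq.sym v≈v′)) (bot≤ m))) m≉v
  saturated-determined {v} {v′} (m ∷ s) (m′ ∷ s′) v≈v′ (m⋖v , sat) (m′⋖v′ , sat′) to from =
    m≈m′ ∷ saturated-determined s s′ m≈m′ sat sat′
      (λ p∈ → Any.tail (below {s = s} sat m⋖v p∈ ∘ λ p≈v′ → Eq.trans p≈v′ (Eq.sym v≈v′)) (to (there p∈)))
      (λ p∈ → Any.tail (below {s = s′} sat′ m′⋖v′ p∈ ∘ λ p≈v → Eq.trans p≈v v≈v′) (from (there p∈)))
    where
    below : ∀ {v m s p} → Saturated m s → m ⋖ v → p ∈ m ∷ s → ¬ p ≈ v
    below {s = s} sat ((m≤v , m≉v) , _) p∈ p≈v =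
      m≉v (≤ₚ-antisym m≤v (≤-respˡ-≈ p≈v (saturated-≤ s sat p∈)))
    m≈m′ : m ≈ m′
    m≈m′ = ≤ₚ-antisym
      (saturated-≤ s′ sat′ (Any.tail (below {s = s} sat m⋖v (here Eq.refl) ∘ λ p≈v′ → Eq.trans p≈v′ (Eq.sym v≈v′)) (to (there (here Eq.refl)))))
      (saturated-≤ s sat (Any.tail (below {s = s′} sat′ m′⋖v′ (here Eq.refl) ∘ λ p≈v → Eq.trans p≈v v≈v′) (from (there (here Eq.refl)))))

  -- All `s` with `Saturated v s` and entries from `elements`, once the bound exceeds `height v`.
  -- The recursion is that of `pathsWithin`, which makes the two counts comparable.
  tailsWithin : ℕ → Carrier → List (List Carrier)
  tailsWithin zero    v = []
  tailsWithin (suc k) v = filter (λ _ → bot ≟ v) ([] ∷ []) ++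
                          concatMap (λ m → map (m ∷_) (tailsWithin k m)) (filter (_⋖? v) elements)

  tails-sound : ∀ k v {s} → s ∈≡ tailsWithin k v → Saturated v s × All (_∈≡ elements) s
  tails-sound (suc k) v s∈ with ∈-++⁻ (filter (λ _ → bot ≟ v) ([] ∷ [])) s∈
  ... | inj₁ s∈′ with ∈-filter⁻ (λ _ → bot ≟ v) {xs = [] ∷ []} s∈′
  ...   | (here refl , bot≈v) = bot≈v , []
  tails-sound (suc k) v s∈ | inj₂ s∈′ with ≡ₗ.find (∈-concatMap⁻ (λ m → map (m ∷_) (tailsWithin k m)) {xs = filter (_⋖? v) elements} s∈′)
  ... | (m , m∈ , s∈m) with ∈-map⁻ (m ∷_) s∈m | ∈-filter⁻ (_⋖? v) {xs = elements} m∈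
  ...   | (t , t∈ , refl) | (m∈′ , m⋖v) = let (sat , t⊆) = tails-sound k m t∈ in (m⋖v , sat) , m∈′ ∷ t⊆

  tails-complete : ∀ k v {s} → height v < k → Saturated v s → All (_∈≡ elements) s → s ∈≡ tailsWithin k v
  tails-complete (suc k) v {[]}    _         bot≈v       _        = ∈-++⁺ˡ (∈-filter⁺ (λ _ → bot ≟ v) (here refl) bot≈v)
  tails-complete (suc k) v {m ∷ s} (s≤s v≤k) (m⋖v , sat) (m∈ ∷ s⊆) =
    ∈-++⁺ʳ (filter (λ _ → bot ≟ v) ([] ∷ [])) (∈-concatMap⁺ (λ m → map (m ∷_) (tailsWithin k m))
      (Any.map (λ { refl → ∈-map⁺ (m ∷_) (tails-complete k m (ℕ.<-≤-trans (height-mono (proj₁ m⋖v)) v≤k) sat s⊆) })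
        (∈-filter⁺ (_⋖? v) m∈ m⋖v)))

  tails-unique : ∀ k v → AllPairs (λ s t → ¬ Pointwise _≈_ s t) (tailsWithin k v)
  tails-unique zero    v = []
  tails-unique (suc k) v = AllPairs.++⁺ (AllPairs.filter⁺ (λ _ → bot ≟ v) ([] ∷ []))
    (AllPairs.concat⁺
      (All.map⁺ (All.tabulate λ {m} _ → AllPairs.map⁺ (AllPairs.map (_∘ Pointwise.tail) (tails-unique k m))))
      (AllPairs.map⁺ (AllPairs.map
        (λ m≉m′ → All.map⁺ (All.tabulate λ _ → All.map⁺ (All.tabulate λ { _ (m≈m′ ∷ _) → m≉m′ m≈m′ })))
        (AllPairs.filter⁺ (_⋖? v) unique))))
    (All.tabulate λ {s} s∈ → All.tabulate λ {t} t∈ → disjoint s∈ t∈)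
    where
    disjoint : ∀ {s t} → s ∈≡ filter (λ _ → bot ≟ v) ([] ∷ []) →
               t ∈≡ concatMap (λ m → map (m ∷_) (tailsWithin k m)) (filter (_⋖? v) elements) → ¬ Pointwise _≈_ s t
    disjoint s∈ t∈ s≈t with ∈-filter⁻ (λ _ → bot ≟ v) {xs = [] ∷ []} s∈ | ≡ₗ.find (∈-concatMap⁻ (λ m → map (m ∷_) (tailsWithin k m)) {xs = filter (_⋖? v) elements} t∈)
    ... | (here refl , _) | (m , _ , t∈m) with ∈-map⁻ (m ∷_) t∈m | s≈t
    ...   | (_ , _ , refl) | ()

  tails : List (List Carrier)
  tails = tailsWithin (suc (height top)) top

  -- Forgets the order of the chain: `maximalChains` lists its chains in the order of `elements`.
  members : List Carrier → List Carrier
  members s = (top ∷ s) ∩elements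

  -- Below `v` take a maximal element `m` of `C` among those under `v`. An element strictly between
  -- `m` and `v` would be comparable to all of `C`, hence be absorbed, against the choice of `m`; so
  -- `m ⋖ v`.
  descend : ∀ {C} → C ∈≡ sublists elements → MaximalChain C →
            ∀ v → v ∈ C → ∃ λ s → Saturated v s × All (_∈≡ C) s
  descend {C} C∈ C-max = ≺-rec (λ v → v ∈ C → ∃ λ s → Saturated v s × All (_∈≡ C) s) step
    where
    open Maximal C∈ C-max
    step : ∀ v → (∀ m → m ≺ v → m ∈ C → ∃ λ s → Saturated m s × All (_∈≡ C) s) →
           v ∈ C → ∃ λ s → Saturated v s × All (_∈≡ C) s
    step v ih v∈ with bot ≟ v
    ... | yes bot≈v = [] , bot≈v , []
    ... | no  bot≉v =
      let bot∈            = absorbs bot (λ _ → inj₁ (bot≤ _))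
          (m , m∈ , m≺v , max) = maximal (_≺? v) (λ x≈y → ≺-resp x≈y Eq.refl) C
                                   (Any.map (λ bot≈x → ≺-resp bot≈x Eq.refl (bot≤ v , bot≉v)) bot∈)
          m⋖v             = m≺v , λ z (m≺z , z≺v) → max (absorbs z (between m∈ max m≺z z≺v)) z≺v m≺z
          (s , sat , s⊆)  = ih m m≺v (≡⇒∈ m∈)
      in m ∷ s , (m⋖v , sat) , m∈ ∷ s⊆
      where
      between : ∀ {m z} → m ∈≡ C → (∀ {z} → z ∈ C → z ≺ v → ¬ m ≺ z) → m ≺ z → z ≺ v → ∀ {c} → c ∈ C → Comparable z c
      between {m} {z} m∈ max m≺z z≺v {c} c∈ with comparable c∈ v∈ | c ≟ v
      ... | inj₂ v≤c | _       = inj₁ (≤ₚ-trans (proj₁ z≺v) v≤c)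
      ... | inj₁ _   | yes c≈v = inj₁ (≤-respʳ-≈ (Eq.sym c≈v) (proj₁ z≺v))
      ... | inj₁ c≤v | no c≉v with comparable (≡⇒∈ m∈) c∈ | m ≟ c
      ...   | inj₂ c≤m | _       = inj₂ (≤ₚ-trans c≤m (proj₁ m≺z))
      ...   | inj₁ _   | yes m≈c = inj₂ (≤-respˡ-≈ m≈c (proj₁ m≺z))
      ...   | inj₁ m≤c | no m≉c  = contradiction (m≤c , m≉c) (max c∈ (c≤v , c≉v))

  maximal⇒members : ∀ {C} → C ∈≡ maximalChains → C ∈≡ map members tails
  maximal⇒members {C} C∈ =
    let (C∈′ , C-max)  = ∈-filter⁻ maximalChain? {xs = sublists elements} C∈
        open Maximal C∈′ C-max
        top∈           = absorbs top (λ _ → inj₂ (≤top _))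
        (s , sat , s⊆) = descend C∈′ C-max top top∈
        s⊆C : ∀ {q} → q ∈ top ∷ s → q ∈ C
        s⊆C = λ where
          (here q≈top) → ∈-resp (Eq.sym q≈top) top∈
          (there q∈)   → let (q′ , q′∈ , q≈q′) = ∈⇒≡ q∈ in ∈-resp (Eq.sym q≈q′) (≡⇒∈ (All.lookup s⊆ q′∈))
        C≡ = sublist-determined (_∈? (top ∷ s)) elements elements-≢ C∈′
          (λ {x} x∈ → saturated-absorbs s sat (≤top x) (λ q∈ → comparable (≡⇒∈ x∈) (s⊆C q∈)))
          (λ {x} x∈ x∈s → elements-reflect (sublists-All elements C∈′) x∈ (s⊆C x∈s))
    in subst (_∈≡ map members tails) (sym C≡)
         (∈-map⁺ members (tails-complete (suc (height top)) top ℕ.≤-refl sat (All.map (All.lookup (sublists-All elements C∈′)) s⊆)))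
    where
    elements-reflect : ∀ {D x} → All (_∈≡ elements) D → x ∈≡ elements → x ∈ D → x ∈≡ D
    elements-reflect D⊆ x∈ x∈D =
      let (y , y∈ , x≈y) = ∈⇒≡ x∈D in subst (_∈≡ _) (injective unique (All.lookup D⊆ y∈) x∈ (Eq.sym x≈y)) y∈
      where
      injective : ∀ {ys x y} → AllPairs (λ x y → ¬ x ≈ y) ys → x ∈≡ ys → y ∈≡ ys → x ≈ y → x ≡ y
      injective _          (here refl) (here refl) _   = refl
      injective (x∉ ∷ _)   (here refl) (there y∈)  x≈y = contradiction x≈y (All.lookup x∉ y∈)
      injective (y∉ ∷ _)   (there x∈)  (here refl) x≈y = contradiction (Eq.sym x≈y) (All.lookup y∉ x∈)
      injective (_ ∷ ys!)  (there x∈)  (there y∈)  x≈y = injective ys! x∈ y∈ x≈y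

  members⇒maximal : ∀ {C} → C ∈≡ map members tails → C ∈≡ maximalChains
  members⇒maximal C∈ with ∈-map⁻ members C∈
  ... | (s , s∈ , refl) = ∈-filter⁺ maximalChain? (filter∈sublists (_∈? (top ∷ s)) elements)
    ( ∩-chain (saturated-comparable s sat)
    , All.tabulate λ _ D-chain s⊆D {d} d∈ → ∈-∩⁺ (saturated-absorbs s sat (≤top d)
        (λ q∈ → chain-comparable D-chain d∈ (s⊆D (∈-∩⁺ q∈)))))
    where sat = proj₁ (tails-sound (suc (height top)) top s∈)

  members-unique : AllPairs _≢_ (map members tails)
  members-unique = AllPairs.map⁺ (AllPairs-strengthen
    (λ {s} {t} sat-s sat-t s≉t eq → s≉t (saturated-determined s t Eq.refl sat-s sat-t
      (λ p∈ → ∈-∩⁻ (subst (_ ∈_) eq (∈-∩⁺ p∈))) (λ p∈ → ∈-∩⁻ (subst (_ ∈_) (sym eq) (∈-∩⁺ p∈)))))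
    (All.tabulate λ s∈ → proj₁ (tails-sound (suc (height top)) top s∈))
    (tails-unique (suc (height top)) top))

  maximalChains↭ : maximalChains ↭ map members tails
  maximalChains↭ = ∼bag⇒↭ (unique∧set⇒bag
    (AllPairs.filter⁺ maximalChain? (sublists-unique elements-≢)) members-unique (mk⇔ maximal⇒members members⇒maximal))

  ∑-tails : (F : List Carrier → ℕ) → ∀ k v → ∑ (tailsWithin (suc k) v) F ≡
            ⟦ bot ≟ v ⟧ * F [] + (∑[ m ∈ elements ] (⟦ m ⋖? v ⟧ * (∑[ s ∈ tailsWithin k m ] F (m ∷ s))))
  ∑-tails F k v = trans (∑-++ F (filter (λ _ → bot ≟ v) ([] ∷ [])) _) (cong₂ _+_
    (trans (∑-filter (λ _ → bot ≟ v) F ([] ∷ [])) (ℕ.+-identityʳ _))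
    (trans (∑-concatMap (λ m → map (m ∷_) (tailsWithin k m)) F (filter (_⋖? v) elements))
      (trans (∑-filter (_⋖? v) _ elements)
        (∑-cong (λ m → cong (⟦ m ⋖? v ⟧ *_) (∑-map (m ∷_) F (tailsWithin k m))) elements))))

  count-tails : ∀ k v → height v < k → (∑[ s ∈ tailsWithin k v ] 1) ≡ paths bot v
  count-tails (suc k) v (s≤s v≤k) = trans (∑-tails (λ _ → 1) k v) (trans (cong₂ _+_ (ℕ.*-identityʳ _)
    (∑-cong (λ m → ⟦⟧-*-cong (m ⋖? v) λ (m≺v , _) → count-tails k m (ℕ.<-≤-trans (height-mono m≺v) v≤k)) elements))
    (sym (paths-rec bot v)))

  -- If `p` is the top `v`, every chain counts. Otherwise `p` lies in the part from the next element
  -- down, and the recursion is that of `paths p v` with the factor `paths bot p` carried along.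
  count-tails-through : ∀ p k v → height v < k →
                        (∑[ s ∈ tailsWithin k v ] ⟦ p ∈? (v ∷ s) ⟧) ≡ paths bot p * paths p v
  count-tails-through p (suc k) v v<k@(s≤s v≤k) = split (p ≟ v)
    where
    open ≡-Reasoning
    below : ∀ m → ¬ p ≈ v → m ⋖ v → (∑[ s ∈ tailsWithin k m ] ⟦ p ∈? (v ∷ m ∷ s) ⟧) ≡ paths bot p * paths p m
    below m p≉v (m≺v , _) = trans
      (∑-cong (λ s → ⟦⟧-⇔ (p ∈? (v ∷ m ∷ s)) (p ∈? (m ∷ s)) (Any.tail p≉v) there) (tailsWithin k m))
      (count-tails-through p k m (ℕ.<-≤-trans (height-mono m≺v) v≤k))
    split : Dec (p ≈ v) → (∑[ s ∈ tailsWithin (suc k) v ] ⟦ p ∈? (v ∷ s) ⟧) ≡ paths bot p * paths p v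
    split (yes p≈v) = begin
      (∑[ s ∈ tailsWithin (suc k) v ] ⟦ p ∈? (v ∷ s) ⟧)  ≡⟨ ∑-cong (λ s → ⟦⟧-yes (p ∈? (v ∷ s)) (here p≈v)) (tailsWithin (suc k) v) ⟩
      (∑[ s ∈ tailsWithin (suc k) v ] 1)  ≡⟨ count-tails (suc k) v v<k ⟩
      paths bot v  ≡⟨ sym (ℕ.*-identityʳ _) ⟩
      paths bot v * 1  ≡⟨ cong₂ _*_ (paths-resp Eq.refl (Eq.sym p≈v)) (sym (paths-≈ p≈v)) ⟩
      paths bot p * paths p v  ∎
    split (no p≉v) = begin
      (∑[ s ∈ tailsWithin (suc k) v ] ⟦ p ∈? (v ∷ s) ⟧)
        ≡⟨ ∑-tails (λ s → ⟦ p ∈? (v ∷ s) ⟧) k v ⟩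
      ⟦ bot ≟ v ⟧ * ⟦ p ∈? (v ∷ []) ⟧ + (∑[ m ∈ elements ] (⟦ m ⋖? v ⟧ * (∑[ s ∈ tailsWithin k m ] ⟦ p ∈? (v ∷ m ∷ s) ⟧)))
        ≡⟨ cong₂ _+_ (trans (cong (⟦ bot ≟ v ⟧ *_) (⟦⟧-no (p ∈? (v ∷ [])) λ { (here p≈v) → p≉v p≈v })) (ℕ.*-zeroʳ ⟦ bot ≟ v ⟧))
             (∑-cong (λ m → ⟦⟧-*-cong (m ⋖? v) (below m p≉v)) elements) ⟩
      (∑[ m ∈ elements ] (⟦ m ⋖? v ⟧ * (paths bot p * paths p m)))
        ≡⟨ ∑-cong (λ m → x∙yz≈y∙xz ⟦ m ⋖? v ⟧ (paths bot p) (paths p m)) elements ⟩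
      (∑[ m ∈ elements ] (paths bot p * (⟦ m ⋖? v ⟧ * paths p m)))
        ≡⟨ ∑-*ˡ (paths bot p) (λ m → ⟦ m ⋖? v ⟧ * paths p m) elements ⟩
      paths bot p * (∑[ m ∈ elements ] (⟦ m ⋖? v ⟧ * paths p m))
        ≡⟨ cong (paths bot p *_) (sym (trans (paths-rec p v) (cong (_+ (∑[ m ∈ elements ] (⟦ m ⋖? v ⟧ * paths p m))) (⟦⟧-no (p ≟ v) p≉v)))) ⟩
      paths bot p * paths p v ∎

  #maximalChainsThrough-paths : ∀ p → #maximalChainsThrough p ≡ paths bot p * paths p top
  #maximalChainsThrough-paths p = begin
    #maximalChainsThrough p  ≡⟨ length-filter (p ∈?_) maximalChains ⟩
    (∑[ C ∈ maximalChains ] ⟦ p ∈? C ⟧)  ≡⟨ sum-↭ (map⁺ (λ C → ⟦ p ∈? C ⟧) maximalChains↭) ⟩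
    (∑[ C ∈ map members tails ] ⟦ p ∈? C ⟧)  ≡⟨ ∑-map members (λ C → ⟦ p ∈? C ⟧) tails ⟩
    (∑[ s ∈ tails ] ⟦ p ∈? members s ⟧)  ≡⟨ ∑-cong (λ s → ⟦⟧-⇔ (p ∈? members s) (p ∈? (top ∷ s)) ∈-∩⁻ ∈-∩⁺) tails ⟩
    (∑[ s ∈ tails ] ⟦ p ∈? (top ∷ s) ⟧)  ≡⟨ count-tails-through p _ top ℕ.≤-refl ⟩
    paths bot p * paths p top  ∎
    where open ≡-Reasoning

-- Covers in the weak order

module Weak (n : ℕ) where

  Letter : Set
  Letter = Fin n

  Word : Set
  Word = Permutation′ n

  open FinitePoset (weakOrder n) public using (_≈_; _≺_; _⋖_; module Eq)
  open FinitePoset (weakOrder n) using () renaming (_≟_ to _≈?_)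
  module ≤ʷ = FinitePoset (weakOrder n)

  opaque

    -- Weak order here compares inverse inversion sets, that is, pairs of values. Permutations are
    -- therefore read as words with values as letters, and the position of a letter is the natural
    -- coordinate.
    pos : Word → Letter → ℕ
    pos u a = toℕ (u ⟨$⟩ˡ a)

    pos-injective : ∀ u {a b} → pos u a ≡ pos u b → a ≡ b
    pos-injective u = ⟨$⟩ʳ-injective (flip u) ∘ Fin.toℕ-injective

    pos<n : ∀ u a → pos u a < n
    pos<n u a = Fin.toℕ<n (u ⟨$⟩ˡ a)

    letterAt : ∀ u {i} → i < n → ∃ λ a → pos u a ≡ i
    letterAt u i<n = u ⟨$⟩ʳ fromℕ< i<n , trans (cong toℕ (inverseˡ u)) (Fin.toℕ-fromℕ< i<n)

    pos-≈⁺ : ∀ {u v} → (∀ a → pos u a ≡ pos v a) → u ≈ v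
    pos-≈⁺ {u} {v} eq = ≈-flip {u = flip u} {flip v} (Fin.toℕ-injective ∘ eq)

    pos-≈⁻ : ∀ {u v} → u ≈ v → ∀ a → pos u a ≡ pos v a
    pos-≈⁻ {u} {v} u≈v a = cong toℕ (≈-flip {u = u} {v} u≈v a)

    ≤-inversion : ∀ {u v} → u ≤ʷ v → ∀ {a b} → a Fin.< b → pos u b < pos u a → pos v b < pos v a
    ≤-inversion u≤v a<b inv = proj₂ (u≤v (a<b , inv))

    ≤-intro : ∀ {u v} → (∀ {a b} → a Fin.< b → pos u b < pos u a → pos v b < pos v a) → u ≤ʷ v
    ≤-intro h (a<b , inv) = a<b , h a<b inv

    pos-id : ∀ a → pos Perm.id a ≡ toℕ a
    pos-id a = refl

    pos-toℕ : ∀ u a → pos u a ≡ toℕ (u ⟨$⟩ˡ a)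
    pos-toℕ u a = refl

  pos-≢ : ∀ u {a b} → a ≢ b → pos u a ≢ pos u b
  pos-≢ u a≢b = a≢b ∘ pos-injective u

  <⇒≢ : ∀ {a b : Letter} → a Fin.< b → a ≢ b
  <⇒≢ a<b refl = ℕ.<-irrefl refl a<b

  pos-compare : ∀ u {a b} → a ≢ b → pos u a < pos u b ⊎ pos u b < pos u a
  pos-compare u {a} {b} a≢b with ℕ.<-cmp (pos u a) (pos u b)
  ... | tri< a<b _ _ = inj₁ a<b
  ... | tri≈ _ eq _  = contradiction eq (pos-≢ u a≢b)
  ... | tri> _ _ b<a = inj₂ b<a

  ≤-noninversion : ∀ {u v} → u ≤ʷ v → ∀ {a b} → a Fin.< b → pos v a < pos v b → pos u a < pos u b
  ≤-noninversion {u} {v} u≤v a<b v-ord with pos-compare u (<⇒≢ a<b)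
  ... | inj₁ u-ord = u-ord
  ... | inj₂ u-inv = contradiction v-ord (ℕ.<-asym (≤-inversion u≤v a<b u-inv))

  id≤ : ∀ u → Perm.id ≤ʷ u
  id≤ u = ≤-intro {Perm.id} {u} λ {a} {b} a<b inv →
    contradiction a<b (ℕ.<-asym (subst₂ _<_ (pos-id b) (pos-id a) inv))

  ≤ʷ-trans : ∀ {u v w} → u ≤ʷ v → v ≤ʷ w → u ≤ʷ w
  ≤ʷ-trans {u} {v} {w} = ≤ʷ.trans {u} {v} {w}

  ≈⇒≤ : ∀ {u v} → u ≈ v → u ≤ʷ v
  ≈⇒≤ {u} {v} = ≤ʷ.reflexive {u} {v}

  infix 4 _then_in-word_

  _then_in-word_ : Letter → Letter → Word → Set
  a then b in-word u = pos u b ≡ suc (pos u a)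

  then? : ∀ a b u → Dec (a then b in-word u)
  then? a b u = pos u b ℕ.≟ suc (pos u a)

  then⇒< : ∀ {a b} u → a then b in-word u → pos u a < pos u b
  then⇒< u next = ℕ.≤-reflexive (sym next)

  -- A relation rather than a function, because covers present their elements only up to `_≈_`;
  -- positions determine a word up to `_≈_`.
  record Swapped (a b : Letter) (u v : Word) : Set where
    constructor swapped
    field
      pos-a : pos v a ≡ pos u b
      pos-b : pos v b ≡ pos u a
      pos-other : ∀ {c} → c ≢ a → c ≢ b → pos v c ≡ pos u c

  open Swapped

  Swapped-sym : ∀ {a b u v} → Swapped a b u v → Swapped a b v u
  Swapped-sym s = swapped (sym (pos-b s)) (sym (pos-a s)) (λ c≢a c≢b → sym (pos-other s c≢a c≢b))

  Swapped-flip : ∀ {a b u v} → Swapped a b u v → Swapped b a u v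
  Swapped-flip s = swapped (pos-b s) (pos-a s) (λ c≢b c≢a → pos-other s c≢a c≢b)

  Swapped-unique : ∀ {a b u v v′} → Swapped a b u v → Swapped a b u v′ → v ≈ v′
  Swapped-unique {a} {b} {u} {v} {v′} s s′ = pos-≈⁺ eq
    where
    eq : ∀ c → pos v c ≡ pos v′ c
    eq c with c Fin.≟ a | c Fin.≟ b
    ... | yes refl | _        = trans (pos-a s) (sym (pos-a s′))
    ... | no _     | yes refl = trans (pos-b s) (sym (pos-b s′))
    ... | no c≢a   | no c≢b   = trans (pos-other s c≢a c≢b) (sym (pos-other s′ c≢a c≢b))

  Swapped-resp : ∀ {a b u u′ v v′} → u ≈ u′ → v ≈ v′ → Swapped a b u v → Swapped a b u′ v′
  Swapped-resp {a} {b} u≈ v≈ s = swapped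
    (trans (sym (pos-≈⁻ v≈ a)) (trans (pos-a s) (pos-≈⁻ u≈ b)))
    (trans (sym (pos-≈⁻ v≈ b)) (trans (pos-b s) (pos-≈⁻ u≈ a)))
    (λ {c} c≢a c≢b → trans (sym (pos-≈⁻ v≈ c)) (trans (pos-other s c≢a c≢b) (pos-≈⁻ u≈ c)))

  opaque
    unfolding pos

    -- The arguments are reversed because positions are read through the inverse: the inverse of
    -- `transpose a b` is `Components.transpose b a`, so that `pos-swap` holds by computation.
    tr : Letter → Letter → Letter → Letter
    tr a b = Components.transpose b a

    swap : Letter → Letter → Word → Word
    swap a b u = u ∘ₚ transpose a b

    pos-swap : ∀ a b u c → pos (swap a b u) c ≡ pos u (tr a b c)
    pos-swap a b u c = refl

    tr-a : ∀ a b → tr a b a ≡ b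
    tr-a a b with a Fin.≟ b
    ... | yes a≡b = a≡b
    ... | no _ with a Fin.≟ a
    ...   | yes _  = refl
    ...   | no a≢a = contradiction refl a≢a

    tr-b : ∀ a b → tr a b b ≡ a
    tr-b a b with b Fin.≟ b
    ... | yes _  = refl
    ... | no b≢b = contradiction refl b≢b

    tr-other : ∀ {a b c} → c ≢ a → c ≢ b → tr a b c ≡ c
    tr-other {a} {b} {c} c≢a c≢b with c Fin.≟ b
    ... | yes c≡b = contradiction c≡b c≢b
    ... | no _ with c Fin.≟ a
    ...   | yes c≡a = contradiction c≡a c≢a
    ...   | no _    = refl

  swap-swapped : ∀ a b u → Swapped a b u (swap a b u)
  swap-swapped a b u = swapped
    (trans (pos-swap a b u a) (cong (pos u) (tr-a a b)))
    (trans (pos-swap a b u b) (cong (pos u) (tr-b a b)))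
    (λ c≢a c≢b → trans (pos-swap a b u _) (cong (pos u) (tr-other c≢a c≢b)))

  swap-resp : ∀ a b {u v} → u ≈ v → swap a b u ≈ swap a b v
  swap-resp a b {u} {v} u≈v = pos-≈⁺ {swap a b u} {swap a b v} λ c →
    trans (pos-swap a b u c) (trans (pos-≈⁻ {u} {v} u≈v (tr a b c)) (sym (pos-swap a b v c)))

  swap-involutive : ∀ a b u → swap a b (swap a b u) ≈ u
  swap-involutive a b u = Swapped-unique {v = swap a b (swap a b u)} {u} (swap-swapped a b (swap a b u)) (Swapped-sym (swap-swapped a b u))

  swap-≈ : ∀ a b {u v} → swap a b u ≈ v → swap a b v ≈ u
  swap-≈ a b {u} {v} eq = ≤ʷ.Eq.trans {swap a b v} {swap a b (swap a b u)} {u}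
    (swap-resp a b {v} {swap a b u} (≤ʷ.Eq.sym {swap a b u} {v} eq)) (swap-involutive a b u)

  swapped-then : ∀ {a b u v} → Swapped a b u v → b then a in-word u → a then b in-word v
  swapped-then s next = trans (pos-b s) (trans next (cong suc (sym (pos-a s))))

  -- The exchanged letters are neighbours, so no third letter is passed and only their own order
  -- changes.
  swapped-order : ∀ {a b u v} → Swapped a b u v → b then a in-word u → ∀ {c d} → ¬ (c ≡ b × d ≡ a) →
                  pos u c < pos u d → pos v c < pos v d
  swapped-order {a} {b} {u} {v} s next {c} {d} ¬ba c<d with c Fin.≟ a | c Fin.≟ b | d Fin.≟ a | d Fin.≟ b
  ... | yes refl | _        | yes refl | _        = contradiction c<d (ℕ.<-irrefl refl)
  ... | yes refl | _        | no _     | yes refl = contradiction (then⇒< u next) (ℕ.<-asym c<d)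
  ... | yes refl | _        | no d≢a   | no d≢b   =
    subst₂ _<_ (sym (pos-a s)) (sym (pos-other s d≢a d≢b)) (ℕ.<-trans (then⇒< u next) c<d)
  ... | no _     | yes refl | yes d≡a  | _        = contradiction (refl , d≡a) ¬ba
  ... | no _     | yes refl | no _     | yes refl = contradiction c<d (ℕ.<-irrefl refl)
  ... | no _     | yes refl | no d≢a   | no d≢b   =
    subst₂ _<_ (sym (pos-b s)) (sym (pos-other s d≢a d≢b))
      (ℕ.≤∧≢⇒< (ℕ.≤-trans (ℕ.≤-reflexive next) c<d) (pos-≢ u (d≢a ∘ sym)))
  ... | no c≢a   | no c≢b   | yes refl | _        =
    subst₂ _<_ (sym (pos-other s c≢a c≢b)) (sym (pos-a s))
      (ℕ.≤∧≢⇒< (ℕ.≤-pred (ℕ.≤-trans c<d (ℕ.≤-reflexive next))) (pos-≢ u c≢b))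
  ... | no c≢a   | no c≢b   | no _     | yes refl =
    subst₂ _<_ (sym (pos-other s c≢a c≢b)) (sym (pos-b s)) (ℕ.<-trans c<d (then⇒< u next))
  ... | no c≢a   | no c≢b   | no d≢a   | no d≢b   =
    subst₂ _<_ (sym (pos-other s c≢a c≢b)) (sym (pos-other s d≢a d≢b)) c<d

  -- The covering relation in concrete form, `m` arising from `v` by sorting one descent. `cover⇒⋖`
  -- and `⋖⇒cover` identify it with the order-theoretic one.
  record Cover (m v : Word) : Set where
    constructor cover
    field
      {a b}       : Letter
      a<b         : a Fin.< b
      descent     : b then a in-word v
      exchanged   : Swapped a b v m

  swapped-≤ : ∀ {a b u v} → a Fin.< b → b then a in-word u → Swapped a b u v → v ≤ʷ u
  swapped-≤ {a} {b} {u} {v} a<b next s = ≤-intro {v} {u} λ {c} {d} c<d inv →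
    swapped-order (Swapped-sym (Swapped-flip s)) (swapped-then s next) (λ { (refl , refl) → ℕ.<-asym a<b c<d }) inv

  -- `v` lacks exactly one inversion of `u`, the pair of `a` and `b`, so below `u` this pair alone
  -- decides. `swapped-≥` is the dual.
  ≤-swapped : ∀ {a b u v p} → a Fin.< b → b then a in-word u → Swapped a b u v →
              p ≤ʷ u → pos p a < pos p b → p ≤ʷ v
  ≤-swapped {a} {b} {u} {v} {p} a<b next s p≤u a-b = ≤-intro {p} {v} λ {c} {d} c<d inv →
    swapped-order s next (λ { (refl , refl) → ℕ.<-asym a-b inv }) (≤-inversion {p} {u} p≤u c<d inv)

  swapped-≥ : ∀ {a b u v p} → a Fin.< b → b then a in-word u → Swapped a b u v →
              v ≤ʷ p → pos p b < pos p a → u ≤ʷ p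
  swapped-≥ {a} {b} {u} {v} {p} a<b next s v≤p b-a = ≤-intro {u} {p} go
    where
    go : ∀ {c d} → c Fin.< d → pos u d < pos u c → pos p d < pos p c
    go {c} {d} c<d inv with d Fin.≟ b | c Fin.≟ a
    ... | yes refl | yes refl = b-a
    ... | yes _    | no c≢a   = ≤-inversion {v} {p} v≤p c<d (swapped-order s next (c≢a ∘ proj₂) inv)
    ... | no d≢b   | _        = ≤-inversion {v} {p} v≤p c<d (swapped-order s next (d≢b ∘ proj₁) inv)

  cover⇒⋖ : ∀ {m v} → Cover m v → m ⋖ v
  cover⇒⋖ {m} {v} (cover {a} {b} a<b next s) =
    (swapped-≤ a<b next s , λ m≈v → pos-≢ v (<⇒≢ a<b) (trans (sym (pos-≈⁻ {m} {v} m≈v a)) (pos-a s)))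
    , none
    where
    none : ∀ z → ¬ (m ≺ z × z ≺ v)
    none z ((m≤z , m≉z) , (z≤v , z≉v)) with pos-compare z (<⇒≢ a<b)
    ... | inj₁ a-b = m≉z (≤ʷ-antisym {u = m} {z} m≤z (≤-swapped {u = v} {m} {z} a<b next s z≤v a-b))
    ... | inj₂ b-a = z≉v (≤ʷ-antisym {u = z} {v} z≤v (swapped-≥ {u = v} {m} {z} a<b next s m≤z b-a))

  -- Induction on the number `k` of letters of `v` strictly between `c` and `d`.
  consecutive⇒order : ∀ p v → (∀ {c d} → c then d in-word v → pos p c < pos p d) →
                      ∀ k {c d} → pos v d ≡ suc (k + pos v c) → pos p c < pos p d
  consecutive⇒order p v h zero    eq = h eq
  consecutive⇒order p v h (suc k) {c} {d} eq =
    let (e , eq′) = letterAt v (ℕ.<-trans (ℕ.≤-reflexive (sym eq)) (pos<n v d)) in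
    ℕ.<-trans (consecutive⇒order p v h k eq′) (h (trans eq (cong suc (sym eq′))))

  -- If `p` kept the order of every two neighbours of `v`, it would keep that of all letters and
  -- equal `v`. Neighbours that it reverses form a descent of `v`, because `p ≤ʷ v` respects the
  -- ascents of `v`.
  ∃-descent : ∀ {p v} → p ≤ʷ v → ¬ p ≈ v →
              ∃₂ λ a b → a Fin.< b × b then a in-word v × pos p a < pos p b
  ∃-descent {p} {v} p≤v p≉v with Fin.any? (λ a → Fin.any? (λ b → (a Fin.<? b) ×-dec (then? b a v) ×-dec (pos p a ℕ.<? pos p b)))
  ... | yes (a , b , h) = a , b , h
  ... | no none = contradiction (≤ʷ-antisym {u = p} {v} p≤v v≤p) p≉v
    where
    next : ∀ {c d} → c then d in-word v → pos p c < pos p d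
    next {c} {d} eq with Fin.<-cmp c d
    ... | tri< c<d _ _  = ≤-noninversion {p} {v} p≤v c<d (then⇒< v eq)
    ... | tri≈ _ refl _ = contradiction (then⇒< v eq) (ℕ.<-irrefl refl)
    ... | tri> _ _ d<c with pos-compare p (<⇒≢ d<c)
    ...   | inj₂ c-d = c-d
    ...   | inj₁ d-c = contradiction (d , c , d<c , eq , d-c) none
    v≤p : v ≤ʷ p
    v≤p = ≤-intro {v} {p} λ {a} {b} a<b inv →
      let (k , eq) = ℕ.m≤n⇒∃[o]m+o≡n inv in
      consecutive⇒order p v next k (trans (sym eq) (cong suc (ℕ.+-comm (pos v b) k)))

  ⋖⇒cover : ∀ {m v} → m ⋖ v → Cover m v
  ⋖⇒cover {m} {v} ((m≤v , m≉v) , none) with ∃-descent {m} {v} m≤v m≉v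
  ... | (a , b , a<b , next , a-b) with m ≈? swap a b v
  ...   | yes m≈ = cover a<b next (Swapped-resp {u = v} {v} {swap a b v} {m} (≤ʷ.Eq.refl {v}) (≤ʷ.Eq.sym {m} {swap a b v} m≈) (swap-swapped a b v))
  ...   | no m≉  = ⊥-elim (none (swap a b v)
    ( (≤-swapped {u = v} {swap a b v} {m} a<b next (swap-swapped a b v) m≤v a-b , m≉)
    , proj₁ (cover⇒⋖ {swap a b v} {v} (cover a<b next (swap-swapped a b v)))))

-- Toggle symmetry

module Toggle (n : ℕ) where
  open Weak n public
  open CDE (weakOrder n) using (_⋖?_) public
  open Paths (weakOrder n) public

  words : List Word
  words = permutations n

  infix 4 _≈?_
  _≈?_ : (u v : Word) → Dec (u ≈ v)
  _≈?_ = FinitePoset._≟_ (weakOrder n)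

  χ : Letter → Letter → Word → ℕ
  χ a b u = ⟦ then? a b u ⟧

  then-resp : ∀ {a b u v} → u ≈ v → a then b in-word u → a then b in-word v
  then-resp {a} {b} {u} {v} u≈v next = trans (sym (pos-≈⁻ {u} {v} u≈v b)) (trans next (cong suc (pos-≈⁻ {u} {v} u≈v a)))

  χ-resp : ∀ a b {u v} → u ≈ v → χ a b u ≡ χ a b v
  χ-resp a b {u} {v} u≈v = ⟦⟧-⇔ (then? a b u) (then? a b v)
    (then-resp {u = u} {v} u≈v) (then-resp {u = v} {u} (≤ʷ.Eq.sym {u} {v} u≈v))

  swap-then : ∀ a b u → a then b in-word u → b then a in-word swap a b u
  swap-then a b u = swapped-then (Swapped-flip (swap-swapped a b u))

  swap-then⁻ : ∀ a b u → b then a in-word swap a b u → a then b in-word u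
  swap-then⁻ a b u = swapped-then (Swapped-sym (swap-swapped a b u))

  χ-swap : ∀ a b u → χ b a (swap a b u) ≡ χ a b u
  χ-swap a b u = ⟦⟧-⇔ (then? b a (swap a b u)) (then? a b u) (swap-then⁻ a b u) (swap-then a b u)

  ∑-swap-words : ∀ a b {f} → Respectful f → (∑[ u ∈ words ] f (swap a b u)) ≡ ∑ words f
  ∑-swap-words a b resp = ∑-reindex resp (swap a b) (swap a b)
    (λ {u} {v} → swap-≈ a b {u} {v}) (λ {u} {v} → swap-≈ a b {v} {u})

  ≤-swap : ∀ {a b} u → a Fin.< b → a then b in-word u → u ≤ʷ swap a b u
  ≤-swap {a} {b} u a<b next = swapped-≤ a<b (swap-then a b u next) (Swapped-sym (swap-swapped a b u))

  -- Exchanging the values a and b reverses comparisons only between one of them and a letter of intermediate value.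
  -- In a good word these letters stay outside the stretch from a to b, so covers between good words are preserved.
  Good : Letter → Letter → Word → Set
  Good a b u = pos u a < pos u b × (∀ z → a Fin.< z → z Fin.< b → pos u z < pos u a ⊎ pos u b < pos u z)

  good? : ∀ a b u → Dec (Good a b u)
  good? a b u = (pos u a ℕ.<? pos u b) ×-dec Fin.all? (λ z → (a Fin.<? z) →-dec ((z Fin.<? b) →-dec
    ((pos u z ℕ.<? pos u a) ⊎-dec (pos u b ℕ.<? pos u z))))

  then⇒good : ∀ {a b} u → a then b in-word u → Good a b u
  then⇒good {a} {b} u next = then⇒< u next , λ z a<z z<b → outside z (<⇒≢ a<z ∘ sym) (<⇒≢ z<b)
    where
    outside : ∀ z → z ≢ a → z ≢ b → pos u z < pos u a ⊎ pos u b < pos u z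
    outside z z≢a z≢b with pos-compare u z≢a
    ... | inj₁ z-a = inj₁ z-a
    ... | inj₂ a-z = inj₂ (ℕ.≤∧≢⇒< (ℕ.≤-trans (ℕ.≤-reflexive next) a-z) (pos-≢ u (z≢b ∘ sym)))

  module _ {a b : Letter} (a<b : a Fin.< b) where

    private
      τ : Word → Word
      τ = swap a b
      module S u = Swapped (swap-swapped a b u)

    -- A letter of intermediate value outside the stretch forms an inversion with `a` or `b`, which
    -- persists upwards from `u`; the order of `a` before `b` is no inversion and persists downwards
    -- from `v`. After the exchange the two roles are reversed, which gives `good-between-swap`.
    good-between : ∀ u m v → Good a b u → Good a b v → u ≤ʷ m → m ≤ʷ v → Good a b m
    good-between u m v (_ , u-out) (v-ord , _) u≤m m≤v = ≤-noninversion {m} {v} m≤v a<b v-ord , out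
      where
      out : ∀ z → a Fin.< z → z Fin.< b → pos m z < pos m a ⊎ pos m b < pos m z
      out z a<z z<b = Sum.map (≤-inversion {u} {m} u≤m a<z) (≤-inversion {u} {m} u≤m z<b) (u-out z a<z z<b)

    good-between-swap : ∀ u m v → Good a b u → Good a b v → τ u ≤ʷ τ m → τ m ≤ʷ τ v → Good a b m
    good-between-swap u m v (u-ord , _) (_ , v-out) u≤m m≤v =
      subst₂ _<_ (S.pos-b m) (S.pos-a m)
        (≤-inversion {τ u} {τ m} u≤m a<b (subst₂ _<_ (sym (S.pos-b u)) (sym (S.pos-a u)) u-ord)) , out
      where
      out : ∀ z → a Fin.< z → z Fin.< b → pos m z < pos m a ⊎ pos m b < pos m z
      out z a<z z<b = Sum.map
        (λ z-a → subst₂ _<_ (other m) (S.pos-b m)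
          (≤-noninversion {τ m} {τ v} m≤v z<b (subst₂ _<_ (sym (other v)) (sym (S.pos-b v)) z-a)))
        (λ b-z → subst₂ _<_ (S.pos-a m) (other m)
          (≤-noninversion {τ m} {τ v} m≤v a<z (subst₂ _<_ (sym (S.pos-a v)) (sym (other v)) b-z)))
        (v-out z a<z z<b)
        where
        other : ∀ u → pos (τ u) z ≡ pos u z
        other u = S.pos-other u (<⇒≢ a<z ∘ sym) (<⇒≢ z<b)

    -- Goodness keeps intermediate values away from the place just before `b`. So a smaller
    -- neighbour there stays smaller when `b` is replaced by `a`; `good-not-a-then` is the
    -- counterpart after `a`.
    good-not-then-b : ∀ {z} u → Good a b u → z ≢ a → z Fin.< b → z then b in-word u → z Fin.< a
    good-not-then-b {z} u (a-b , out) z≢a z<b next with Fin.<-cmp z a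
    ... | tri< z<a _ _ = z<a
    ... | tri≈ _ z≡a _ = contradiction z≡a z≢a
    ... | tri> _ _ a<z with out z a<z z<b
    ...   | inj₁ z-a = contradiction a-b (ℕ.≤⇒≯ (ℕ.≤-trans (ℕ.≤-reflexive next) z-a))
    ...   | inj₂ b-z = contradiction b-z (ℕ.<-asym (then⇒< u next))

    good-not-a-then : ∀ {z} u → Good a b u → z ≢ b → a Fin.< z → a then z in-word u → b Fin.< z
    good-not-a-then {z} u (a-b , out) z≢b a<z next with Fin.<-cmp b z
    ... | tri< b<z _ _ = b<z
    ... | tri≈ _ b≡z _ = contradiction (sym b≡z) z≢b
    ... | tri> _ _ z<b with out z a<z z<b
    ...   | inj₁ z-a = contradiction z-a (ℕ.<-asym (then⇒< u next))
    ...   | inj₂ b-z = contradiction a-b (ℕ.≤⇒≯ (ℕ.≤-pred (ℕ.≤-trans b-z (ℕ.≤-reflexive next))))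

    data TrView (c : Letter) : Set where
      is-a  : c ≡ a → tr a b c ≡ b → TrView c
      is-b  : c ≡ b → tr a b c ≡ a → TrView c
      other : c ≢ a → c ≢ b → tr a b c ≡ c → TrView c

    trView : ∀ c → TrView c
    trView c with c Fin.≟ a | c Fin.≟ b
    ... | yes refl | _        = is-a refl (tr-a a b)
    ... | no _     | yes refl = is-b refl (tr-b a b)
    ... | no c≢a   | no c≢b   = other c≢a c≢b (tr-other c≢a c≢b)

    tr-involutive : ∀ c → tr a b (tr a b c) ≡ c
    tr-involutive c with trView c
    ... | is-a refl eq    = trans (cong (tr a b) eq) (tr-b a b)
    ... | is-b refl eq    = trans (cong (tr a b) eq) (tr-a a b)
    ... | other _ _ eq    = trans (cong (tr a b) eq) eq

    pos-swap-tr : ∀ u c → pos (τ u) (tr a b c) ≡ pos u c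
    pos-swap-tr u c = trans (pos-swap a b u (tr a b c)) (cong (pos u) (tr-involutive c))

    tr-then : ∀ {c d} u → c then d in-word u → tr a b c then tr a b d in-word τ u
    tr-then {c} {d} u next = trans (pos-swap-tr u d) (trans next (cong suc (sym (pos-swap-tr u c))))

    tr-swapped : ∀ {c d} u v → Swapped c d u v → Swapped (tr a b c) (tr a b d) (τ u) (τ v)
    tr-swapped {c} {d} u v s = swapped
      (trans (pos-swap-tr v c) (trans (Swapped.pos-a s) (sym (pos-swap-tr u d))))
      (trans (pos-swap-tr v d) (trans (Swapped.pos-b s) (sym (pos-swap-tr u c))))
      (λ {e} e≢c e≢d → trans (pos-swap a b v e) (trans
        (Swapped.pos-other s (λ eq → e≢c (trans (sym (tr-involutive e)) (cong (tr a b) eq)))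
                             (λ eq → e≢d (trans (sym (tr-involutive e)) (cong (tr a b) eq))))
        (sym (pos-swap a b u e))))

    cover-swap : ∀ m v → Good a b m → Good a b v → m ⋖ v → τ m ⋖ τ v
    cover-swap m v gm gv m⋖v = cover⇒⋖ {τ m} {τ v} (go (⋖⇒cover {m} {v} m⋖v))
      where
      go : Cover m v → Cover (τ m) (τ v)
      go (cover {c} {d} c<d next s) = cover (increasing (trView c) (trView d)) (tr-then v next) (tr-swapped v m s)
        where
        next′ : c then d in-word m
        next′ = swapped-then s next
        increasing : TrView c → TrView d → tr a b c Fin.< tr a b d
        increasing (is-a refl _)  (is-a refl _)    = contradiction c<d (ℕ.<-irrefl refl)
        increasing (is-a refl _)  (is-b refl _)    = contradiction (proj₁ gv) (ℕ.<-asym (then⇒< v next))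
        increasing (is-a refl p)  (other _ d≢b q)  = subst₂ Fin._<_ (sym p) (sym q) (good-not-a-then m gm d≢b c<d next′)
        increasing (is-b refl _)  (is-a refl _)    = contradiction c<d (ℕ.<-asym a<b)
        increasing (is-b refl _)  (is-b refl _)    = contradiction c<d (ℕ.<-irrefl refl)
        increasing (is-b refl p)  (other _ _ q)    = subst₂ Fin._<_ (sym p) (sym q) (ℕ.<-trans a<b c<d)
        increasing (other _ _ p)  (is-a refl q)    = subst₂ Fin._<_ (sym p) (sym q) (ℕ.<-trans c<d a<b)
        increasing (other c≢a _ p) (is-b refl q)   = subst₂ Fin._<_ (sym p) (sym q) (good-not-then-b m gm c≢a c<d next′)
        increasing (other _ _ p)  (other _ _ q)    = subst₂ Fin._<_ (sym p) (sym q) c<d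

    cover-unswap : ∀ m v → Good a b m → Good a b v → τ m ⋖ τ v → m ⋖ v
    cover-unswap m v gm gv m⋖v = cover⇒⋖ {m} {v} (go (⋖⇒cover {τ m} {τ v} m⋖v))
      where
      go : Cover (τ m) (τ v) → Cover m v
      go (cover {c} {d} c<d next s) = cover (increasing (trView c) (trView d)) next′
        (Swapped-resp {u = τ (τ v)} {v} {τ (τ m)} {m} (swap-involutive a b v) (swap-involutive a b m) (tr-swapped (τ v) (τ m) s))
        where
        next′ : tr a b d then tr a b c in-word v
        next′ = then-resp {u = τ (τ v)} {v} (swap-involutive a b v) (tr-then (τ v) next)
        next″ : tr a b c then tr a b d in-word m
        next″ = then-resp {u = τ (τ m)} {m} (swap-involutive a b m) (tr-then (τ m) (swapped-then s next))
        increasing : TrView c → TrView d → tr a b c Fin.< tr a b d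
        increasing (is-a refl _)  (is-a refl _)    = contradiction c<d (ℕ.<-irrefl refl)
        increasing (is-a refl p)  (is-b refl q)    =
          contradiction (proj₁ gm) (ℕ.<-asym (then⇒< m (subst₂ (_then_in-word m) p q next″)))
        increasing (is-a refl p)  (other d≢a d≢b q) with Fin.<-cmp b d
        ... | tri< b<d _ _ = subst₂ Fin._<_ (sym p) (sym q) b<d
        ... | tri≈ _ b≡d _ = contradiction (sym b≡d) d≢b
        ... | tri> _ _ d<b = contradiction
          (good-not-then-b v gv d≢a d<b (subst₂ (_then_in-word v) q p next′)) (ℕ.<-asym c<d)
        increasing (is-b refl _)  (is-a refl _)    = contradiction c<d (ℕ.<-asym a<b)
        increasing (is-b refl _)  (is-b refl _)    = contradiction c<d (ℕ.<-irrefl refl)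
        increasing (is-b refl p)  (other _ _ q)    = subst₂ Fin._<_ (sym p) (sym q) (ℕ.<-trans a<b c<d)
        increasing (other _ _ p)  (is-a refl q)    = subst₂ Fin._<_ (sym p) (sym q) (ℕ.<-trans c<d a<b)
        increasing (other c≢a c≢b p) (is-b refl q) with Fin.<-cmp c a
        ... | tri< c<a _ _ = subst₂ Fin._<_ (sym p) (sym q) c<a
        ... | tri≈ _ c≡a _ = contradiction c≡a c≢a
        ... | tri> _ _ a<c = contradiction
          (good-not-a-then v gv c≢b a<c (subst₂ (_then_in-word v) q p next′)) (ℕ.<-asym c<d)
        increasing (other _ _ p)  (other _ _ q)    = subst₂ Fin._<_ (sym p) (sym q) c<d

    -- Among good words the exchange matches the elements covered by `v` with those covered by
    -- `τ v`. A word `m` that is not good contributes to neither side, since everything between good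
    -- words is good, before as well as after the exchange.
    paths-swap : ∀ u v → Good a b u → Good a b v → paths u v ≡ paths (τ u) (τ v)
    paths-swap u v gu = ≺-rec (λ v → Good a b v → paths u v ≡ paths (τ u) (τ v)) step v
      where
      step : ∀ v → (∀ m → m ≺ v → Good a b m → paths u m ≡ paths (τ u) (τ m)) →
             Good a b v → paths u v ≡ paths (τ u) (τ v)
      step v ih gv = begin
        paths u v  ≡⟨ paths-rec u v ⟩
        ⟦ u ≈? v ⟧ + (∑[ m ∈ words ] (⟦ m ⋖? v ⟧ * paths u m))  ≡⟨ cong₂ _+_ same-δ (∑-cong (λ m → term m (good? a b m)) words) ⟩
        ⟦ τ u ≈? τ v ⟧ + (∑[ m ∈ words ] (⟦ τ m ⋖? τ v ⟧ * paths (τ u) (τ m))) ≡⟨ cong (⟦ τ u ≈? τ v ⟧ +_) (∑-swap-words a b resp) ⟩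
        ⟦ τ u ≈? τ v ⟧ + (∑[ m ∈ words ] (⟦ m ⋖? τ v ⟧ * paths (τ u) m)) ≡⟨ sym (paths-rec (τ u) (τ v)) ⟩
        paths (τ u) (τ v)  ∎
        where
        open ≡-Reasoning
        same-δ : ⟦ u ≈? v ⟧ ≡ ⟦ τ u ≈? τ v ⟧
        same-δ = ⟦⟧-⇔ (u ≈? v) (τ u ≈? τ v) (swap-resp a b {u} {v})
          (λ eq → ≤ʷ.Eq.trans {u} {τ (τ u)} {v} (≤ʷ.Eq.sym {τ (τ u)} {u} (swap-involutive a b u))
            (≤ʷ.Eq.trans {τ (τ u)} {τ (τ v)} {v} (swap-resp a b {τ u} {τ v} eq) (swap-involutive a b v)))
        resp : Respectful (λ m → ⟦ m ⋖? τ v ⟧ * paths (τ u) m)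
        resp {x} {y} x≈y = cong₂ _*_
          (⟦⟧-⇔ (x ⋖? τ v) (y ⋖? τ v) (⋖-resp {x} {y} {τ v} {τ v} x≈y (≤ʷ.Eq.refl {τ v}))
            (⋖-resp {y} {x} {τ v} {τ v} (≤ʷ.Eq.sym {x} {y} x≈y) (≤ʷ.Eq.refl {τ v})))
          (paths-resp {τ u} {τ u} {x} {y} (≤ʷ.Eq.refl {τ u}) x≈y)
        term : ∀ m → Dec (Good a b m) → ⟦ m ⋖? v ⟧ * paths u m ≡ ⟦ τ m ⋖? τ v ⟧ * paths (τ u) (τ m)
        term m (yes gm) = trans
          (⟦⟧-*-cong (m ⋖? v) (λ (m≺v , _) → ih m m≺v gm))
          (cong (_* paths (τ u) (τ m)) (⟦⟧-⇔ (m ⋖? v) (τ m ⋖? τ v) (cover-swap m v gm gv) (cover-unswap m v gm gv)))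
        term m (no ¬gm) = trans
          (⟦⟧-*-vanish (m ⋖? v) (λ ((m≤v , _) , _) → paths-vanish u m λ u≤m → ¬gm (good-between u m v gu gv u≤m m≤v)))
          (sym (⟦⟧-*-vanish (τ m ⋖? τ v) (λ ((m≤v , _) , _) → paths-vanish (τ u) (τ m) λ u≤m →
            ¬gm (good-between-swap u m v gu gv u≤m m≤v))))

    -- A cover reorders only the pair that it exchanges, so a cover that reverses `a` and `b` is
    -- their exchange.
    crossing-edge : ∀ k v → pos k a < pos k b → pos v b < pos v a →
                    (k ⋖ v → a then b in-word k × τ k ≈ v) × (a then b in-word k × τ k ≈ v → k ⋖ v)
    crossing-edge k v a-b b-a = (λ k⋖v → to (⋖⇒cover {k} {v} k⋖v)) , λ (next , eq) → cover⇒⋖ {k} {v} (cover a<b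
      (then-resp {u = τ k} {v} eq (swap-then a b k next))
      (Swapped-resp {u = τ k} {v} {k} {k} eq (≤ʷ.Eq.refl {k}) (Swapped-sym (swap-swapped a b k))))
      where
      to : Cover k v → a then b in-word k × τ k ≈ v
      to (cover {c} {d} c<d next s) with b Fin.≟ d | a Fin.≟ c
      ... | yes refl | yes refl = swapped-then s next , Swapped-unique {v = τ k} {v} (swap-swapped a b k) (Swapped-sym s)
      ... | yes _    | no a≢c   = contradiction (swapped-order s next (a≢c ∘ proj₂) b-a) (ℕ.<-asym a-b)
      ... | no b≢d   | _        = contradiction (swapped-order s next (b≢d ∘ proj₁) b-a) (ℕ.<-asym a-b)

    -- A saturated chain from u to v exchanges a and b exactly once.
    paths-crossing : ∀ u v → pos u a < pos u b → pos v b < pos v a →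
                     paths u v ≡ ∑[ m ∈ words ] (χ a b m * (paths u m * paths (τ m) v))
    paths-crossing u v u-ord = ≺-rec (λ v → pos v b < pos v a → paths u v ≡ through v) step v
      where
      through : Word → ℕ
      through v = ∑[ m ∈ words ] (χ a b m * (paths u m * paths (τ m) v))
      step : ∀ v → (∀ k → k ≺ v → pos k b < pos k a → paths u k ≡ through k) →
             pos v b < pos v a → paths u v ≡ through v
      step v ih b-a = begin
        paths u v  ≡⟨ paths-rec u v ⟩
        ⟦ u ≈? v ⟧ + (∑[ k ∈ words ] (⟦ k ⋖? v ⟧ * paths u k))  ≡⟨ cong (_+ (∑[ k ∈ words ] (⟦ k ⋖? v ⟧ * paths u k))) (⟦⟧-no (u ≈? v) u≉v) ⟩
        -- Split by the last cover `k ⋖ v`: either it is the exchange of `a` and `b`, or these are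
        -- already reversed in `k` and the induction hypothesis applies.
        (∑[ k ∈ words ] (⟦ k ⋖? v ⟧ * paths u k))  ≡⟨ ∑-cong term words ⟩
        (∑[ k ∈ words ] (χ a b k * (paths u k * ⟦ τ k ≈? v ⟧) + ⟦ k ⋖? v ⟧ * through k))  ≡⟨ ∑-+ (λ k → χ a b k * (paths u k * ⟦ τ k ≈? v ⟧)) (λ k → ⟦ k ⋖? v ⟧ * through k) words ⟩
        last-step + (∑[ k ∈ words ] (⟦ k ⋖? v ⟧ * through k))  ≡⟨ cong (last-step +_) exchange ⟩
        last-step + (∑[ m ∈ words ] (χ a b m * (paths u m * (∑[ k ∈ words ] (⟦ k ⋖? v ⟧ * paths (τ m) k)))))
          ≡⟨ sym (∑-+ (λ m → χ a b m * (paths u m * ⟦ τ m ≈? v ⟧)) _ words) ⟩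
        (∑[ m ∈ words ] (χ a b m * (paths u m * ⟦ τ m ≈? v ⟧) + χ a b m * (paths u m * (∑[ k ∈ words ] (⟦ k ⋖? v ⟧ * paths (τ m) k)))))
          ≡⟨ ∑-cong (λ m → trans (distrib (χ a b m) (paths u m) ⟦ τ m ≈? v ⟧ _) (cong (λ x → χ a b m * (paths u m * x)) (sym (paths-rec (τ m) v)))) words ⟩
        through v  ∎
        where
        open ≡-Reasoning
        last-step : ℕ
        last-step = ∑[ m ∈ words ] (χ a b m * (paths u m * ⟦ τ m ≈? v ⟧))
        u≉v : ¬ u ≈ v
        u≉v u≈v = ℕ.<-asym b-a (subst₂ _<_ (pos-≈⁻ {u} {v} u≈v a) (pos-≈⁻ {u} {v} u≈v b) u-ord)
        distrib : ∀ x y z t → x * (y * z) + x * (y * t) ≡ x * (y * (z + t))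
        distrib = solve 4 (λ x y z t → x :* (y :* z) :+ x :* (y :* t) := x :* (y :* (z :+ t))) refl
          where open +-*-Solver
        exchange : (∑[ k ∈ words ] (⟦ k ⋖? v ⟧ * through k)) ≡
                   (∑[ m ∈ words ] (χ a b m * (paths u m * (∑[ k ∈ words ] (⟦ k ⋖? v ⟧ * paths (τ m) k)))))
        exchange = begin
          (∑[ k ∈ words ] (⟦ k ⋖? v ⟧ * through k))
            ≡⟨ ∑-cong (λ k → sym (∑-*ˡ ⟦ k ⋖? v ⟧ (λ m → χ a b m * (paths u m * paths (τ m) k)) words)) words ⟩
          (∑[ k ∈ words ] ∑[ m ∈ words ] (⟦ k ⋖? v ⟧ * (χ a b m * (paths u m * paths (τ m) k))))
            ≡⟨ ∑-swap (λ k m → ⟦ k ⋖? v ⟧ * (χ a b m * (paths u m * paths (τ m) k))) words words ⟩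
          (∑[ m ∈ words ] ∑[ k ∈ words ] (⟦ k ⋖? v ⟧ * (χ a b m * (paths u m * paths (τ m) k))))
            ≡⟨ ∑-cong (λ m → ∑-cong (λ k → rotate ⟦ k ⋖? v ⟧ (χ a b m) (paths u m) (paths (τ m) k)) words) words ⟩
          (∑[ m ∈ words ] ∑[ k ∈ words ] (χ a b m * paths u m * (⟦ k ⋖? v ⟧ * paths (τ m) k)))
            ≡⟨ ∑-cong (λ m → ∑-*ˡ (χ a b m * paths u m) (λ k → ⟦ k ⋖? v ⟧ * paths (τ m) k) words) words ⟩
          (∑[ m ∈ words ] (χ a b m * paths u m * (∑[ k ∈ words ] (⟦ k ⋖? v ⟧ * paths (τ m) k))))
            ≡⟨ ∑-cong (λ m → ℕ.*-assoc (χ a b m) (paths u m) _) words ⟩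
          (∑[ m ∈ words ] (χ a b m * (paths u m * (∑[ k ∈ words ] (⟦ k ⋖? v ⟧ * paths (τ m) k))))) ∎
          where
          rotate : ∀ x y z t → x * (y * (z * t)) ≡ y * z * (x * t)
          rotate = solve 4 (λ x y z t → x :* (y :* (z :* t)) := y :* z :* (x :* t)) refl
            where open +-*-Solver
        term : ∀ k → ⟦ k ⋖? v ⟧ * paths u k ≡ χ a b k * (paths u k * ⟦ τ k ≈? v ⟧) + ⟦ k ⋖? v ⟧ * through k
        term k with pos-compare k (<⇒≢ a<b)
        ... | inj₂ b-a′ = trans (⟦⟧-*-cong (k ⋖? v) (λ (k≺v , _) → ih k k≺v b-a′))
          (cong (_+ ⟦ k ⋖? v ⟧ * through k) (sym (⟦⟧-*-vanish (then? a b k) (λ next → contradiction (then⇒< k next) (ℕ.<-asym b-a′)))))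
        ... | inj₁ a-b′ = begin
          ⟦ k ⋖? v ⟧ * paths u k  ≡⟨ cong (_* paths u k) (⟦⟧-⇔ (k ⋖? v) (then? a b k ×-dec (τ k ≈? v)) to from) ⟩
          ⟦ then? a b k ×-dec (τ k ≈? v) ⟧ * paths u k  ≡⟨ cong (_* paths u k) (⟦⟧-× (then? a b k) (τ k ≈? v)) ⟩
          χ a b k * ⟦ τ k ≈? v ⟧ * paths u k  ≡⟨ shuffle (χ a b k) ⟦ τ k ≈? v ⟧ (paths u k) ⟩
          χ a b k * (paths u k * ⟦ τ k ≈? v ⟧) + 0  ≡⟨ cong (χ a b k * (paths u k * ⟦ τ k ≈? v ⟧) +_) (sym (⟦⟧-*-vanish (k ⋖? v) (λ _ → none))) ⟩
          χ a b k * (paths u k * ⟦ τ k ≈? v ⟧) + ⟦ k ⋖? v ⟧ * through k ∎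
          where
          to = proj₁ (crossing-edge k v a-b′ b-a)
          from = proj₂ (crossing-edge k v a-b′ b-a)
          shuffle : ∀ x y z → x * y * z ≡ x * (z * y) + 0
          shuffle = solve 3 (λ x y z → x :* y :* z := x :* (z :* y) :+ con 0) refl
            where open +-*-Solver
          none : through k ≡ 0
          -- In `τ m` the letter `b` precedes `a`, and this inversion cannot be undone on the way up
          -- to `k`.
          none = ∑-vanish (λ m → ⟦⟧-*-vanish (then? a b m) λ next →
            trans (cong (paths u m *_) (paths-vanish (τ m) k λ τm≤k →
              ℕ.<-asym a-b′ (≤-inversion {τ m} {k} τm≤k a<b (then⇒< (τ m) (swap-then a b m next)))))
              (ℕ.*-zeroʳ (paths u m))) words

  module Symmetry (w : Word) where

    Inverted : Letter → Letter → Set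
    Inverted a b = a Fin.< b × pos w b < pos w a

    inverted? : ∀ a b → Dec (Inverted a b)
    inverted? a b = (a Fin.<? b) ×-dec (pos w b ℕ.<? pos w a)

    -- For the uniform weight `toggled` is enough. `rigid` is there for chains, where the partner of
    -- a chain is marked at another word; it compares the two words `u` and `m` between which the
    -- exchange is moved.
    record Insensitive (a b : Letter) (Φ : Word → ℕ) : Set where
      field
        resp    : ∀ {u v} → u ≈ v → Φ u ≡ Φ v
        toggled : ∀ u → a then b in-word u → Φ (swap a b u) ≡ Φ u
        rigid   : ∀ u v → a then b in-word u → a then b in-word v → u ≤ʷ v → v ≤ʷ w → Φ u ≡ Φ v

    -- Weights are defined on all words, where `swap` acts as a bijection; `supported` confines them
    -- to the interval.
    record ToggleSymmetric (N : Word → ℕ) : Set where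
      field
        N-resp    : ∀ {u v} → u ≈ v → N u ≡ N v
        supported : ∀ u → ¬ u ≤ʷ w → N u ≡ 0
        symmetric : ∀ {a b Φ} → Inverted a b → Insensitive a b Φ →
                    (∑[ u ∈ words ] (N u * (χ a b u * Φ u))) ≡ (∑[ u ∈ words ] (N u * (χ b a u * Φ u)))

    ≤w? : ∀ u → Dec (u ≤ʷ w)
    ≤w? u = u ≤ʷ? w

    ≤w-resp : ∀ {u v} → u ≈ v → ⟦ ≤w? u ⟧ ≡ ⟦ ≤w? v ⟧
    ≤w-resp {u} {v} u≈v = ⟦⟧-⇔ (≤w? u) (≤w? v)
      (λ u≤w → ≤ʷ-trans {v} {u} {w} (≈⇒≤ {v} {u} (≤ʷ.Eq.sym {u} {v} u≈v)) u≤w)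
      (λ v≤w → ≤ʷ-trans {u} {v} {w} (≈⇒≤ {u} {v} u≈v) v≤w)

    module _ {N : Word → ℕ} (N-resp : ∀ {u v} → u ≈ v → N u ≡ N v) {a b Φ} (ins : Insensitive a b Φ) where
      open Insensitive ins

      -- Pulls the sum over words with `b` just before `a` back along the exchange, so that both
      -- sides of the symmetry range over words with `a` just before `b`.
      ∑-toggled : (∑[ u ∈ words ] (N u * (χ b a u * Φ u))) ≡ (∑[ u ∈ words ] (χ a b u * (N (swap a b u) * Φ u)))
      ∑-toggled = trans (sym (∑-swap-words a b {λ u → N u * (χ b a u * Φ u)}
        (λ {u} {v} u≈v → cong₂ _*_ (N-resp {u} {v} u≈v) (cong₂ _*_ (χ-resp b a {u} {v} u≈v) (resp {u} {v} u≈v)))))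
        (∑-cong (λ u → begin
          N (swap a b u) * (χ b a (swap a b u) * Φ (swap a b u)) ≡⟨ x∙yz≈y∙xz (N (swap a b u)) (χ b a (swap a b u)) (Φ (swap a b u)) ⟩
          χ b a (swap a b u) * (N (swap a b u) * Φ (swap a b u)) ≡⟨ cong (_* (N (swap a b u) * Φ (swap a b u))) (χ-swap a b u) ⟩
          χ a b u * (N (swap a b u) * Φ (swap a b u))  ≡⟨ ⟦⟧-*-cong (then? a b u) (λ next → cong (N (swap a b u) *_) (toggled u next)) ⟩
          χ a b u * (N (swap a b u) * Φ u)  ∎) words)
        where open ≡-Reasoning

    uniform-symmetric : ToggleSymmetric (λ u → ⟦ ≤w? u ⟧)
    uniform-symmetric = record
      { N-resp    = λ {u} {v} → ≤w-resp {u} {v}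
      ; supported = λ u → ⟦⟧-no (≤w? u)
      ; symmetric = λ {a} {b} {Φ} inv ins → trans
          (∑-cong (λ u → trans (x∙yz≈y∙xz ⟦ ≤w? u ⟧ (χ a b u) (Φ u))
            (⟦⟧-*-cong (then? a b u) (λ next → cong (_* Φ u) (⟦⟧-⇔ (≤w? u) (≤w? (swap a b u))
              -- Exchanging upwards stays below `w` because the pair is inverted in `w`.
              (λ u≤w → swapped-≥ {u = swap a b u} {u} {w} (proj₁ inv) (swap-then a b u next) (Swapped-sym (swap-swapped a b u)) u≤w (proj₂ inv))
              (λ v≤w → ≤ʷ-trans {u} {swap a b u} {w} (≤-swap u (proj₁ inv) next) v≤w))))) words)
          (sym (∑-toggled (λ {u} {v} → ≤w-resp {u} {v}) ins))
      }

    chains : Word → ℕ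
    chains u = paths Perm.id u * paths u w

    chains-resp : ∀ {u v} → u ≈ v → chains u ≡ chains v
    chains-resp {u} {v} u≈v = cong₂ _*_ (paths-resp {Perm.id} {Perm.id} {u} {v} (≤ʷ.Eq.refl {Perm.id}) u≈v)
                                        (paths-resp {u} {v} {w} {w} u≈v (≤ʷ.Eq.refl {w}))

    chains-symmetric : ToggleSymmetric chains
    chains-symmetric = record
      { N-resp    = λ {u} {v} → chains-resp {u} {v}
      ; supported = λ u u≰w → trans (cong (paths Perm.id u *_) (paths-vanish u w u≰w)) (ℕ.*-zeroʳ (paths Perm.id u))
      ; symmetric = λ {a} {b} {Φ} inv ins → sym-chains inv ins
      }
      where
      -- A chain marked at `u` runs through the identity, `u`, `m`, `τ m`, `w`. Replacing the
      -- stretch from `u` to `m` by the parallel one from `τ u` to `τ m` gives a chain through the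
      -- identity, `u`, `τ u`, `τ m`, `w`, marked at `τ m`. `expand-left` and `expand-right` count
      -- the two kinds by the place of the exchange.
      sym-chains : ∀ {a b Φ} → Inverted a b → Insensitive a b Φ →
                   (∑[ u ∈ words ] (chains u * (χ a b u * Φ u))) ≡ (∑[ u ∈ words ] (chains u * (χ b a u * Φ u)))
      sym-chains {a} {b} {Φ} (a<b , b-a) ins = begin
        (∑[ u ∈ words ] (chains u * (χ a b u * Φ u)))
          ≡⟨ ∑-cong expand-left words ⟩
        (∑[ u ∈ words ] ∑[ m ∈ words ] (χ a b u * (χ a b m * (P u * (paths u m * (paths (τ m) w * Φ u))))))
          ≡⟨ ∑-cong (λ u → ∑-cong (λ m → ⟦⟧-*-cong (then? a b u) λ u-next → ⟦⟧-*-cong (then? a b m) λ m-next →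
               cong (P u *_) (parallel u m u-next m-next)) words) words ⟩
        (∑[ u ∈ words ] ∑[ m ∈ words ] (χ a b u * (χ a b m * (P u * (paths (τ u) (τ m) * (paths (τ m) w * Φ m))))))
          ≡⟨ ∑-swap (λ u m → χ a b u * (χ a b m * (P u * (paths (τ u) (τ m) * (paths (τ m) w * Φ m))))) words words ⟩
        (∑[ m ∈ words ] ∑[ u ∈ words ] (χ a b u * (χ a b m * (P u * (paths (τ u) (τ m) * (paths (τ m) w * Φ m))))))
          ≡⟨ ∑-cong (λ m → sym (expand-right m)) words ⟩
        (∑[ m ∈ words ] (χ a b m * (chains (τ m) * Φ m)))
          ≡⟨ sym (∑-toggled (λ {u} {v} → chains-resp {u} {v}) ins) ⟩
        (∑[ u ∈ words ] (chains u * (χ b a u * Φ u))) ∎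
        where
        open ≡-Reasoning
        open Insensitive ins
        τ = swap a b
        P = paths Perm.id
        expand-left : ∀ u → chains u * (χ a b u * Φ u) ≡
                      ∑[ m ∈ words ] (χ a b u * (χ a b m * (P u * (paths u m * (paths (τ m) w * Φ u)))))
        expand-left u = begin
          P u * paths u w * (χ a b u * Φ u)  ≡⟨ r₁ (P u) (paths u w) (χ a b u) (Φ u) ⟩
          χ a b u * (P u * Φ u * paths u w)  ≡⟨ ⟦⟧-*-cong (then? a b u) (λ next →
                                                                                   cong (P u * Φ u *_) (paths-crossing a<b u w (then⇒< u next) b-a)) ⟩
          χ a b u * (P u * Φ u * (∑[ m ∈ words ] (χ a b m * (paths u m * paths (τ m) w))))
            ≡⟨ sym (ℕ.*-assoc (χ a b u) (P u * Φ u) _) ⟩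
          χ a b u * (P u * Φ u) * (∑[ m ∈ words ] (χ a b m * (paths u m * paths (τ m) w)))
            ≡⟨ sym (∑-*ˡ (χ a b u * (P u * Φ u)) (λ m → χ a b m * (paths u m * paths (τ m) w)) words) ⟩
          (∑[ m ∈ words ] (χ a b u * (P u * Φ u) * (χ a b m * (paths u m * paths (τ m) w))))
            ≡⟨ ∑-cong (λ m → r₂ (χ a b u) (P u) (Φ u) (χ a b m) (paths u m) (paths (τ m) w)) words ⟩
          (∑[ m ∈ words ] (χ a b u * (χ a b m * (P u * (paths u m * (paths (τ m) w * Φ u)))))) ∎
          where
          r₁ : ∀ p q x f → p * q * (x * f) ≡ x * (p * f * q)
          r₁ = solve 4 (λ p q x f → p :* q :* (x :* f) := x :* (p :* f :* q)) refl
            where open +-*-Solver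
          r₂ : ∀ x p f y q r → x * (p * f) * (y * (q * r)) ≡ x * (y * (p * (q * (r * f))))
          r₂ = solve 6 (λ x p f y q r → x :* (p :* f) :* (y :* (q :* r)) := x :* (y :* (p :* (q :* (r :* f))))) refl
            where open +-*-Solver
        expand-right : ∀ m → χ a b m * (chains (τ m) * Φ m) ≡
                       ∑[ u ∈ words ] (χ a b u * (χ a b m * (P u * (paths (τ u) (τ m) * (paths (τ m) w * Φ m)))))
        expand-right m = begin
          χ a b m * (P (τ m) * paths (τ m) w * Φ m)
            ≡⟨ ⟦⟧-*-cong (then? a b m) (λ next → trans (r₁ (P (τ m)) (paths (τ m) w) (Φ m))
                 (cong (paths (τ m) w * Φ m *_) (paths-crossing a<b Perm.id (τ m)
                   (subst₂ _<_ (sym (pos-id a)) (sym (pos-id b)) a<b) (then⇒< (τ m) (swap-then a b m next))))) ⟩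
          χ a b m * (paths (τ m) w * Φ m * (∑[ u ∈ words ] (χ a b u * (P u * paths (τ u) (τ m)))))
            ≡⟨ sym (ℕ.*-assoc (χ a b m) (paths (τ m) w * Φ m) _) ⟩
          χ a b m * (paths (τ m) w * Φ m) * (∑[ u ∈ words ] (χ a b u * (P u * paths (τ u) (τ m))))
            ≡⟨ sym (∑-*ˡ (χ a b m * (paths (τ m) w * Φ m)) (λ u → χ a b u * (P u * paths (τ u) (τ m))) words) ⟩
          (∑[ u ∈ words ] (χ a b m * (paths (τ m) w * Φ m) * (χ a b u * (P u * paths (τ u) (τ m)))))
            ≡⟨ ∑-cong (λ u → r₂ (χ a b m) (paths (τ m) w) (Φ m) (χ a b u) (P u) (paths (τ u) (τ m))) words ⟩
          (∑[ u ∈ words ] (χ a b u * (χ a b m * (P u * (paths (τ u) (τ m) * (paths (τ m) w * Φ m)))))) ∎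
          where
          r₁ : ∀ p q f → p * q * f ≡ q * f * p
          r₁ = solve 3 (λ p q f → p :* q :* f := q :* f :* p) refl
            where open +-*-Solver
          r₂ : ∀ y r f x p q → y * (r * f) * (x * (p * q)) ≡ x * (y * (p * (q * (r * f))))
          r₂ = solve 6 (λ y r f x p q → y :* (r :* f) :* (x :* (p :* q)) := x :* (y :* (p :* (q :* (r :* f))))) refl
            where open +-*-Solver
        parallel : ∀ u m → a then b in-word u → a then b in-word m →
                   paths u m * (paths (τ m) w * Φ u) ≡ paths (τ u) (τ m) * (paths (τ m) w * Φ m)
        parallel u m u-next m-next = trans
          (cong (_* (paths (τ m) w * Φ u)) same)
          (split (u ≤ʷ? m) (τ m ≤ʷ? w))
          where
          same : paths u m ≡ paths (τ u) (τ m)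
          same = paths-swap a<b u m (then⇒good u u-next) (then⇒good m m-next)
          split : Dec (u ≤ʷ m) → Dec (τ m ≤ʷ w) →
                  paths (τ u) (τ m) * (paths (τ m) w * Φ u) ≡ paths (τ u) (τ m) * (paths (τ m) w * Φ m)
          -- `rigid` speaks only of `u ≤ʷ m` below `w`; otherwise one of the path counts is zero.
          split (no u≰m) _ = trans (cong (_* (paths (τ m) w * Φ u)) zero′) (sym (cong (_* (paths (τ m) w * Φ m)) zero′))
            where
            zero′ : paths (τ u) (τ m) ≡ 0
            zero′ = trans (sym same) (paths-vanish u m u≰m)
          split (yes _) (no m≰w) = cong (λ x → paths (τ u) (τ m) * x)
            (trans (cong (_* Φ u) (paths-vanish (τ m) w m≰w)) (sym (cong (_* Φ m) (paths-vanish (τ m) w m≰w))))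
          split (yes u≤m) (yes m≤w) = cong (λ x → paths (τ u) (τ m) * (paths (τ m) w * x))
            (rigid u m u-next m-next u≤m (≤ʷ-trans {m} {τ m} {w} (≤-swap m a<b m-next) m≤w))

opaque
  unfolding ⟦_⟧

  ⟦⟧-exclusive : {P Q : Set} (P? : Dec P) (Q? : Dec Q) → P ⊎ Q → (P → ¬ Q) → ⟦ P? ⟧ + ⟦ Q? ⟧ ≡ 1
  ⟦⟧-exclusive (yes p) (yes q) _        excl = contradiction q (excl p)
  ⟦⟧-exclusive (yes _) (no _)  _        _    = refl
  ⟦⟧-exclusive (no _)  (yes _) _        _    = refl
  ⟦⟧-exclusive (no ¬p) (no ¬q) (inj₁ p) _    = contradiction p ¬p
  ⟦⟧-exclusive (no ¬p) (no ¬q) (inj₂ q) _    = contradiction q ¬q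

-- Rooks

module Rook (n : ℕ) where
  open Toggle n
  private module L = FinSum n

  letters : List Letter
  letters = allFin n

  ∑-χʳ : ∀ u a → (∑[ b ∈ letters ] χ a b u) ≡ ⟦ suc (pos u a) ℕ.<? n ⟧
  ∑-χʳ u a = L.∑-∃! (suc (pos u a) ℕ.<? n) (λ b → then? a b u) (λ { refl q → q })
    (λ p q → pos-injective u (trans p (sym q)))
    (λ lt → let (b , eq) = letterAt u lt in Any.map (λ { refl → eq }) (∈-allFin b))
    (λ {b} eq → subst (_< n) eq (pos<n u b))

  ∑-χˡ : ∀ u b → (∑[ a ∈ letters ] χ a b u) ≡ ⟦ 0 ℕ.<? pos u b ⟧
  ∑-χˡ u b = L.∑-∃! (0 ℕ.<? pos u b) (λ a → then? a b u) (λ { refl q → q })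
    (λ p q → pos-injective u (ℕ.suc-injective (trans (sym p) q)))
    (λ lt → witness (pos u b) refl lt)
    (λ {a} eq → subst (0 <_) (sym eq) z<s)
    where
    witness : ∀ k → pos u b ≡ k → 0 < k → Any.Any (λ a → a then b in-word u) letters
    witness (suc k) eq _ = let (a , eq′) = letterAt u (ℕ.<-trans (ℕ.n<1+n k) (subst (_< n) eq (pos<n u b))) in
      Any.map (λ { refl → trans eq (cong suc (sym eq′)) }) (∈-allFin a)

  -- The letter argument ensures that the word is nonempty.
  ∑-last : ∀ u → Letter → (∑[ a ∈ letters ] ⟦ suc (pos u a) ℕ.≟ n ⟧) ≡ 1
  ∑-last u a₀ = trans (L.∑-∃! (0 ℕ.<? n) (λ a → suc (pos u a) ℕ.≟ n) (λ { refl q → q })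
    (λ p q → pos-injective u (ℕ.suc-injective (trans p (sym q))))
    (λ lt → witness n refl lt) (λ {a} eq → subst (0 <_) eq z<s))
    (⟦⟧-yes (0 ℕ.<? n) (ℕ.≤-<-trans z≤n (Fin.toℕ<n a₀)))
    where
    witness : ∀ k → n ≡ k → 0 < k → Any.Any (λ a → suc (pos u a) ≡ n) letters
    witness (suc k) eq _ = let (a , eq′) = letterAt u (subst (k <_) (sym eq) (ℕ.n<1+n k)) in
      Any.map (λ { refl → trans (cong suc eq′) (sym eq) }) (∈-allFin a)

  module _ (u : Word) (A B : Letter → Letter → ℕ) (ψ : Letter → ℕ) (a₀ : Letter)
           (step : ∀ c d → c then d in-word u → A c d + ψ c ≡ B c d + ψ d)
           (first : ∀ c → pos u c ≡ 0 → ψ c ≡ 0) (last : ∀ c → suc (pos u c) ≡ n → ψ c ≡ 1) where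

    private
      ∑₂ : (Letter → Letter → ℕ) → ℕ
      ∑₂ F = ∑[ c ∈ letters ] ∑[ d ∈ letters ] (χ c d u * F c d)

      Ψ : ℕ
      Ψ = ∑ letters ψ

      ∑₂-+ : ∀ F G → ∑₂ (λ c d → F c d + G c d) ≡ ∑₂ F + ∑₂ G
      ∑₂-+ F G = trans (∑-cong (λ c → trans (∑-cong (λ d → ℕ.*-distribˡ-+ (χ c d u) (F c d) (G c d)) letters)
        (∑-+ (λ d → χ c d u * F c d) (λ d → χ c d u * G c d) letters)) letters)
        (∑-+ (λ c → ∑[ d ∈ letters ] (χ c d u * F c d)) (λ c → ∑[ d ∈ letters ] (χ c d u * G c d)) letters)

      starts : ∑₂ (λ c _ → ψ c) + 1 ≡ Ψ
      starts = begin
        ∑₂ (λ c _ → ψ c) + 1  ≡⟨ cong₂ _+_ (∑-cong (λ c → trans (∑-*ʳ (ψ c) (λ d → χ c d u) letters) (cong (_* ψ c) (∑-χʳ u c))) letters) (sym (∑-last u a₀)) ⟩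
        (∑[ c ∈ letters ] (⟦ suc (pos u c) ℕ.<? n ⟧ * ψ c)) + (∑[ c ∈ letters ] ⟦ suc (pos u c) ℕ.≟ n ⟧) ≡⟨ sym (∑-+ (λ c → ⟦ suc (pos u c) ℕ.<? n ⟧ * ψ c) (λ c → ⟦ suc (pos u c) ℕ.≟ n ⟧) letters) ⟩
        (∑[ c ∈ letters ] (⟦ suc (pos u c) ℕ.<? n ⟧ * ψ c + ⟦ suc (pos u c) ℕ.≟ n ⟧)) ≡⟨ ∑-cong term letters ⟩
        Ψ ∎
        where
        open ≡-Reasoning
        term : ∀ c → ⟦ suc (pos u c) ℕ.<? n ⟧ * ψ c + ⟦ suc (pos u c) ℕ.≟ n ⟧ ≡ ψ c
        term c with ℕ.m≤n⇒m<n∨m≡n (pos<n u c)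
        ... | inj₁ lt = trans (cong₂ _+_ (trans (cong (_* ψ c) (⟦⟧-yes (suc (pos u c) ℕ.<? n) lt)) (ℕ.*-identityˡ (ψ c)))
                                         (⟦⟧-no (suc (pos u c) ℕ.≟ n) (ℕ.<⇒≢ lt))) (ℕ.+-identityʳ (ψ c))
        ... | inj₂ eq = trans (cong₂ _+_ (cong (_* ψ c) (⟦⟧-no (suc (pos u c) ℕ.<? n) (ℕ.<-irrefl eq)))
                                         (⟦⟧-yes (suc (pos u c) ℕ.≟ n) eq)) (sym (last c eq))

      ends : ∑₂ (λ _ d → ψ d) ≡ Ψ
      ends = trans (∑-swap (λ c d → χ c d u * ψ d) letters letters)
        (∑-cong (λ d → trans (∑-*ʳ (ψ d) (λ c → χ c d u) letters) (trans (cong (_* ψ d) (∑-χˡ u d)) (term d))) letters)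
        where
        term : ∀ d → ⟦ 0 ℕ.<? pos u d ⟧ * ψ d ≡ ψ d
        term d with 0 ℕ.<? pos u d
        ... | yes lt = trans (cong (_* ψ d) (⟦⟧-yes (yes lt) lt)) (ℕ.*-identityˡ (ψ d))
        ... | no ¬lt = trans (cong (⟦ no ¬lt ⟧ *_) ψ≡0) (trans (ℕ.*-zeroʳ ⟦ no ¬lt ⟧) (sym ψ≡0))
          where ψ≡0 = first d (ℕ.n≤0⇒n≡0 (ℕ.≮⇒≥ ¬lt))

    -- By `step`, `A` exceeds `B` by the increment of `ψ` along each adjacent pair, and `ψ` rises
    -- from 0 at the first letter to 1 at the last. To avoid subtraction, the sums of `ψ` over left
    -- and over right members of the pairs are compared through `Ψ`.
    telescope : ∑₂ A ≡ 1 + ∑₂ B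
    telescope = ℕ.+-cancelʳ-≡ (∑₂ (λ c _ → ψ c)) (∑₂ A) (1 + ∑₂ B) (begin
      ∑₂ A + ∑₂ (λ c _ → ψ c)  ≡⟨ sym (∑₂-+ A (λ c _ → ψ c)) ⟩
      ∑₂ (λ c d → A c d + ψ c)  ≡⟨ ∑-cong (λ c → ∑-cong (λ d → ⟦⟧-*-cong (then? c d u) (step c d)) letters) letters ⟩
      ∑₂ (λ c d → B c d + ψ d)  ≡⟨ ∑₂-+ B (λ _ d → ψ d) ⟩
      ∑₂ B + ∑₂ (λ _ d → ψ d)  ≡⟨ cong (∑₂ B +_) (trans ends (sym starts)) ⟩
      ∑₂ B + (∑₂ (λ c _ → ψ c) + 1)  ≡⟨ rearrange (∑₂ B) (∑₂ (λ c _ → ψ c)) ⟩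
      1 + ∑₂ B + ∑₂ (λ c _ → ψ c)  ∎)
      where
      open ≡-Reasoning
      rearrange : ∀ b s → b + (s + 1) ≡ 1 + b + s
      rearrange = solve 2 (λ b s → b :+ (s :+ con 1) := con 1 :+ b :+ s) refl
        where open +-*-Solver

  -- Weak, so that a letter compared with itself counts in both directions. This excess later
  -- singles out the column of `x₀` and the row of `y₀`.
  weakly : Letter → Letter → Word → ℕ
  weakly a b u = ⟦ pos u a ℕ.≤? pos u b ⟧

  module _ (u : Word) {p q : Letter} (X Y : Letter → ℕ) (p-q : pos u p < pos u q)
           (Yp : Y p ≡ 0) (Yq : Y q ≡ 1)
           (typed : ∀ c → pos u p ≤ pos u c → pos u c ≤ pos u q → X c + Y c ≡ 1) where

    private
      A B : Letter → Letter → ℕ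
      A c d = X c * Y d * (weakly p c u + weakly d q u) + X d * Y c * (weakly q c u + weakly d p u)
      B c d = X c * Y d + X d * Y c

      -- ψ is the type of the letter between p and q, extended by 0 to the left and 1 to the right. The weights in A
      -- agree with those in B outside this range and are 2 and 0 inside, so A + ψ = B + ψ along each adjacent pair.
      inside : Letter → ℕ
      inside c = ⟦ (pos u p ℕ.≤? pos u c) ×-dec (pos u c ℕ.≤? pos u q) ⟧

      ψ : Letter → ℕ
      ψ c = ⟦ pos u q ℕ.<? pos u c ⟧ + inside c * Y c

      ψ-before : ∀ c → pos u c ≤ pos u p → ψ c ≡ 0
      ψ-before c c≤p = cong₂ _+_ (⟦⟧-no (pos u q ℕ.<? pos u c) (ℕ.<-asym (ℕ.≤-<-trans c≤p p-q)))
        (⟦⟧-*-vanish ((pos u p ℕ.≤? pos u c) ×-dec (pos u c ℕ.≤? pos u q)) λ (p≤c , _) →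
          trans (cong Y (pos-injective u (ℕ.≤-antisym c≤p p≤c))) Yp)

      ψ-inside : ∀ c → pos u p ≤ pos u c → pos u c ≤ pos u q → ψ c ≡ Y c
      ψ-inside c p≤c c≤q = cong₂ _+_ (⟦⟧-no (pos u q ℕ.<? pos u c) (ℕ.≤⇒≯ c≤q))
        (trans (cong (_* Y c) (⟦⟧-yes ((pos u p ℕ.≤? pos u c) ×-dec (pos u c ℕ.≤? pos u q)) (p≤c , c≤q))) (ℕ.*-identityˡ (Y c)))

      ψ-after : ∀ c → pos u q ≤ pos u c → ψ c ≡ 1
      ψ-after c q≤c with ℕ.m≤n⇒m<n∨m≡n q≤c
      ... | inj₁ q<c = cong₂ _+_ (⟦⟧-yes (pos u q ℕ.<? pos u c) q<c)
        (cong (_* Y c) (⟦⟧-no ((pos u p ℕ.≤? pos u c) ×-dec (pos u c ℕ.≤? pos u q)) λ (_ , c≤q) → ℕ.<⇒≱ q<c c≤q))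
      ... | inj₂ q≡c with pos-injective u q≡c
      ...   | refl = trans (ψ-inside q (ℕ.<⇒≤ p-q) ℕ.≤-refl) Yq

      step : ∀ c d → c then d in-word u → A c d + ψ c ≡ B c d + ψ d
      step c d next with ℕ.<-≤-connex (pos u c) (pos u p) | ℕ.≤-<-connex (pos u q) (pos u c)
      ... | inj₁ c<p | _ = cong₂ _+_
        (cong₂ _+_
          (weight (X c * Y d) (⟦⟧-no (pos u p ℕ.≤? pos u c) (ℕ.<⇒≱ c<p))
                              (⟦⟧-yes (pos u d ℕ.≤? pos u q) (ℕ.≤-trans d≤p (ℕ.<⇒≤ p-q))))
          (weight (X d * Y c) (⟦⟧-no (pos u q ℕ.≤? pos u c) (ℕ.<⇒≱ (ℕ.<-trans c<p p-q)))
                              (⟦⟧-yes (pos u d ℕ.≤? pos u p) d≤p)))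
        (trans (ψ-before c (ℕ.<⇒≤ c<p)) (sym (ψ-before d d≤p)))
        where
        d≤p : pos u d ≤ pos u p
        d≤p = ℕ.≤-trans (ℕ.≤-reflexive next) c<p
        weight : ∀ x {y z} → y ≡ 0 → z ≡ 1 → x * (y + z) ≡ x
        weight x refl refl = ℕ.*-identityʳ x
      ... | inj₂ _ | inj₁ q≤c = cong₂ _+_
        (cong₂ _+_
          (weight (X c * Y d) (⟦⟧-yes (pos u p ℕ.≤? pos u c) (ℕ.≤-trans (ℕ.<⇒≤ p-q) q≤c))
                              (⟦⟧-no (pos u d ℕ.≤? pos u q) (ℕ.<⇒≱ q<d)))
          (weight (X d * Y c) (⟦⟧-yes (pos u q ℕ.≤? pos u c) q≤c)
                              (⟦⟧-no (pos u d ℕ.≤? pos u p) (ℕ.<⇒≱ (ℕ.<-trans p-q q<d)))))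
        (trans (ψ-after c q≤c) (sym (ψ-after d (ℕ.<⇒≤ q<d))))
        where
        q<d : pos u q < pos u d
        q<d = ℕ.≤-<-trans q≤c (then⇒< u next)
        weight : ∀ x {y z} → y ≡ 1 → z ≡ 0 → x * (y + z) ≡ x
        weight x refl refl = ℕ.*-identityʳ x
      ... | inj₂ p≤c | inj₂ c<q = begin
        A c d + ψ c
          ≡⟨ cong₂ _+_ (cong₂ _+_
               (cong (X c * Y d *_) (cong₂ _+_ (⟦⟧-yes (pos u p ℕ.≤? pos u c) p≤c) (⟦⟧-yes (pos u d ℕ.≤? pos u q) d≤q)))
               (cong (X d * Y c *_) (cong₂ _+_ (⟦⟧-no (pos u q ℕ.≤? pos u c) (ℕ.<⇒≱ c<q)) (⟦⟧-no (pos u d ℕ.≤? pos u p) (ℕ.<⇒≱ p<d)))))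
               (ψ-inside c p≤c (ℕ.<⇒≤ c<q)) ⟩
        X c * Y d * 2 + X d * Y c * 0 + Y c
          -- Both letters lie between `p` and `q`: the factor `X d + Y d = 1` is inserted here, and
          -- `X c + Y c = 1` is removed below.
          ≡⟨ cong (λ z → X c * Y d * 2 + X d * Y c * 0 + z) (trans (sym (ℕ.*-identityʳ (Y c))) (cong (Y c *_) (sym (typed d (ℕ.<⇒≤ p<d) d≤q)))) ⟩
        X c * Y d * 2 + X d * Y c * 0 + Y c * (X d + Y d)
          ≡⟨ rearrange (X c) (Y c) (X d) (Y d) ⟩
        X c * Y d + X d * Y c + (X c + Y c) * Y d
          ≡⟨ cong (B c d +_) (trans (cong (_* Y d) (typed c p≤c (ℕ.<⇒≤ c<q))) (ℕ.*-identityˡ (Y d))) ⟩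
        B c d + Y d
          ≡⟨ cong (B c d +_) (sym (ψ-inside d (ℕ.<⇒≤ p<d) d≤q)) ⟩
        B c d + ψ d ∎
        where
        open ≡-Reasoning
        p<d : pos u p < pos u d
        p<d = ℕ.≤-<-trans p≤c (then⇒< u next)
        d≤q : pos u d ≤ pos u q
        d≤q = ℕ.≤-trans (ℕ.≤-reflexive next) c<q
        rearrange : ∀ xc yc xd yd → xc * yd * 2 + xd * yc * 0 + yc * (xd + yd) ≡ xc * yd + xd * yc + (xc + yc) * yd
        rearrange = solve 4 (λ xc yc xd yd → xc :* yd :* con 2 :+ xd :* yc :* con 0 :+ yc :* (xd :+ yd)
                                          := xc :* yd :+ xd :* yc :+ (xc :+ yc) :* yd) refl
          where open +-*-Solver

    walk : (∑[ c ∈ letters ] ∑[ d ∈ letters ] (χ c d u * A c d)) ≡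
           1 + (∑[ c ∈ letters ] ∑[ d ∈ letters ] (χ c d u * B c d))
    walk = telescope u A B ψ p step (λ c eq → ψ-before c (subst (_≤ pos u p) (sym eq) z≤n))
      (λ c eq → ψ-after c (ℕ.≤-pred (ℕ.≤-trans (pos<n u q) (ℕ.≤-reflexive (sym eq)))))

-- The rook identity for toggle symmetric weights

module Expectation (n : ℕ) (w : Weak.Word n) where
  open Toggle n
  open Rook n
  open Symmetry w
  private module L = FinSum n

  inverted-irrefl : ∀ {a} → ¬ Inverted a a
  inverted-irrefl (a<a , _) = ℕ.<-irrefl refl a<a

  ¬inverted⇒order : ∀ {a b} → a Fin.< b → ¬ Inverted a b → pos w a < pos w b
  ¬inverted⇒order a<b ¬inv with pos-compare w (<⇒≢ a<b)
  ... | inj₁ a-b = a-b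
  ... | inj₂ b-a = contradiction (a<b , b-a) ¬inv

  -- Boxes of the Rothe diagram are named by their values: y₀ is the letter of the row and x₀ that of the column.
  record Rook□ (x₀ y₀ : Letter) : Set where
    field
      box       : Inverted x₀ y₀
      rectangle : ∀ {x y} → Inverted x y₀ → Inverted x₀ y → Inverted x y

  weakly-resp : ∀ a b {u v} → u ≈ v → weakly a b u ≡ weakly a b v
  weakly-resp a b {u} {v} u≈v = ⟦⟧-⇔ (pos u a ℕ.≤? pos u b) (pos v a ℕ.≤? pos v b)
    (subst₂ _≤_ (pos-≈⁻ {u} {v} u≈v a) (pos-≈⁻ {u} {v} u≈v b))
    (subst₂ _≤_ (sym (pos-≈⁻ {u} {v} u≈v a)) (sym (pos-≈⁻ {u} {v} u≈v b)))

  const-insensitive : ∀ a b → Insensitive a b (λ _ → 1)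
  const-insensitive a b = record { resp = λ _ → refl ; toggled = λ _ _ → refl ; rigid = λ _ _ _ _ _ _ → refl }

  module _ {x₀ y₀ : Letter} (rook : Rook□ x₀ y₀) where
    open Rook□ rook

    private
      X Y : Letter → ℕ
      X x = ⟦ inverted? x y₀ ⟧
      Y y = ⟦ inverted? x₀ y ⟧

      -- Otherwise the rectangle would contain the box of `c` with itself.
      not-both : ∀ {c} → Inverted c y₀ → ¬ Inverted x₀ c
      not-both c-y₀ x₀-c = inverted-irrefl (rectangle c-y₀ x₀-c)

    -- `x₀` is a third letter and cannot stand between the neighbours `x` and `y`; hence `toggled`.
    -- For `rigid` with `x₀` less than `x`, the pair is not inverted in `w`, so all words below `w`
    -- order it alike. With `x` less than `x₀`, an inversion of the pair in `u` persists in `v`.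
    -- Conversely, if `x` precedes `x₀` in `u`, so does its neighbour `y`; this inverts `x₀` and
    -- `y`, also in `v`, where `x` just before `y` then precedes `x₀` too.
    column-insensitive : ∀ {x y} → Inverted x y₀ → Inverted x₀ y → x₀ ≢ x → Insensitive x y (weakly x₀ x)
    column-insensitive {x} {y} x-y₀ x₀-y x₀≢x = record
      { resp    = λ {u} {v} → weakly-resp x₀ x {u} {v}
      ; toggled = toggled
      ; rigid   = rigid
      }
      where
      x₀≢y : x₀ ≢ y
      x₀≢y = <⇒≢ (proj₁ x₀-y)
      toggled : ∀ u → x then y in-word u → weakly x₀ x (swap x y u) ≡ weakly x₀ x u
      toggled u next = ⟦⟧-⇔ (pos (swap x y u) x₀ ℕ.≤? pos (swap x y u) x) (pos u x₀ ℕ.≤? pos u x)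
        (λ le → ℕ.≤-pred (ℕ.≤∧≢⇒< (subst₂ _≤_ (S.pos-other x₀≢x x₀≢y) (trans S.pos-a next) le)
                                  (λ eq → pos-≢ u x₀≢y (trans eq (sym next)))))
        (λ le → subst₂ _≤_ (sym (S.pos-other x₀≢x x₀≢y)) (sym (trans S.pos-a next)) (ℕ.m≤n⇒m≤1+n le))
        where module S = Swapped (swap-swapped x y u)
      rigid : ∀ u v → x then y in-word u → x then y in-word v → u ≤ʷ v → v ≤ʷ w → weakly x₀ x u ≡ weakly x₀ x v
      rigid u v u-next v-next u≤v v≤w with Fin.<-cmp x₀ x
      ... | tri≈ _ x₀≡x _ = contradiction x₀≡x x₀≢x
      ... | tri< x₀<x _ _ = trans (⟦⟧-yes (pos u x₀ ℕ.≤? pos u x) (ℕ.<⇒≤ (≤-noninversion {u} {v} u≤v x₀<x v-ord)))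
                                  (sym (⟦⟧-yes (pos v x₀ ℕ.≤? pos v x) (ℕ.<⇒≤ v-ord)))
        where
        v-ord : pos v x₀ < pos v x
        v-ord = ≤-noninversion {v} {w} v≤w x₀<x (¬inverted⇒order x₀<x (not-both x-y₀))
      ... | tri> _ _ x<x₀ = ⟦⟧-⇔ (pos u x₀ ℕ.≤? pos u x) (pos v x₀ ℕ.≤? pos v x)
        (λ le → ℕ.<⇒≤ (≤-inversion {u} {v} u≤v x<x₀ (ℕ.≤∧≢⇒< le (pos-≢ u x₀≢x)))) back
        where
        back : pos v x₀ ≤ pos v x → pos u x₀ ≤ pos u x
        back le with pos-compare u x₀≢x
        ... | inj₁ x₀-x = ℕ.<⇒≤ x₀-x
        ... | inj₂ x-x₀ = contradiction
          (ℕ.<-trans (≤-inversion {u} {v} u≤v (proj₁ x₀-y)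
            (ℕ.≤∧≢⇒< (ℕ.≤-trans (ℕ.≤-reflexive u-next) x-x₀) (pos-≢ u (x₀≢y ∘ sym)))) (ℕ.≤∧≢⇒< le (pos-≢ v x₀≢x)))
          (ℕ.<-asym (then⇒< v v-next))

    -- Mirror image of `column-insensitive`: reversing both positions and values exchanges the roles
    -- of `x` and `y`.
    row-insensitive : ∀ {x y} → Inverted x y₀ → Inverted x₀ y → y₀ ≢ y → Insensitive x y (weakly y y₀)
    row-insensitive {x} {y} x-y₀ x₀-y y₀≢y = record
      { resp    = λ {u} {v} → weakly-resp y y₀ {u} {v}
      ; toggled = toggled
      ; rigid   = rigid
      }
      where
      y₀≢x : y₀ ≢ x
      y₀≢x = <⇒≢ (proj₁ x-y₀) ∘ sym
      toggled : ∀ u → x then y in-word u → weakly y y₀ (swap x y u) ≡ weakly y y₀ u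
      toggled u next = ⟦⟧-⇔ (pos (swap x y u) y ℕ.≤? pos (swap x y u) y₀) (pos u y ℕ.≤? pos u y₀)
        (λ le → ℕ.≤-trans (ℕ.≤-reflexive next) (ℕ.≤∧≢⇒< (subst₂ _≤_ S.pos-b (S.pos-other y₀≢x y₀≢y) le) (pos-≢ u (y₀≢x ∘ sym))))
        (λ le → subst₂ _≤_ (sym S.pos-b) (sym (S.pos-other y₀≢x y₀≢y)) (ℕ.≤-trans (ℕ.<⇒≤ (then⇒< u next)) le))
        where module S = Swapped (swap-swapped x y u)
      rigid : ∀ u v → x then y in-word u → x then y in-word v → u ≤ʷ v → v ≤ʷ w → weakly y y₀ u ≡ weakly y y₀ v
      rigid u v u-next v-next u≤v v≤w with Fin.<-cmp y y₀
      ... | tri≈ _ y≡y₀ _ = contradiction (sym y≡y₀) y₀≢y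
      ... | tri< y<y₀ _ _ = trans (⟦⟧-yes (pos u y ℕ.≤? pos u y₀) (ℕ.<⇒≤ (≤-noninversion {u} {v} u≤v y<y₀ v-ord)))
                                  (sym (⟦⟧-yes (pos v y ℕ.≤? pos v y₀) (ℕ.<⇒≤ v-ord)))
        where
        v-ord : pos v y < pos v y₀
        v-ord = ≤-noninversion {v} {w} v≤w y<y₀ (¬inverted⇒order y<y₀ (λ y-y₀ → not-both y-y₀ x₀-y))
      ... | tri> _ _ y₀<y = ⟦⟧-⇔ (pos u y ℕ.≤? pos u y₀) (pos v y ℕ.≤? pos v y₀)
        (λ le → ℕ.<⇒≤ (≤-inversion {u} {v} u≤v y₀<y (ℕ.≤∧≢⇒< le (pos-≢ u (y₀≢y ∘ sym))))) back
        where
        back : pos v y ≤ pos v y₀ → pos u y ≤ pos u y₀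
        back le with pos-compare u y₀≢y
        ... | inj₂ y-y₀ = ℕ.<⇒≤ y-y₀
        ... | inj₁ y₀-y = contradiction
          (ℕ.<-≤-trans (then⇒< v v-next) le)
          (ℕ.<-asym (≤-inversion {u} {v} u≤v (proj₁ x-y₀)
            (ℕ.≤∧≢⇒< (ℕ.≤-pred (ℕ.≤-trans y₀-y (ℕ.≤-reflexive u-next))) (pos-≢ u y₀≢x))))

    -- Between x₀ and y₀, every letter of u is either a column of the row of y₀ or a row of the column of x₀.
    typed : ∀ {u} → u ≤ʷ w → ∀ c → (pos u x₀ ≤ pos u c × pos u c ≤ pos u y₀) ⊎ (pos u y₀ ≤ pos u c × pos u c ≤ pos u x₀) →
            X c + Y c ≡ 1
    typed {u} u≤w c between = ⟦⟧-exclusive (inverted? c y₀) (inverted? x₀ c) (either between) not-both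
      where
      y₀-x₀ = proj₂ box
      x₀<y₀ = proj₁ box
      descends : ∀ {a b} → a Fin.< b → pos u b ≤ pos u a → Inverted a b
      descends a<b le = a<b , ≤-inversion {u} {w} u≤w a<b (ℕ.≤∧≢⇒< le (pos-≢ u (<⇒≢ a<b ∘ sym)))
      either : (pos u x₀ ≤ pos u c × pos u c ≤ pos u y₀) ⊎ (pos u y₀ ≤ pos u c × pos u c ≤ pos u x₀) →
               Inverted c y₀ ⊎ Inverted x₀ c
      either (inj₁ (x₀-c , c-y₀)) with Fin.<-cmp c x₀ | Fin.<-cmp c y₀
      ... | tri≈ _ refl _ | _             = inj₁ box
      ... | _             | tri≈ _ refl _ = inj₂ box
      ... | tri< c<x₀ _ _ | _             =
        inj₁ (ℕ.<-trans c<x₀ x₀<y₀ , ℕ.<-trans y₀-x₀ (proj₂ (descends c<x₀ x₀-c)))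
      ... | _             | tri> _ _ y₀<c =
        inj₂ (ℕ.<-trans x₀<y₀ y₀<c , ℕ.<-trans (proj₂ (descends y₀<c c-y₀)) y₀-x₀)
      -- Here the position in `w` decides: `y₀` precedes `x₀` there, so `c` either precedes `x₀` or
      -- follows `y₀`.
      ... | tri> _ _ x₀<c | tri< c<y₀ _ _ with pos-compare w (<⇒≢ x₀<c)
      ...   | inj₂ c-x₀  = inj₂ (x₀<c , c-x₀)
      ...   | inj₁ x₀-c′ = inj₁ (c<y₀ , ℕ.<-trans y₀-x₀ x₀-c′)
      either (inj₂ (y₀-c , c-x₀)) with Fin.<-cmp c y₀
      ... | tri≈ _ refl _ = inj₂ box
      ... | tri< c<y₀ _ _ = inj₁ (descends c<y₀ y₀-c)
      ... | tri> _ _ y₀<c = inj₂ (descends (ℕ.<-trans x₀<y₀ y₀<c) c-x₀)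

    private
      -- `α` weights `x` just before `y`, `β` the reversed neighbours. Each comparison in `α` occurs
      -- in the opposite direction in `β`, which is what `half` exploits.
      α β : Letter → Letter → Word → ℕ
      α x y u = weakly x₀ x u + weakly y y₀ u
      β x y u = weakly y₀ y u + weakly x x₀ u

      Y-x₀ : Y x₀ ≡ 0
      Y-x₀ = ⟦⟧-no (inverted? x₀ x₀) inverted-irrefl
      Y-y₀ : Y y₀ ≡ 1
      Y-y₀ = ⟦⟧-yes (inverted? x₀ y₀) box
      X-x₀ : X x₀ ≡ 1
      X-x₀ = ⟦⟧-yes (inverted? x₀ y₀) box
      X-y₀ : X y₀ ≡ 0
      X-y₀ = ⟦⟧-no (inverted? y₀ y₀) inverted-irrefl

      ∑□ : (Letter → Letter → ℕ) → ℕ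
      ∑□ F = ∑[ x ∈ letters ] ∑[ y ∈ letters ] (X x * Y y * F x y)

      split-pairs : ∀ u (F G : Letter → Letter → ℕ) →
        (∑[ c ∈ letters ] ∑[ d ∈ letters ] (χ c d u * (X c * Y d * F c d + X d * Y c * G d c))) ≡
        ∑□ (λ x y → χ x y u * F x y + χ y x u * G x y)
      split-pairs u F G = begin
        (∑[ c ∈ letters ] ∑[ d ∈ letters ] (χ c d u * (X c * Y d * F c d + X d * Y c * G d c)))
          ≡⟨ ∑-cong (λ c → ∑-cong (λ d → expand (χ c d u) (X c * Y d) (F c d) (X d * Y c) (G d c)) letters) letters ⟩
        (∑[ c ∈ letters ] ∑[ d ∈ letters ] (X c * Y d * (χ c d u * F c d) + X d * Y c * (χ c d u * G d c)))
          ≡⟨ ∑∑-+ (λ c d → X c * Y d * (χ c d u * F c d)) (λ c d → X d * Y c * (χ c d u * G d c)) ⟩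
        ∑□ (λ x y → χ x y u * F x y) + (∑[ c ∈ letters ] ∑[ d ∈ letters ] (X d * Y c * (χ c d u * G d c)))
          ≡⟨ cong (∑□ (λ x y → χ x y u * F x y) +_) (∑-swap (λ c d → X d * Y c * (χ c d u * G d c)) letters letters) ⟩
        ∑□ (λ x y → χ x y u * F x y) + ∑□ (λ x y → χ y x u * G x y)
          ≡⟨ sym (∑∑-+ (λ x y → X x * Y y * (χ x y u * F x y)) (λ x y → X x * Y y * (χ y x u * G x y))) ⟩
        (∑[ x ∈ letters ] ∑[ y ∈ letters ] (X x * Y y * (χ x y u * F x y) + X x * Y y * (χ y x u * G x y)))
          ≡⟨ ∑-cong (λ x → ∑-cong (λ y → sym (ℕ.*-distribˡ-+ (X x * Y y) (χ x y u * F x y) (χ y x u * G x y))) letters) letters ⟩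
        ∑□ (λ x y → χ x y u * F x y + χ y x u * G x y) ∎
        where
        open ≡-Reasoning
        expand : ∀ k p f q g → k * (p * f + q * g) ≡ p * (k * f) + q * (k * g)
        expand = solve 5 (λ k p f q g → k :* (p :* f :+ q :* g) := p :* (k :* f) :+ q :* (k :* g)) refl
          where open +-*-Solver
        ∑∑-+ : ∀ (F G : Letter → Letter → ℕ) → (∑[ c ∈ letters ] ∑[ d ∈ letters ] (F c d + G c d)) ≡
               (∑[ c ∈ letters ] ∑[ d ∈ letters ] F c d) + (∑[ c ∈ letters ] ∑[ d ∈ letters ] G c d)
        ∑∑-+ F G = trans (∑-cong (λ c → ∑-+ (F c) (G c) letters) letters) (∑-+ (λ c → ∑ letters (F c)) (λ c → ∑ letters (G c)) letters)

      rook-at : ∀ u → u ≤ʷ w → ∑□ (λ x y → χ x y u * α x y u + χ y x u * β x y u) ≡ 1 + ∑□ (λ x y → χ x y u * 1 + χ y x u * 1)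
      rook-at u u≤w = trans (sym (split-pairs u (λ x y → α x y u) (λ x y → β x y u)))
        (trans (go (pos-compare u (<⇒≢ (proj₁ box)))) (cong suc (trans
          (∑-cong (λ c → ∑-cong (λ d → cong (χ c d u *_) (sym (cong₂ _+_ (ℕ.*-identityʳ (X c * Y d)) (ℕ.*-identityʳ (X d * Y c))))) letters) letters)
          (split-pairs u (λ _ _ → 1) (λ _ _ → 1)))))
        where
        Goal : Set
        Goal = (∑[ c ∈ letters ] ∑[ d ∈ letters ] (χ c d u * (X c * Y d * α c d u + X d * Y c * β d c u))) ≡
               1 + (∑[ c ∈ letters ] ∑[ d ∈ letters ] (χ c d u * (X c * Y d + X d * Y c)))
        go : pos u x₀ < pos u y₀ ⊎ pos u y₀ < pos u x₀ → Goal
        go (inj₁ x₀-y₀) = walk u X Y x₀-y₀ Y-x₀ Y-y₀ (λ c l r → typed {u} u≤w c (inj₁ (l , r)))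
        -- The walk now runs from `y₀` to `x₀` with the two types interchanged; this turns `α` into
        -- `β` and back.
        go (inj₂ y₀-x₀) = trans
          (∑-cong (λ c → ∑-cong (λ d → cong (χ c d u *_) (turn (X c) (Y d) (X d) (Y c) (α c d u) (β d c u))) letters) letters)
          (trans (walk u Y X y₀-x₀ X-y₀ X-x₀ (λ c l r → trans (ℕ.+-comm (Y c) (X c)) (typed {u} u≤w c (inj₂ (l , r)))))
            (cong suc (∑-cong (λ c → ∑-cong (λ d → cong (χ c d u *_) (turn₁ (X c) (Y d) (X d) (Y c))) letters) letters)))
          where
          turn : ∀ xc yd xd yc s t → xc * yd * s + xd * yc * t ≡ yc * xd * t + yd * xc * s
          turn = solve 6 (λ xc yd xd yc s t → xc :* yd :* s :+ xd :* yc :* t := yc :* xd :* t :+ yd :* xc :* s) refl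
            where open +-*-Solver
          turn₁ : ∀ xc yd xd yc → yc * xd + yd * xc ≡ xc * yd + xd * yc
          turn₁ = solve 4 (λ xc yd xd yc → yc :* xd :+ yd :* xc := xc :* yd :+ xd :* yc) refl
            where open +-*-Solver

    module _ {N : Word → ℕ} (N-symmetric : ToggleSymmetric N) where
      open ToggleSymmetric N-symmetric

      private
        E : (Word → ℕ) → ℕ
        E f = ∑[ u ∈ words ] (N u * f u)

        t : Letter → Letter → ℕ
        t x y = E (χ y x)

        E-cong : ∀ {f g} → (∀ u → f u ≡ g u) → E f ≡ E g
        E-cong eq = ∑-cong (λ u → cong (N u *_) (eq u)) words

        E-+ : ∀ f g → E (λ u → f u + g u) ≡ E f + E g
        E-+ f g = trans (∑-cong (λ u → ℕ.*-distribˡ-+ (N u) (f u) (g u)) words)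
          (∑-+ (λ u → N u * f u) (λ u → N u * g u) words)

        E-*ˡ : ∀ k f → E (λ u → k * f u) ≡ k * E f
        E-*ˡ k f = trans (∑-cong (λ u → x∙yz≈y∙xz (N u) k (f u)) words) (∑-*ˡ k (λ u → N u * f u) words)

        E-∑ : ∀ (f : Letter → Word → ℕ) → E (λ u → ∑[ a ∈ letters ] f a u) ≡ ∑[ a ∈ letters ] E (f a)
        E-∑ f = trans (∑-cong (λ u → sym (∑-*ˡ (N u) (λ a → f a u) letters)) words)
          (∑-swap (λ u a → N u * f a u) words letters)

        E-∑□ : ∀ (f : Letter → Letter → Word → ℕ) → E (λ u → ∑□ (λ x y → f x y u)) ≡ ∑□ (λ x y → E (f x y))
        E-∑□ f = trans (E-∑ (λ x u → ∑[ y ∈ letters ] (X x * Y y * f x y u)))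
          (∑-cong (λ x → trans (E-∑ (λ y u → X x * Y y * f x y u))
            (∑-cong (λ y → E-*ˡ (X x * Y y) (f x y)) letters)) letters)

        ∑□-+ : ∀ F G → ∑□ (λ x y → F x y + G x y) ≡ ∑□ F + ∑□ G
        ∑□-+ F G = trans
          (∑-cong (λ x → trans (∑-cong (λ y → ℕ.*-distribˡ-+ (X x * Y y) (F x y) (G x y)) letters)
            (∑-+ (λ y → X x * Y y * F x y) (λ y → X x * Y y * G x y) letters)) letters)
          (∑-+ (λ x → ∑[ y ∈ letters ] (X x * Y y * F x y)) (λ x → ∑[ y ∈ letters ] (X x * Y y * G x y)) letters)

        -- `symmetric` moves the first sum to the words with `y` just before `x`, where the two
        -- statistics add up to the constant `k`.
        half : ∀ {x y} → Inverted x y → ∀ {Φ Φ′ : Word → ℕ} {k} → Insensitive x y Φ → (∀ u → Φ u + Φ′ u ≡ k) →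
               E (λ u → χ x y u * Φ u) + E (λ u → χ y x u * Φ′ u) ≡ k * t x y
        half {x} {y} inv {Φ} {Φ′} {k} ins total = begin
          E (λ u → χ x y u * Φ u) + E (λ u → χ y x u * Φ′ u)  ≡⟨ cong (_+ E (λ u → χ y x u * Φ′ u)) (symmetric inv ins) ⟩
          E (λ u → χ y x u * Φ u) + E (λ u → χ y x u * Φ′ u)  ≡⟨ sym (E-+ (λ u → χ y x u * Φ u) (λ u → χ y x u * Φ′ u)) ⟩
          E (λ u → χ y x u * Φ u + χ y x u * Φ′ u)  ≡⟨ E-cong (λ u → trans (sym (ℕ.*-distribˡ-+ (χ y x u) (Φ u) (Φ′ u)))
                                                                    (trans (cong (χ y x u *_) (total u)) (ℕ.*-comm (χ y x u) k))) ⟩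
          E (λ u → k * χ y x u)  ≡⟨ E-*ˡ k (χ y x) ⟩
          k * t x y  ∎
          where open ≡-Reasoning

        weakly-total : ∀ a b u → weakly a b u + weakly b a u ≡ 1 + ⟦ a Fin.≟ b ⟧
        weakly-total a b u with a Fin.≟ b
        ... | yes refl = cong₂ _+_ (⟦⟧-yes (pos u a ℕ.≤? pos u a) ℕ.≤-refl)
          (trans (⟦⟧-yes (pos u a ℕ.≤? pos u a) ℕ.≤-refl) (sym (⟦⟧-yes (yes refl) refl)))
        ... | no a≢b = trans (⟦⟧-exclusive (pos u a ℕ.≤? pos u b) (pos u b ℕ.≤? pos u a) (ℕ.≤-total (pos u a) (pos u b))
          (λ le ge → pos-≢ u a≢b (ℕ.≤-antisym le ge))) (cong suc (sym (⟦⟧-no (no a≢b) a≢b)))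

        self-insensitive : ∀ a {x y} → Insensitive x y (weakly a a)
        self-insensitive a {x} {y} = record
          { resp    = λ {u} {v} → weakly-resp a a {u} {v}
          ; toggled = λ u _ → trans (one (swap x y u)) (sym (one u))
          ; rigid   = λ u v _ _ _ _ → trans (one u) (sym (one v))
          }
          where
          one : ∀ u → weakly a a u ≡ 1
          one u = ⟦⟧-yes (pos u a ℕ.≤? pos u a) ℕ.≤-refl

        column-any : ∀ {x y} → Inverted x y₀ → Inverted x₀ y → Dec (x₀ ≡ x) → Insensitive x y (weakly x₀ x)
        column-any _    _    (yes refl) = self-insensitive x₀
        column-any x-y₀ x₀-y (no x₀≢x)  = column-insensitive x-y₀ x₀-y x₀≢x

        row-any : ∀ {x y} → Inverted x y₀ → Inverted x₀ y → Dec (y₀ ≡ y) → Insensitive x y (weakly y y₀)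
        row-any _    _    (yes refl) = self-insensitive y₀
        row-any x-y₀ x₀-y (no y₀≢y)  = row-insensitive x-y₀ x₀-y y₀≢y

        -- A rook at the box of `x₀` and `y₀` attacks the boxes of its row and column, its own box
        -- being counted twice.
        attack : Letter → Letter → ℕ
        attack x y = ⟦ x₀ Fin.≟ x ⟧ + ⟦ y₀ Fin.≟ y ⟧

        E-αβ : ∀ {x y} → Inverted x y₀ → Inverted x₀ y →
               E (λ u → χ x y u * α x y u + χ y x u * β x y u) ≡ attack x y * t x y + (1 * t x y + 1 * t x y)
        E-αβ {x} {y} x-y₀ x₀-y = begin
          E (λ u → χ x y u * α x y u + χ y x u * β x y u)
            ≡⟨ E-cong (λ u → regroup (χ x y u) (weakly x₀ x u) (weakly y y₀ u) (χ y x u) (weakly y₀ y u) (weakly x x₀ u)) ⟩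
          E (λ u → (χ x y u * weakly x₀ x u + χ y x u * weakly x x₀ u) + (χ x y u * weakly y y₀ u + χ y x u * weakly y₀ y u))
            ≡⟨ E-+ (λ u → χ x y u * weakly x₀ x u + χ y x u * weakly x x₀ u) (λ u → χ x y u * weakly y y₀ u + χ y x u * weakly y₀ y u) ⟩
          E (λ u → χ x y u * weakly x₀ x u + χ y x u * weakly x x₀ u) + E (λ u → χ x y u * weakly y y₀ u + χ y x u * weakly y₀ y u)
            ≡⟨ cong₂ _+_
                 (trans (E-+ (λ u → χ x y u * weakly x₀ x u) (λ u → χ y x u * weakly x x₀ u))
                   (half inv (column-any x-y₀ x₀-y (x₀ Fin.≟ x)) (weakly-total x₀ x)))
                 (trans (E-+ (λ u → χ x y u * weakly y y₀ u) (λ u → χ y x u * weakly y₀ y u))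
                   (half inv (row-any x-y₀ x₀-y (y₀ Fin.≟ y)) (λ u → trans (ℕ.+-comm (weakly y y₀ u) (weakly y₀ y u)) (weakly-total y₀ y u)))) ⟩
          (1 + ⟦ x₀ Fin.≟ x ⟧) * t x y + (1 + ⟦ y₀ Fin.≟ y ⟧) * t x y
            ≡⟨ collect ⟦ x₀ Fin.≟ x ⟧ ⟦ y₀ Fin.≟ y ⟧ (t x y) ⟩
          attack x y * t x y + (1 * t x y + 1 * t x y) ∎
          where
          open ≡-Reasoning
          inv = rectangle x-y₀ x₀-y
          regroup : ∀ p a b q c d → p * (a + b) + q * (c + d) ≡ (p * a + q * d) + (p * b + q * c)
          regroup = solve 6 (λ p a b q c d → p :* (a :+ b) :+ q :* (c :+ d) := (p :* a :+ q :* d) :+ (p :* b :+ q :* c)) refl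
            where open +-*-Solver
          collect : ∀ c d k → (1 + c) * k + (1 + d) * k ≡ (c + d) * k + (1 * k + 1 * k)
          collect = solve 3 (λ c d k → (con 1 :+ c) :* k :+ (con 1 :+ d) :* k := (c :+ d) :* k :+ (con 1 :* k :+ con 1 :* k)) refl
            where open +-*-Solver

        E-1 : ∀ {x y} → Inverted x y₀ → Inverted x₀ y → E (λ u → χ x y u * 1 + χ y x u * 1) ≡ 1 * t x y + 1 * t x y
        E-1 {x} {y} x-y₀ x₀-y = trans (E-+ (λ u → χ x y u * 1) (λ u → χ y x u * 1))
          (trans (cong (_+ E (λ u → χ y x u * 1)) (symmetric (rectangle x-y₀ x₀-y) (const-insensitive x y)))
            (cong₂ _+_ one one))
          where
          one : E (λ u → χ y x u * 1) ≡ 1 * t x y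
          one = trans (E-cong (λ u → ℕ.*-comm (χ y x u) 1)) (E-*ˡ 1 (χ y x))

        ∑□-cong : ∀ {F G : Letter → Letter → ℕ} → (∀ {x y} → Inverted x y₀ → Inverted x₀ y → F x y ≡ G x y) → ∑□ F ≡ ∑□ G
        ∑□-cong {F} {G} eq = ∑-cong (λ x → ∑-cong (λ y → begin
          X x * Y y * F x y  ≡⟨ ℕ.*-assoc (X x) (Y y) (F x y) ⟩
          X x * (Y y * F x y)  ≡⟨ ⟦⟧-*-cong (inverted? x y₀) (λ x-y₀ → ⟦⟧-*-cong (inverted? x₀ y) (λ x₀-y → eq x-y₀ x₀-y)) ⟩
          X x * (Y y * G x y)  ≡⟨ sym (ℕ.*-assoc (X x) (Y y) (G x y)) ⟩
          X x * Y y * G x y  ∎) letters) letters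
          where open ≡-Reasoning

        ∑-attack : ∑□ (λ x y → attack x y * t x y) ≡
                   (∑[ y ∈ letters ] (⟦ inverted? x₀ y ⟧ * t x₀ y)) + (∑[ x ∈ letters ] (⟦ inverted? x y₀ ⟧ * t x y₀))
        ∑-attack = trans (∑□-cong (λ {x} {y} _ _ → ℕ.*-distribʳ-+ (t x y) ⟦ x₀ Fin.≟ x ⟧ ⟦ y₀ Fin.≟ y ⟧))
          (trans (∑□-+ (λ x y → ⟦ x₀ Fin.≟ x ⟧ * t x y) (λ x y → ⟦ y₀ Fin.≟ y ⟧ * t x y)) (cong₂ _+_
            (trans (∑-cong (λ x → trans
                     (∑-cong (λ y → pull (X x) (Y y) ⟦ x₀ Fin.≟ x ⟧ (t x y)) letters)
                     (∑-*ˡ ⟦ x₀ Fin.≟ x ⟧ (λ y → X x * (Y y * t x y)) letters)) letters)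
              (trans (L.∑-δ x₀ {λ x → ∑[ y ∈ letters ] (X x * (Y y * t x y))} (λ { refl → refl }))
                (∑-cong (λ y → trans (cong (_* (Y y * t x₀ y)) X-x₀) (ℕ.*-identityˡ _)) letters)))
            (trans (∑-swap (λ x y → X x * Y y * (⟦ y₀ Fin.≟ y ⟧ * t x y)) letters letters)
              (trans (∑-cong (λ y → trans
                     (∑-cong (λ x → pull′ (X x) (Y y) ⟦ y₀ Fin.≟ y ⟧ (t x y)) letters)
                     (∑-*ˡ ⟦ y₀ Fin.≟ y ⟧ (λ x → Y y * (X x * t x y)) letters)) letters)
              (trans (L.∑-δ y₀ {λ y → ∑[ x ∈ letters ] (Y y * (X x * t x y))} (λ { refl → refl }))
                (∑-cong (λ x → trans (cong (_* (X x * t x y₀)) Y-y₀) (ℕ.*-identityˡ _)) letters))))))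
          where
          pull : ∀ p q d k → p * q * (d * k) ≡ d * (p * (q * k))
          pull = solve 4 (λ p q d k → p :* q :* (d :* k) := d :* (p :* (q :* k))) refl
            where open +-*-Solver
          pull′ : ∀ p q d k → p * q * (d * k) ≡ d * (q * (p * k))
          pull′ = solve 4 (λ p q d k → p :* q :* (d :* k) := d :* (q :* (p :* k))) refl
            where open +-*-Solver

      -- Weight `rook-at` by `N` and sum. By toggle symmetry every box of the rectangle contributes
      -- twice its descent weight on both sides; what remains is the attacked boxes on the left and
      -- the total weight on the right.
      rook-sum : (∑[ y ∈ letters ] (⟦ inverted? x₀ y ⟧ * (∑[ u ∈ words ] (N u * χ y x₀ u)))) +
                 (∑[ x ∈ letters ] (⟦ inverted? x y₀ ⟧ * (∑[ u ∈ words ] (N u * χ y₀ x u)))) ≡ ∑ words N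
      rook-sum = trans (sym ∑-attack) (ℕ.+-cancelʳ-≡ doubled (∑□ (λ x y → attack x y * t x y)) (∑ words N) (begin
        ∑□ (λ x y → attack x y * t x y) + doubled
          ≡⟨ sym (∑□-+ (λ x y → attack x y * t x y) (λ x y → 1 * t x y + 1 * t x y)) ⟩
        ∑□ (λ x y → attack x y * t x y + (1 * t x y + 1 * t x y))
          ≡⟨ sym (∑□-cong E-αβ) ⟩
        ∑□ (λ x y → E (λ u → χ x y u * α x y u + χ y x u * β x y u))
          ≡⟨ sym (E-∑□ (λ x y u → χ x y u * α x y u + χ y x u * β x y u)) ⟩
        E (λ u → ∑□ (λ x y → χ x y u * α x y u + χ y x u * β x y u))
          ≡⟨ ∑-cong (λ u → at u (≤w? u)) words ⟩
        E (λ u → 1 + ∑□ (λ x y → χ x y u * 1 + χ y x u * 1))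
          ≡⟨ E-+ (λ _ → 1) (λ u → ∑□ (λ x y → χ x y u * 1 + χ y x u * 1)) ⟩
        E (λ _ → 1) + E (λ u → ∑□ (λ x y → χ x y u * 1 + χ y x u * 1))
          ≡⟨ cong₂ _+_ (∑-cong (λ u → ℕ.*-identityʳ (N u)) words)
               (trans (E-∑□ (λ x y u → χ x y u * 1 + χ y x u * 1)) (∑□-cong E-1)) ⟩
        ∑ words N + doubled ∎))
        where
        open ≡-Reasoning
        doubled : ℕ
        doubled = ∑□ (λ x y → 1 * t x y + 1 * t x y)
        at : ∀ u → Dec (u ≤ʷ w) → N u * ∑□ (λ x y → χ x y u * α x y u + χ y x u * β x y u) ≡
             N u * (1 + ∑□ (λ x y → χ x y u * 1 + χ y x u * 1))
        at u (yes u≤w) = cong (N u *_) (rook-at u u≤w)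
        at u (no u≰w)  = trans (cong (_* ∑□ (λ x y → χ x y u * α x y u + χ y x u * β x y u)) (supported u u≰w))
                               (sym (cong (_* (1 + ∑□ (λ x y → χ x y u * 1 + χ y x u * 1))) (supported u u≰w)))

-- The interval below w

module Descents (n : ℕ) where
  open Toggle n
  open Rook n
  private module L = FinSum n

  descentSum : Word → ℕ
  descentSum v = ∑[ a ∈ letters ] ∑[ b ∈ letters ] (⟦ a Fin.<? b ⟧ * χ b a v)

  module _ (v : Word) where

    Lowers : Letter → Letter → Word → Set
    Lowers a b u = (a Fin.< b × b then a in-word v) × swap a b v ≈ u

    lowers? : ∀ a b u → Dec (Lowers a b u)
    lowers? a b u = ((a Fin.<? b) ×-dec then? b a v) ×-dec (swap a b v ≈? u)

    lowers⇒order : ∀ {a b u} → Lowers a b u → pos u a < pos u b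
    lowers⇒order {a} {b} {u} ((_ , next) , eq) =
      subst₂ _<_ (pos-≈⁻ {swap a b v} {u} eq a) (pos-≈⁻ {swap a b v} {u} eq b)
        (then⇒< (swap a b v) (swapped-then (swap-swapped a b v) next))

    lowers-unique : ∀ {a b c d u} → Lowers a b u → Swapped c d v u → d then c in-word v → c ≡ a × d ≡ b
    lowers-unique {a} {b} {c} {d} {u} l@((_ , next) , _) s next′ with c Fin.≟ a | d Fin.≟ b
    ... | yes c≡a | yes d≡b = c≡a , d≡b
    ... | no c≢a  | _       =
      contradiction (swapped-order s next′ (c≢a ∘ sym ∘ proj₂) (then⇒< v next)) (ℕ.<-asym (lowers⇒order {u = u} l))
    ... | yes _   | no d≢b  =
      contradiction (swapped-order s next′ (d≢b ∘ sym ∘ proj₁) (then⇒< v next)) (ℕ.<-asym (lowers⇒order {u = u} l))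

    ∑-lowers : ∀ u → Dec (u ⋖ v) → (∑[ a ∈ letters ] ∑[ b ∈ letters ] ⟦ lowers? a b u ⟧) ≡ ⟦ u ⋖? v ⟧
    ∑-lowers u (no ¬u⋖v) = trans
      (∑-vanish (λ a → ∑-vanish (λ b → ⟦⟧-no (lowers? a b u) (λ ((a<b , next) , eq) → ¬u⋖v (cover⇒⋖ {u} {v}
        (cover a<b next (Swapped-resp {u = v} {v} {swap a b v} {u} (≤ʷ.Eq.refl {v}) eq (swap-swapped a b v)))))) letters) letters)
      (sym (⟦⟧-no (u ⋖? v) ¬u⋖v))
    ∑-lowers u (yes u⋖v) with ⋖⇒cover {u} {v} u⋖v
    ... | cover {c} {d} c<d next s = begin
      (∑[ a ∈ letters ] ∑[ b ∈ letters ] ⟦ lowers? a b u ⟧)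
        ≡⟨ ∑-cong (λ a → ∑-cong (λ b → trans
             (⟦⟧-⇔ (lowers? a b u) ((c Fin.≟ a) ×-dec (d Fin.≟ b)) (λ l → lowers-unique l s next)
               (λ { (refl , refl) → (c<d , next) , Swapped-unique {v = swap c d v} {u} (swap-swapped c d v) s }))
             (⟦⟧-× (c Fin.≟ a) (d Fin.≟ b))) letters) letters ⟩
      (∑[ a ∈ letters ] ∑[ b ∈ letters ] (⟦ c Fin.≟ a ⟧ * ⟦ d Fin.≟ b ⟧))
        ≡⟨ ∑-cong (λ a → trans (∑-*ˡ ⟦ c Fin.≟ a ⟧ (λ b → ⟦ d Fin.≟ b ⟧) letters)
             (trans (cong (⟦ c Fin.≟ a ⟧ *_) (L.∑-δ1 d)) (ℕ.*-identityʳ _))) letters ⟩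
      (∑[ a ∈ letters ] ⟦ c Fin.≟ a ⟧)  ≡⟨ L.∑-δ1 c ⟩
      1  ≡⟨ sym (⟦⟧-yes (u ⋖? v) u⋖v) ⟩
      ⟦ u ⋖? v ⟧  ∎
      where open ≡-Reasoning

    -- Double counting of `Lowers`: each element covered by `v` comes from one pair of letters, and
    -- each descent of `v` produces one element.
    ∑-⋖ : (∑[ u ∈ words ] ⟦ u ⋖? v ⟧) ≡ descentSum v
    ∑-⋖ = begin
      (∑[ u ∈ words ] ⟦ u ⋖? v ⟧)  ≡⟨ ∑-cong (λ u → sym (∑-lowers u (u ⋖? v))) words ⟩
      (∑[ u ∈ words ] ∑[ a ∈ letters ] ∑[ b ∈ letters ] ⟦ lowers? a b u ⟧)  ≡⟨ ∑-swap (λ u a → ∑[ b ∈ letters ] ⟦ lowers? a b u ⟧) words letters ⟩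
      (∑[ a ∈ letters ] ∑[ u ∈ words ] ∑[ b ∈ letters ] ⟦ lowers? a b u ⟧)  ≡⟨ ∑-cong (λ a → ∑-swap (λ u b → ⟦ lowers? a b u ⟧) words letters) letters ⟩
      (∑[ a ∈ letters ] ∑[ b ∈ letters ] ∑[ u ∈ words ] ⟦ lowers? a b u ⟧)  ≡⟨ ∑-cong (λ a → ∑-cong (λ b → single a b) letters) letters ⟩
      descentSum v  ∎
      where
      open ≡-Reasoning
      single : ∀ a b → (∑[ u ∈ words ] ⟦ lowers? a b u ⟧) ≡ ⟦ a Fin.<? b ⟧ * χ b a v
      single a b = trans (∑-cong (λ u → ⟦⟧-× ((a Fin.<? b) ×-dec then? b a v) (swap a b v ≈? u)) words)
        (trans (∑-*ˡ ⟦ (a Fin.<? b) ×-dec then? b a v ⟧ (λ u → ⟦ swap a b v ≈? u ⟧) words)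
          (trans (cong (⟦ (a Fin.<? b) ×-dec then? b a v ⟧ *_) (∑-δ1 (swap a b v)))
            (trans (ℕ.*-identityʳ _) (⟦⟧-× (a Fin.<? b) (then? b a v)))))

module _ (P : FinitePoset) {Q : Pred (FinitePoset.Carrier P) 0ℓ} (Q? : Decidable Q)
         (resp : ∀ {x y} → FinitePoset._≈_ P x y → Q x → Q y) where

  open Restriction P {Q} Q? resp

  opaque
    unfolding ⟦_⟧

    ∑-sift : ∀ (f : FinitePoset.Carrier P → ℕ) xs → (∑[ p ∈ sift xs ] f (proj₁ p)) ≡ ∑[ x ∈ xs ] (⟦ Q? x ⟧ * f x)
    ∑-sift f []       = refl
    ∑-sift f (x ∷ xs) with Q? x
    ... | yes _ = cong₂ _+_ (sym (ℕ.+-identityʳ (f x))) (∑-sift f xs)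
    ... | no _  = ∑-sift f xs

module Interval (n : ℕ) (w : Weak.Word n) where
  open Toggle n
  open Rook n
  open Symmetry w
  open Descents n

  module I = FinitePoset [e, w ]
  private
    module P = Paths [e, w ]
    module C = CDE [e, w ]

  ∑-interval : ∀ (f : Word → ℕ) → (∑[ p ∈ I.elements ] f (proj₁ p)) ≡ ∑[ u ∈ words ] (⟦ ≤w? u ⟧ * f u)
  ∑-interval f = trans (∑-sift (weakOrder n) {λ z → Perm.id ≤ʷ z × z ≤ʷ w} (λ z → (Perm.id ≤ʷ? z) ×-dec (z ≤ʷ? w)) _ f words)
    (∑-cong (λ u → cong (_* f u) (⟦⟧-⇔ ((Perm.id ≤ʷ? u) ×-dec (u ≤ʷ? w)) (≤w? u) proj₂ (λ u≤w → id≤ u , u≤w))) words)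

  -- Intervals are convex, so an element between two members would itself be a member.
  ⋖-interval⁻ : ∀ p q → p I.⋖ q → proj₁ p ⋖ proj₁ q
  ⋖-interval⁻ (u , _) (v , _ , v≤w) (u≺v , none) = u≺v ,
    λ z (u≺z , z≺v) → none (z , id≤ z , ≤ʷ-trans {z} {v} {w} (proj₁ z≺v) v≤w) (u≺z , z≺v)

  ⋖-interval⁺ : ∀ p q → proj₁ p ⋖ proj₁ q → p I.⋖ q
  ⋖-interval⁺ p q (u≺v , none) = u≺v , λ z → none (proj₁ z)

  ⋖?-interval : ∀ p q → ⟦ p C.⋖? q ⟧ ≡ ⟦ proj₁ p ⋖? proj₁ q ⟧
  ⋖?-interval p q = ⟦⟧-⇔ (p C.⋖? q) (proj₁ p ⋖? proj₁ q) (⋖-interval⁻ p q) (⋖-interval⁺ p q)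

  ∑-below : ∀ q (f : Word → ℕ) →
            (∑[ p ∈ I.elements ] (⟦ p C.⋖? q ⟧ * f (proj₁ p))) ≡ ∑[ u ∈ words ] (⟦ u ⋖? proj₁ q ⟧ * f u)
  ∑-below q f = trans (∑-cong (λ p → cong (_* f (proj₁ p)) (⋖?-interval p q)) I.elements)
    (trans (∑-interval (λ u → ⟦ u ⋖? proj₁ q ⟧ * f u))
      (∑-cong (λ u → trans (x∙yz≈y∙xz ⟦ ≤w? u ⟧ ⟦ u ⋖? proj₁ q ⟧ (f u))
        (⟦⟧-*-cong (u ⋖? proj₁ q) λ ((u≤v , _) , _) → trans
          (cong (_* f u) (⟦⟧-yes (≤w? u) (≤ʷ-trans {u} {proj₁ q} {w} u≤v (proj₂ (proj₂ q)))))
          (ℕ.*-identityˡ (f u)))) words))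

  ddeg-interval : ∀ q → C.ddeg q ≡ descentSum (proj₁ q)
  ddeg-interval q = begin
    C.ddeg q  ≡⟨ length-filter (C._⋖? q) I.elements ⟩
    (∑[ p ∈ I.elements ] ⟦ p C.⋖? q ⟧)  ≡⟨ ∑-cong (λ p → sym (ℕ.*-identityʳ ⟦ p C.⋖? q ⟧)) I.elements ⟩
    (∑[ p ∈ I.elements ] (⟦ p C.⋖? q ⟧ * 1))  ≡⟨ ∑-below q (λ _ → 1) ⟩
    (∑[ u ∈ words ] (⟦ u ⋖? proj₁ q ⟧ * 1))  ≡⟨ ∑-cong (λ u → ℕ.*-identityʳ ⟦ u ⋖? proj₁ q ⟧) words ⟩
    (∑[ u ∈ words ] ⟦ u ⋖? proj₁ q ⟧)  ≡⟨ ∑-⋖ (proj₁ q) ⟩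
    descentSum (proj₁ q)  ∎
    where open ≡-Reasoning

  paths-interval : ∀ p q → P.paths p q ≡ paths (proj₁ p) (proj₁ q)
  paths-interval p = P.≺-rec (λ q → P.paths p q ≡ paths (proj₁ p) (proj₁ q)) λ q ih → begin
    P.paths p q
      ≡⟨ P.paths-rec p q ⟩
    ⟦ p I.≟ q ⟧ + (∑[ m ∈ I.elements ] (⟦ m C.⋖? q ⟧ * P.paths p m))
      ≡⟨ cong (⟦ p I.≟ q ⟧ +_) (∑-cong (λ m → ⟦⟧-*-cong (m C.⋖? q) λ (m≺q , _) → ih m m≺q) I.elements) ⟩
    ⟦ proj₁ p ≈? proj₁ q ⟧ + (∑[ m ∈ I.elements ] (⟦ m C.⋖? q ⟧ * paths (proj₁ p) (proj₁ m)))
      ≡⟨ cong (⟦ proj₁ p ≈? proj₁ q ⟧ +_) (∑-below q (paths (proj₁ p))) ⟩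
    ⟦ proj₁ p ≈? proj₁ q ⟧ + (∑[ u ∈ words ] (⟦ u ⋖? proj₁ q ⟧ * paths (proj₁ p) u))
      ≡⟨ sym (paths-rec (proj₁ p) (proj₁ q)) ⟩
    paths (proj₁ p) (proj₁ q) ∎
    where open ≡-Reasoning

  least greatest : I.Carrier
  least    = Perm.id , (λ x → x) , id≤ w
  greatest = w , id≤ w , (λ x → x)

  through-interval : ∀ p → C.#maximalChainsThrough p ≡ chains (proj₁ p)
  through-interval p = trans
    (MaximalChains.#maximalChainsThrough-paths [e, w ] least greatest (λ q → id≤ (proj₁ q)) (λ q → proj₂ (proj₂ q)) p)
    (cong₂ _*_ (paths-interval least p) (paths-interval p greatest))

  module _ {N : Word → ℕ} (N-symmetric : ToggleSymmetric N) where
    open ToggleSymmetric N-symmetric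

    ∑-interval-N : ∀ (f : Word → ℕ) → (∑[ p ∈ I.elements ] (N (proj₁ p) * f (proj₁ p))) ≡ ∑[ u ∈ words ] (N u * f u)
    ∑-interval-N f = trans (∑-interval (λ u → N u * f u)) (∑-cong (λ u → keep u (≤w? u)) words)
      where
      keep : ∀ u → Dec (u ≤ʷ w) → ⟦ ≤w? u ⟧ * (N u * f u) ≡ N u * f u
      keep u (yes u≤w) = trans (cong (_* (N u * f u)) (⟦⟧-yes (≤w? u) u≤w)) (ℕ.*-identityˡ _)
      keep u (no u≰w)  = trans (cong (_* (N u * f u)) (⟦⟧-no (≤w? u) u≰w)) (sym (cong (_* f u) (supported u u≰w)))

    -- Only descents whose letters are inverted in w occur in words below w.
    ∑-descents : (∑[ u ∈ words ] (N u * descentSum u)) ≡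
                 ∑[ a ∈ letters ] ∑[ b ∈ letters ] (⟦ inverted? a b ⟧ * (∑[ u ∈ words ] (N u * χ b a u)))
    ∑-descents = begin
      (∑[ u ∈ words ] (N u * descentSum u))
        ≡⟨ ∑-cong (λ u → trans (sym (∑-*ˡ (N u) (λ a → ∑[ b ∈ letters ] (⟦ a Fin.<? b ⟧ * χ b a u)) letters))
             (∑-cong (λ a → trans (sym (∑-*ˡ (N u) (λ b → ⟦ a Fin.<? b ⟧ * χ b a u) letters))
               (∑-cong (λ b → inverting u a b (≤w? u)) letters)) letters)) words ⟩
      (∑[ u ∈ words ] ∑[ a ∈ letters ] ∑[ b ∈ letters ] (⟦ inverted? a b ⟧ * (N u * χ b a u)))
        ≡⟨ ∑-swap (λ u a → ∑[ b ∈ letters ] (⟦ inverted? a b ⟧ * (N u * χ b a u))) words letters ⟩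
      (∑[ a ∈ letters ] ∑[ u ∈ words ] ∑[ b ∈ letters ] (⟦ inverted? a b ⟧ * (N u * χ b a u)))
        ≡⟨ ∑-cong (λ a → trans (∑-swap (λ u b → ⟦ inverted? a b ⟧ * (N u * χ b a u)) words letters)
             (∑-cong (λ b → ∑-*ˡ ⟦ inverted? a b ⟧ (λ u → N u * χ b a u) words) letters)) letters ⟩
      (∑[ a ∈ letters ] ∑[ b ∈ letters ] (⟦ inverted? a b ⟧ * (∑[ u ∈ words ] (N u * χ b a u)))) ∎
      where
      open ≡-Reasoning
      inverting : ∀ u a b → Dec (u ≤ʷ w) → N u * (⟦ a Fin.<? b ⟧ * χ b a u) ≡ ⟦ inverted? a b ⟧ * (N u * χ b a u)
      inverting u a b (no u≰w) = trans (cong (_* (⟦ a Fin.<? b ⟧ * χ b a u)) (supported u u≰w))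
        (sym (trans (cong (λ z → ⟦ inverted? a b ⟧ * (z * χ b a u)) (supported u u≰w)) (ℕ.*-zeroʳ ⟦ inverted? a b ⟧)))
      inverting u a b (yes u≤w) = begin
        N u * (⟦ a Fin.<? b ⟧ * χ b a u)  ≡⟨ cong (N u *_) (ℕ.*-comm ⟦ a Fin.<? b ⟧ (χ b a u)) ⟩
        N u * (χ b a u * ⟦ a Fin.<? b ⟧)  ≡⟨ cong (N u *_) (⟦⟧-*-cong (then? b a u) λ next →
                                                  ⟦⟧-⇔ (a Fin.<? b) (inverted? a b) (λ a<b → a<b , ≤-inversion {u} {w} u≤w a<b (then⇒< u next)) proj₁) ⟩
        N u * (χ b a u * ⟦ inverted? a b ⟧)  ≡⟨ sym (ℕ.*-assoc (N u) (χ b a u) ⟦ inverted? a b ⟧) ⟩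
        N u * χ b a u * ⟦ inverted? a b ⟧  ≡⟨ ℕ.*-comm (N u * χ b a u) ⟦ inverted? a b ⟧ ⟩
        ⟦ inverted? a b ⟧ * (N u * χ b a u)  ∎

  -- One computation for both distributions, which have the form `k p ÷ D` with `D` the total
  -- weight. Positivity of the weight excludes the default value of `_÷_` at zero.
  expectation : ∀ {N} → ToggleSymmetric N → ∀ {k : I.Carrier → ℕ} {D} → (∀ p → k p ≡ N (proj₁ p)) → D ≡ ∑ words N →
                0 < ∑ words N → ∀ x y → (∑[ u ∈ words ] (N u * descentSum u)) * y ≡ x * ∑ words N → 0 < y →
                C.𝔼 (λ p → k p ÷ D) C.ddegℚ ≡ x ÷ y
  expectation {N} N-sym {k} {D} k≡N D≡ positive x (suc y) eq _ = go D D≡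
    where
    total : (∑[ p ∈ I.elements ] (k p * C.ddeg p)) ≡ ∑[ u ∈ words ] (N u * descentSum u)
    total = trans (∑-cong (λ p → cong₂ _*_ (k≡N p) (ddeg-interval p)) I.elements) (∑-interval-N N-sym descentSum)
    go : ∀ D → D ≡ ∑ words N → C.𝔼 (λ p → k p ÷ D) C.ddegℚ ≡ x ÷ suc y
    go zero    D≡ = contradiction (sym D≡) (ℕ.>⇒≢ positive)
    go (suc d) D≡ = trans (sumℚ-÷ k C.ddeg d I.elements)
      (÷-cong {∑[ p ∈ I.elements ] (k p * C.ddeg p)} {x} d y (trans (cong (_* suc y) total) (trans eq (cong (x *_) (sym D≡)))))

  size-interval : C.size ≡ ∑[ u ∈ words ] ⟦ ≤w? u ⟧
  size-interval = begin
    C.size  ≡⟨ sym (ℕ.*-identityʳ C.size) ⟩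
    C.size * 1  ≡⟨ sym (∑-const 1 I.elements) ⟩
    (∑[ p ∈ I.elements ] 1)  ≡⟨ ∑-interval (λ _ → 1) ⟩
    (∑[ u ∈ words ] (⟦ ≤w? u ⟧ * 1))  ≡⟨ ∑-cong (λ u → ℕ.*-identityʳ ⟦ ≤w? u ⟧) words ⟩
    (∑[ u ∈ words ] ⟦ ≤w? u ⟧)  ∎
    where open ≡-Reasoning

  through-total : ∑ I.elements C.#maximalChainsThrough ≡ ∑ words chains
  through-total = begin
    ∑ I.elements C.#maximalChainsThrough  ≡⟨ ∑-cong (λ p → trans (through-interval p) (sym (ℕ.*-identityʳ _))) I.elements ⟩
    (∑[ p ∈ I.elements ] (chains (proj₁ p) * 1))  ≡⟨ ∑-interval-N chains-symmetric (λ _ → 1) ⟩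
    (∑[ u ∈ words ] (chains u * 1))  ≡⟨ ∑-cong (λ u → ℕ.*-identityʳ (chains u)) words ⟩
    ∑ words chains  ∎
    where open ≡-Reasoning

  uniform-positive : 0 < (∑[ u ∈ words ] ⟦ ≤w? u ⟧)
  uniform-positive = ℕ.≤-trans (ℕ.≤-reflexive (sym (⟦⟧-yes (≤w? w) (λ x → x)))) (∑-≥ w (λ {u} {v} → ≤w-resp {u} {v}))

  chains-positive : 0 < ∑ words chains
  chains-positive = ℕ.≤-trans
    (ℕ.≤-trans (paths-positive Perm.id w (id≤ w))
      (ℕ.≤-reflexive (sym (trans (cong (paths Perm.id w *_) (paths-≈ {w} {w} (λ _ → refl))) (ℕ.*-identityʳ _)))))
    (∑-≥ w (λ {u} {v} → chains-resp {u} {v}))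

  cde-from-expectations : ∀ x y → 0 < y →
    (∀ {N} → ToggleSymmetric N → (∑[ u ∈ words ] (N u * descentSum u)) * y ≡ x * ∑ words N) →
    C.IsCDE × C.edgeDensity ≡ x ÷ y
  cde-from-expectations x y 0<y constant = trans uniform (sym chain) , uniform
    where
    uniform : C.edgeDensity ≡ x ÷ y
    uniform = expectation uniform-symmetric (λ (u , _ , u≤w) → sym (⟦⟧-yes (≤w? u) u≤w)) size-interval
      uniform-positive x y (constant uniform-symmetric) 0<y
    chain : C.𝔼 C.maxchain C.ddegℚ ≡ x ÷ y
    chain = expectation chains-symmetric through-interval through-total
      chains-positive x y (constant chains-symmetric) 0<y

-- Sums over initial segments of the natural numbers

∑-applyUpTo : ∀ (f : ℕ → ℕ) g n → ∑ (applyUpTo g n) f ≡ ∑[ i ∈ upTo n ] f (g i)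
∑-applyUpTo f g n = cong sum (trans (map-applyUpTo g f n) (sym (map-applyUpTo id (f ∘ g) n)))

∑-upTo-suc : ∀ f n → ∑ (upTo (suc n)) f ≡ f 0 + (∑[ i ∈ upTo n ] f (suc i))
∑-upTo-suc f n = cong (f 0 +_) (∑-applyUpTo f suc n)

∑-upTo-+ : ∀ m n f → ∑ (upTo (m + n)) f ≡ ∑ (upTo m) f + (∑[ i ∈ upTo n ] f (m + i))
∑-upTo-+ zero    n f = refl
∑-upTo-+ (suc m) n f = begin
  ∑ (upTo (suc m + n)) f  ≡⟨ ∑-upTo-suc f (m + n) ⟩
  f 0 + (∑[ i ∈ upTo (m + n) ] f (suc i))  ≡⟨ cong (f 0 +_) (∑-upTo-+ m n (f ∘ suc)) ⟩
  f 0 + ((∑[ i ∈ upTo m ] f (suc i)) + (∑[ i ∈ upTo n ] f (suc (m + i))))  ≡⟨ sym (ℕ.+-assoc (f 0) _ _) ⟩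
  f 0 + (∑[ i ∈ upTo m ] f (suc i)) + (∑[ i ∈ upTo n ] f (suc m + i))  ≡⟨ cong (_+ (∑[ i ∈ upTo n ] f (suc m + i))) (sym (∑-upTo-suc f m)) ⟩
  ∑ (upTo (suc m)) f + (∑[ i ∈ upTo n ] f (suc m + i))  ∎
  where open ≡-Reasoning

∑-upTo-cong : ∀ {f g : ℕ → ℕ} n → (∀ {i} → i < n → f i ≡ g i) → ∑ (upTo n) f ≡ ∑ (upTo n) g
∑-upTo-cong         zero    eq = refl
∑-upTo-cong {f} {g} (suc n) eq = trans (∑-upTo-suc f n)
  (trans (cong₂ _+_ (eq z<s) (∑-upTo-cong n (λ i<n → eq (s≤s i<n)))) (sym (∑-upTo-suc g n)))

∑-upTo-const : ∀ c n → (∑[ i ∈ upTo n ] c) ≡ n * c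
∑-upTo-const c zero    = refl
∑-upTo-const c (suc n) = trans (∑-upTo-suc (λ _ → c) n) (cong (c +_) (∑-upTo-const c n))

-- Each quotient below `k` is taken by exactly `d` of the summation indices.
∑-upTo-/ : ∀ k d .{{_ : NonZero d}} (f : ℕ → ℕ) → (∑[ t ∈ upTo (k * d) ] f (t / d)) ≡ d * ∑ (upTo k) f
∑-upTo-/ zero    d f = sym (ℕ.*-zeroʳ d)
∑-upTo-/ (suc k) d f = begin
  (∑[ t ∈ upTo (d + k * d) ] f (t / d))
    ≡⟨ ∑-upTo-+ d (k * d) (λ t → f (t / d)) ⟩
  (∑[ t ∈ upTo d ] f (t / d)) + (∑[ t ∈ upTo (k * d) ] f ((d + t) / d))
    ≡⟨ cong₂ _+_ (trans (∑-upTo-cong d (λ t<d → cong f (m<n⇒m/n≡0 t<d))) (∑-upTo-const (f 0) d))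
         (∑-cong (λ t → cong f (trans (+-distrib-/-∣ˡ t ∣-refl) (cong (_+ t / d) (n/n≡1 d)))) (upTo (k * d))) ⟩
  d * f 0 + (∑[ t ∈ upTo (k * d) ] f (suc (t / d)))
    ≡⟨ cong (d * f 0 +_) (∑-upTo-/ k d (f ∘ suc)) ⟩
  d * f 0 + d * (∑[ i ∈ upTo k ] f (suc i))
    ≡⟨ sym (ℕ.*-distribˡ-+ d (f 0) _) ⟩
  d * (f 0 + (∑[ i ∈ upTo k ] f (suc i)))
    ≡⟨ cong (d *_) (sym (∑-upTo-suc f k)) ⟩
  d * ∑ (upTo (suc k)) f ∎
  where open ≡-Reasoning

∑-upTo-δ : ∀ {P : ℕ → Set} (P? : ∀ i → Dec (P i)) {i₀} n → i₀ < n → P i₀ → (∀ {i} → P i → i ≡ i₀) →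
           (∑[ i ∈ upTo n ] ⟦ P? i ⟧) ≡ 1
∑-upTo-δ P? {zero}   (suc n) _    p uniq = trans (∑-upTo-suc (λ i → ⟦ P? i ⟧) n)
  (cong₂ _+_ (⟦⟧-yes (P? 0) p) (∑-vanish (λ i → ⟦⟧-no (P? (suc i)) (λ q → ℕ.1+n≢0 (uniq q))) (upTo n)))
∑-upTo-δ P? {suc i₀} (suc n) i₀<n p uniq = trans (∑-upTo-suc (λ i → ⟦ P? i ⟧) n)
  (cong₂ _+_ (⟦⟧-no (P? 0) (λ q → ℕ.1+n≢0 (sym (uniq q))))
    (∑-upTo-δ (P? ∘ suc) n (s<s⁻¹ i₀<n) p (λ q → ℕ.suc-injective (uniq q))))

-- Summing the rook identity along the antidiagonal

module Antidiagonal (n : ℕ) (w : Weak.Word n) where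
  open Toggle n
  open Rook n
  open Symmetry w
  open Descents n
  open Interval n w
  open Expectation n w
  private module L = FinSum n

  module _ (a b top left : ℕ) .{{_ : NonZero a}} .{{_ : NonZero b}} (row column : Letter → ℕ)
           (row-injective : ∀ {x y} → row x ≡ row y → x ≡ y) (column-injective : ∀ {x y} → column x ≡ column y → x ≡ y)
           (in-rows : ∀ {x y} → Inverted x y → top ≤ row y × row y < top + a)
           (in-columns : ∀ {x y} → Inverted x y → left ≤ column x × column x < left + b)
           -- From the northeast corner the antidiagonal enters a new row every `b` pieces and a new
           -- column every `a` pieces. Piece `t` thus lies in row `t / b` from the top and column
           -- `t / a` from the right.
           (crossed : ∀ {t} → t < a * b → ∃₂ λ x y → row y ≡ top + t / b × column x + suc (t / a) ≡ left + b × Rook□ x y)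
           {N : Word → ℕ} (N-symmetric : ToggleSymmetric N) where

    private
      T : Letter → Letter → ℕ
      T x y = ⟦ inverted? x y ⟧ * (∑[ u ∈ words ] (N u * χ y x u))

      -- Columns are counted from the right, by an equation that avoids subtraction: `j = 0` is the
      -- last column.
      columnSum rowSum : ℕ → ℕ
      columnSum j = ∑[ x ∈ letters ] (⟦ column x + suc j ℕ.≟ left + b ⟧ * (∑[ y ∈ letters ] T x y))
      rowSum    i = ∑[ y ∈ letters ] (⟦ row y ℕ.≟ top + i ⟧ * (∑[ x ∈ letters ] T x y))

      at-crossed : ∀ {t} → t < a * b → columnSum (t / a) + rowSum (t / b) ≡ ∑ words N
      at-crossed {t} t<ab = let (x₀ , y₀ , row-y₀ , column-x₀ , rook) = crossed t<ab in trans
        (cong₂ _+_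
          (trans (∑-cong (λ x → cong (_* (∑[ y ∈ letters ] T x y)) (⟦⟧-⇔ (column x + suc (t / a) ℕ.≟ left + b) (x₀ Fin.≟ x)
              (λ eq → column-injective (ℕ.+-cancelʳ-≡ (suc (t / a)) _ _ (trans column-x₀ (sym eq))))
              (λ { refl → column-x₀ }))) letters)
            (L.∑-δ x₀ {λ x → ∑[ y ∈ letters ] T x y} (λ { refl → refl })))
          (trans (∑-cong (λ y → cong (_* (∑[ x ∈ letters ] T x y)) (⟦⟧-⇔ (row y ℕ.≟ top + t / b) (y₀ Fin.≟ y)
              (λ eq → row-injective (trans row-y₀ (sym eq)))
              (λ { refl → row-y₀ }))) letters)
            (L.∑-δ y₀ {λ y → ∑[ x ∈ letters ] T x y} (λ { refl → refl }))))
        (rook-sum rook N-symmetric)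

      total : ℕ
      total = ∑[ x ∈ letters ] ∑[ y ∈ letters ] T x y

      weighted : ∀ (K : Letter → Letter → ℕ) k → (∀ {x y} → Inverted x y → K x y ≡ k) →
                 (∑[ x ∈ letters ] ∑[ y ∈ letters ] (T x y * K x y)) ≡ k * total
      weighted K k eq = trans (∑-cong (λ x → trans (∑-cong (λ y → trans
          (ℕ.*-assoc ⟦ inverted? x y ⟧ (∑[ u ∈ words ] (N u * χ y x u)) (K x y))
          (trans (⟦⟧-*-cong (inverted? x y) (λ inv → cong ((∑[ u ∈ words ] (N u * χ y x u)) *_) (eq inv)))
          (trans (sym (ℕ.*-assoc ⟦ inverted? x y ⟧ (∑[ u ∈ words ] (N u * χ y x u)) k)) (ℕ.*-comm (T x y) k)))) letters)
          (∑-*ˡ k (T x) letters)) letters)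
        (∑-*ˡ k (λ x → ∑ letters (T x)) letters)

      ∑-columnSum : (∑[ j ∈ upTo b ] columnSum j) ≡ total
      ∑-columnSum = begin
        (∑[ j ∈ upTo b ] columnSum j)
          ≡⟨ ∑-swap (λ j x → ⟦ column x + suc j ℕ.≟ left + b ⟧ * (∑[ y ∈ letters ] T x y)) (upTo b) letters ⟩
        (∑[ x ∈ letters ] ∑[ j ∈ upTo b ] (⟦ column x + suc j ℕ.≟ left + b ⟧ * (∑[ y ∈ letters ] T x y)))
          ≡⟨ ∑-cong (λ x → trans (∑-*ʳ (∑[ y ∈ letters ] T x y) (λ j → ⟦ column x + suc j ℕ.≟ left + b ⟧) (upTo b))
               (trans (ℕ.*-comm (count x) (∑[ y ∈ letters ] T x y)) (sym (∑-*ʳ (count x) (T x) letters)))) letters ⟩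
        (∑[ x ∈ letters ] ∑[ y ∈ letters ] (T x y * count x))
          ≡⟨ weighted (λ x _ → count x) 1 (λ inv → once inv) ⟩
        1 * total
          ≡⟨ ℕ.*-identityˡ total ⟩
        total ∎
        where
        open ≡-Reasoning
        count : Letter → ℕ
        count x = ∑[ j ∈ upTo b ] ⟦ column x + suc j ℕ.≟ left + b ⟧
        once : ∀ {x y} → Inverted x y → count x ≡ 1
        once {x} inv = let (l , r) = in-columns inv
                           (j , eq) = ℕ.m≤n⇒∃[o]m+o≡n r
                           eq′ = trans (ℕ.+-suc (column x) j) eq
          in ∑-upTo-δ (λ j → column x + suc j ℕ.≟ left + b) {j} b
               (ℕ.+-cancelˡ-≤ left (suc j) b (ℕ.≤-trans (ℕ.+-monoˡ-≤ (suc j) l) (ℕ.≤-reflexive eq′))) eq′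
               (λ {i} q → ℕ.suc-injective (ℕ.+-cancelˡ-≡ (column x) (suc i) (suc j) (trans q (sym eq′))))

      ∑-rowSum : (∑[ i ∈ upTo a ] rowSum i) ≡ total
      ∑-rowSum = begin
        (∑[ i ∈ upTo a ] rowSum i)
          ≡⟨ ∑-swap (λ i y → ⟦ row y ℕ.≟ top + i ⟧ * (∑[ x ∈ letters ] T x y)) (upTo a) letters ⟩
        (∑[ y ∈ letters ] ∑[ i ∈ upTo a ] (⟦ row y ℕ.≟ top + i ⟧ * (∑[ x ∈ letters ] T x y)))
          ≡⟨ ∑-cong (λ y → trans (∑-*ʳ (∑[ x ∈ letters ] T x y) (λ i → ⟦ row y ℕ.≟ top + i ⟧) (upTo a))
               (trans (ℕ.*-comm (count y) (∑[ x ∈ letters ] T x y)) (sym (∑-*ʳ (count y) (λ x → T x y) letters)))) letters ⟩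
        (∑[ y ∈ letters ] ∑[ x ∈ letters ] (T x y * count y))
          ≡⟨ ∑-swap (λ y x → T x y * count y) letters letters ⟩
        (∑[ x ∈ letters ] ∑[ y ∈ letters ] (T x y * count y))
          ≡⟨ weighted (λ _ y → count y) 1 (λ inv → once inv) ⟩
        1 * total
          ≡⟨ ℕ.*-identityˡ total ⟩
        total ∎
        where
        open ≡-Reasoning
        count : Letter → ℕ
        count y = ∑[ i ∈ upTo a ] ⟦ row y ℕ.≟ top + i ⟧
        once : ∀ {x y} → Inverted x y → count y ≡ 1
        once {x} {y} inv = let (l , r) = in-rows inv
                               (i , eq) = ℕ.m≤n⇒∃[o]m+o≡n l
          in ∑-upTo-δ (λ i → row y ℕ.≟ top + i) {i} a
               (ℕ.+-cancelˡ-< top i a (ℕ.≤-<-trans (ℕ.≤-reflexive eq) r)) (sym eq)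
               (λ {j} q → ℕ.+-cancelˡ-≡ top j i (trans (sym q) (sym eq)))

    antidiagonal-sum : (∑[ u ∈ words ] (N u * descentSum u)) * (a + b) ≡ a * b * ∑ words N
    antidiagonal-sum = begin
      (∑[ u ∈ words ] (N u * descentSum u)) * (a + b)  ≡⟨ cong (_* (a + b)) (∑-descents N-symmetric) ⟩
      total * (a + b)  ≡⟨ ℕ.*-comm total (a + b) ⟩
      (a + b) * total  ≡⟨ ℕ.*-distribʳ-+ total a b ⟩
      a * total + b * total  ≡⟨ cong₂ _+_ (cong (a *_) (sym ∑-columnSum)) (cong (b *_) (sym ∑-rowSum)) ⟩
      a * (∑[ j ∈ upTo b ] columnSum j) + b * (∑[ i ∈ upTo a ] rowSum i)
        ≡⟨ cong₂ _+_ (trans (sym (∑-upTo-/ b a columnSum)) (cong (λ k → ∑[ t ∈ upTo k ] columnSum (t / a)) (ℕ.*-comm b a)))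
                     (sym (∑-upTo-/ a b rowSum)) ⟩
      (∑[ t ∈ upTo (a * b) ] columnSum (t / a)) + (∑[ t ∈ upTo (a * b) ] rowSum (t / b))
        ≡⟨ sym (∑-+ (λ t → columnSum (t / a)) (λ t → rowSum (t / b)) (upTo (a * b))) ⟩
      (∑[ t ∈ upTo (a * b) ] (columnSum (t / a) + rowSum (t / b)))
        ≡⟨ ∑-upTo-cong (a * b) at-crossed ⟩
      (∑[ t ∈ upTo (a * b) ] ∑ words N)
        ≡⟨ ∑-upTo-const (∑ words N) (a * b) ⟩
      a * b * ∑ words N ∎
      where open ≡-Reasoning

-- Corners of skew shapes

≤⇒∃[o]o+m≡n : ∀ {m n} → m ≤ n → ∃ λ o → o + m ≡ n
≤⇒∃[o]o+m≡n {m} m≤n = let (o , eq) = ℕ.m≤n⇒∃[o]m+o≡n m≤n in o , trans (ℕ.+-comm o m) eq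

nth-step : ∀ {xs} → Linked _≥_ xs → ∀ i → nth xs (suc i) ≤ nth xs i
nth-step []         i       = z≤n
nth-step [-]        i       = z≤n
nth-step (x≥y ∷ _)  zero    = x≥y
nth-step (_ ∷ link) (suc i) = nth-step link i

part-antitone : ∀ μ {i j} → i ≤ j → part μ j ≤ part μ i
part-antitone μ i≤j with ≤⇒∃[o]o+m≡n i≤j
... | (o , refl) = go o
  where
  go : ∀ o {i} → part μ (o + i) ≤ part μ i
  go zero    = ℕ.≤-refl
  go (suc o) {i} = ℕ.≤-trans (nth-step (Partition.decreasing μ) (o + i)) (go o)

crossing-index : ∀ (f : ℕ → ℕ) {k} i o → k < f i → f (o + i) ≤ k → ∃ λ j → i ≤ j × j < o + i × k < f j × f (suc j) ≤ k
crossing-index f     i zero    k<f f≤k = contradiction f≤k (ℕ.<⇒≱ k<f)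
crossing-index f {k} i (suc o) k<f f≤k with ℕ.≤-<-connex (f (o + i)) k
... | inj₂ k<  = o + i , ℕ.m≤n+m i o , ℕ.≤-refl , k< , f≤k
... | inj₁ ≤k = let (j , i≤j , j< , rest) = crossing-index f i o k<f ≤k in j , i≤j , ℕ.m≤n⇒m≤1+n j< , rest

-- A discrete intermediate value theorem. Applied to the row ends of a skew shape, it finds two
-- successive rows between which the boundary steps past a given column.
∃-crossing : ∀ (f : ℕ → ℕ) {k i j} → i ≤ j → k < f i → f j ≤ k → ∃ λ m → i ≤ m × m < j × k < f m × f (suc m) ≤ k
∃-crossing f {i = i} i≤j k<f f≤k with ≤⇒∃[o]o+m≡n i≤j
... | (o , refl) = crossing-index f i o k<f f≤k

module Corners (D : Diagram) where

  -- The chosen segments are the two sides of the missing box that meet at the point; it is the only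
  -- box having both as sides. The same choice serves for `missing-SE`.
  missing-NW : ∀ {i j} → D (i , suc j) → D (suc i , j) → ¬ D (i , j) → OutwardCorner D (suc i , suc j)
  missing-NW {i} {j} NE SW ¬NW = (suc i , j) , (i , suc j) ,
    ((suc i , j) , (SW , top) , λ { (_ , top) → refl ; (d , bottom) → contradiction d ¬NW }) ,
    ((i , suc j) , (NE , left) , λ { (_ , left) → refl ; (d , right) → contradiction d ¬NW }) ,
    east , south , λ { _ d (bottom , right) → ¬NW d }

  missing-SE : ∀ {i j} → D (i , suc j) → D (suc i , j) → ¬ D (suc i , suc j) → OutwardCorner D (suc i , suc j)
  missing-SE {i} {j} NE SW ¬SE = (suc i , suc j) , (suc i , suc j) ,
    ((i , suc j) , (NE , bottom) , λ { (_ , bottom) → refl ; (d , top) → contradiction d ¬SE }) ,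
    ((suc i , j) , (SW , right) , λ { (_ , right) → refl ; (d , left) → contradiction d ¬SE }) ,
    west , north , λ { _ d (top , left) → ¬SE d }

module Geometry (σ : SkewShape) where
  open SkewShape σ
  open Corners boxes

  Λ N : ℕ → ℕ
  Λ = part outer
  N = part inner

  Λ-antitone : ∀ {i j} → i ≤ j → Λ j ≤ Λ i
  Λ-antitone = part-antitone outer
  N-antitone : ∀ {i j} → i ≤ j → N j ≤ N i
  N-antitone = part-antitone inner

  box⁺ : ∀ {i j} → N i ≤ j → j < Λ i → boxes (i , j)
  box⁺ N≤j j<Λ = j<Λ , ℕ.≤⇒≯ N≤j

  box-Λ : ∀ {i j} → boxes (i , j) → j < Λ i
  box-Λ = proj₁

  box-N : ∀ {i j} → boxes (i , j) → N i ≤ j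
  box-N (_ , ¬in) = ℕ.≮⇒≥ ¬in

  box? : ∀ i j → Dec (boxes (i , j))
  box? i j = (j ℕ.<? Λ i) ×-dec ¬? (j ℕ.<? N i)

  convex : ∀ {i j i′ j′ k l} → boxes (i , j) → boxes (i′ , j′) → i ≤ k → k ≤ i′ → j ≤ l → l ≤ j′ → boxes (k , l)
  convex d d′ i≤k k≤i′ j≤l l≤j′ =
    box⁺ (ℕ.≤-trans (N-antitone i≤k) (ℕ.≤-trans (box-N d) j≤l))
         (ℕ.<-≤-trans (ℕ.≤-<-trans l≤j′ (box-Λ d′)) (Λ-antitone k≤i′))

  module _ (connected : ConnectedDiagram boxes) where

    -- A path in the Hasse diagram that raises the coordinate π past k does so along a single cover.
    step-across : ∀ (π : Box → ℕ) → (∀ {i j i′ j′} → i ≤ i′ → j ≤ j′ → π (i , j) ≤ π (i′ , j′)) →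
                  ∀ {x y k} → boxes x → boxes y → π x ≤ k → k < π y →
                  ∃₂ λ u v → boxes u × boxes v × proj₁ u ≤ proj₁ v × proj₂ u ≤ proj₂ v × π u ≤ k × k < π v
    step-across π mono {k = k} dx dy = go (proj₂ connected (_ , dx) (_ , dy))
      where
      open Covering (boxPoset boxes) using (_⋖_; _≈_)
      go : ∀ {x y} → EqClosure (λ u v → u ≈ v ⊎ u ⋖ v) x y → π (proj₁ x) ≤ k → k < π (proj₁ y) →
           ∃₂ λ u v → boxes u × boxes v × proj₁ u ≤ proj₁ v × proj₂ u ≤ proj₂ v × π u ≤ k × k < π v
      go ε x≤k k<x = contradiction x≤k (ℕ.<⇒≱ k<x)
      go (_◅_ {x} {z} e path) x≤k k<y with ℕ.≤-<-connex (π (proj₁ z)) k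
      ... | inj₁ z≤k = go path z≤k k<y
      ... | inj₂ k<z with e
      ...   | fwd (inj₁ (refl , refl)) = contradiction x≤k (ℕ.<⇒≱ k<z)
      ...   | bwd (inj₁ (refl , refl)) = contradiction x≤k (ℕ.<⇒≱ k<z)
      ...   | fwd (inj₂ (((i≤ , j≤) , _) , _)) = _ , _ , proj₂ x , proj₂ z , i≤ , j≤ , x≤k , k<z
      ...   | bwd (inj₂ (((i≤ , j≤) , _) , _)) = contradiction (ℕ.≤-trans (mono i≤ j≤) x≤k) (ℕ.<⇒≱ k<z)

    -- Some cover of the Hasse diagram crosses from row `r` or above to a row below `r`. Its lower
    -- end is weakly northwest of its upper end, and convexity fills rows `r` and `suc r` in the
    -- column of the lower end.
    rows-overlap : ∀ {i j i′ j′ r} → boxes (i , j) → boxes (i′ , j′) → i ≤ r → r < i′ →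
                   ∃ λ c → boxes (r , c) × boxes (suc r , c)
    rows-overlap d d′ i≤r r<i′ with step-across proj₁ (λ i≤ _ → i≤) d d′ i≤r r<i′
    ... | ((p , q) , _ , du , dv , p≤ , q≤ , p≤r , r<) = q ,
      convex du dv p≤r (ℕ.<⇒≤ r<) ℕ.≤-refl q≤ , convex du dv (ℕ.m≤n⇒m≤1+n p≤r) r< ℕ.≤-refl q≤

    columns-overlap : ∀ {i j i′ j′ c} → boxes (i , j) → boxes (i′ , j′) → j ≤ c → c < j′ →
                      ∃ λ r → boxes (r , c) × boxes (r , suc c)
    columns-overlap d d′ j≤c c<j′ with step-across proj₂ (λ _ j≤ → j≤) d d′ j≤c c<j′
    ... | ((p , q) , _ , du , dv , p≤ , q≤ , q≤c , c<) = p ,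
      convex du dv ℕ.≤-refl p≤ q≤c (ℕ.<⇒≤ c<) , convex du dv ℕ.≤-refl p≤ (ℕ.m≤n⇒m≤1+n q≤c) c<

    -- The point (p , q) lies weakly northwest of the northwest vertex of (r , c), respectively weakly southeast
    -- of its southeast vertex.
    record Unobstructed (r c : ℕ) : Set where
      field
        no-NW : ∀ {p q} → OutwardCorner boxes (p , q) → p ≤ r → ¬ q ≤ c
        no-SE : ∀ {p q} → OutwardCorner boxes (p , q) → r < p → ¬ c < q

    module _ {r c : ℕ} (clear : Unobstructed r c) where
      open Unobstructed clear

      -- Suppose that (r, c) is missing. If it lies left of its row, the left boundary must step
      -- back past column `c` on the way down to the box of column `c`, and this leaves an outward
      -- corner southeast of (r, c). If it lies right of its row, the right boundary does so on the
      -- way from that box down to row `r`, leaving a corner northwest. Connectedness makes the two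
      -- rows at the step overlap, which provides the boxes next to the corner.
      unobstructed-box : ∀ {i j} → boxes (i , c) → boxes (r , j) → boxes (r , c)
      unobstructed-box {i} {j} dc dr with ℕ.≤-<-connex (N r) c | ℕ.≤-<-connex (Λ r) c
      ... | inj₁ N≤c | inj₂ c<Λ = box⁺ N≤c c<Λ
      ... | inj₂ c<N | _ with ∃-crossing N (ℕ.<⇒≤ (below dc c<N)) c<N (box-N dc)
        where
        below : ∀ {i r} → boxes (i , c) → c < N r → r < i
        below dc c<N = ℕ.≰⇒> λ i≤r → ℕ.<⇒≱ c<N (ℕ.≤-trans (N-antitone i≤r) (box-N dc))
      ...   | (m , r≤m , m<i , c<Nm , Nm′≤c) with rows-overlap dr dc r≤m m<i
      ...     | (q , dm , dm′) = contradiction c<Nm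
        (subst (λ k → ¬ c < k) eq (no-SE corner (s≤s r≤m)))
        where
        eq : suc (pred (N m)) ≡ N m
        eq = ℕ.suc-pred (N m) ⦃ >-nonZero (ℕ.≤-<-trans z≤n c<Nm) ⦄
        corner : OutwardCorner boxes (suc m , suc (pred (N m)))
        corner = missing-NW
          (subst (λ k → boxes (m , k)) (sym eq) (box⁺ ℕ.≤-refl (ℕ.≤-<-trans (box-N dm) (box-Λ dm))))
          (box⁺ (ℕ.≤-trans Nm′≤c (ℕ.≤-pred (subst (c <_) (sym eq) c<Nm)))
                (ℕ.≤-<-trans (ℕ.≤-trans (ℕ.pred[n]≤n) (box-N dm)) (box-Λ dm′)))
          (λ (_ , ¬in) → ¬in (ℕ.≤-reflexive eq))
      unobstructed-box {i} {j} dc dr | inj₁ _ | inj₁ Λ≤c with ∃-crossing Λ (ℕ.<⇒≤ (above dc Λ≤c)) (box-Λ dc) Λ≤c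
        where
        above : ∀ {i r} → boxes (i , c) → Λ r ≤ c → i < r
        above dc Λ≤c = ℕ.≰⇒> λ r≤i → ℕ.<⇒≱ (box-Λ dc) (ℕ.≤-trans (Λ-antitone r≤i) Λ≤c)
      ... | (m , i≤m , m<r , c<Λm , Λm′≤c) with rows-overlap dc dr i≤m m<r
      ...   | (q , dm , dm′) = contradiction Λm′≤c
        (subst (λ k → ¬ k ≤ c) eq (no-NW corner m<r))
        where
        eq : suc (pred (Λ (suc m))) ≡ Λ (suc m)
        eq = ℕ.suc-pred (Λ (suc m)) ⦃ >-nonZero (ℕ.≤-<-trans z≤n (box-Λ dm′)) ⦄
        q≤pred : q ≤ pred (Λ (suc m))
        q≤pred = ℕ.≤-pred (subst (q <_) (sym eq) (box-Λ dm′))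
        corner : OutwardCorner boxes (suc m , suc (pred (Λ (suc m))))
        corner = missing-SE
          (subst (λ k → boxes (m , k)) (sym eq) (box⁺ (ℕ.≤-trans (box-N dm) (ℕ.<⇒≤ (box-Λ dm′))) (ℕ.≤-<-trans Λm′≤c c<Λm)))
          (box⁺ (ℕ.≤-trans (box-N dm′) q≤pred) (ℕ.≤-reflexive eq))
          (λ (lt , _) → ℕ.<-irrefl eq lt)

      -- In the northeast and southwest quadrants of (r, c) convexity is enough. A missing box
      -- southeast of (r, c) forces a step of the right boundary, hence a corner in that quadrant;
      -- northwest the left boundary plays this part.
      unobstructed-rectangle : ∀ {r′ c′} → boxes (r , c) → boxes (r , c′) → boxes (r′ , c) → boxes (r′ , c′)
      unobstructed-rectangle {r′} {c′} d dr dc with ℕ.≤-<-connex r r′ | ℕ.≤-<-connex c c′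
      ... | inj₁ r≤r′ | inj₂ c′<c = convex dr dc r≤r′ ℕ.≤-refl ℕ.≤-refl (ℕ.<⇒≤ c′<c)
      ... | inj₂ r′<r | inj₁ c≤c′ = convex dc dr ℕ.≤-refl (ℕ.<⇒≤ r′<r) c≤c′ ℕ.≤-refl
      ... | inj₁ r≤r′ | inj₁ c≤c′ with ℕ.≤-<-connex (Λ r′) c′
      ...   | inj₂ c′<Λ = box⁺ (ℕ.≤-trans (box-N dc) c≤c′) c′<Λ
      ...   | inj₁ Λ≤c′ with ∃-crossing Λ r≤r′ (box-Λ dr) Λ≤c′
      ...     | (m , r≤m , m<r′ , c′<Λm , Λm′≤c′) = contradiction (ℕ.<-≤-trans (box-Λ dc) (Λ-antitone m<r′))
        (subst (λ k → ¬ c < k) eq (no-SE corner (s≤s r≤m)))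
        where
        c<Λm′ : c < Λ (suc m)
        c<Λm′ = ℕ.<-≤-trans (box-Λ dc) (Λ-antitone m<r′)
        eq : suc (pred (Λ (suc m))) ≡ Λ (suc m)
        eq = ℕ.suc-pred (Λ (suc m)) ⦃ >-nonZero (ℕ.≤-<-trans z≤n c<Λm′) ⦄
        c≤pred : c ≤ pred (Λ (suc m))
        c≤pred = ℕ.≤-pred (subst (c <_) (sym eq) c<Λm′)
        corner : OutwardCorner boxes (suc m , suc (pred (Λ (suc m))))
        corner = missing-SE
          (box⁺ (ℕ.≤-trans (N-antitone r≤m) (ℕ.≤-trans (box-N d) (ℕ.m≤n⇒m≤1+n c≤pred))) (ℕ.≤-<-trans (subst (_≤ c′) (sym eq) Λm′≤c′) c′<Λm))
          (box⁺ (ℕ.≤-trans (N-antitone (ℕ.m≤n⇒m≤1+n r≤m)) (ℕ.≤-trans (box-N d) c≤pred)) (ℕ.≤-reflexive eq))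
          (λ (lt , _) → ℕ.<-irrefl eq lt)
      unobstructed-rectangle {r′} {c′} d dr dc | inj₂ r′<r | inj₂ c′<c with ℕ.≤-<-connex (N r′) c′
      ... | inj₁ N≤c′ = box⁺ N≤c′ (ℕ.<-trans c′<c (box-Λ dc))
      ... | inj₂ c′<N with ∃-crossing N (ℕ.<⇒≤ r′<r) c′<N (box-N dr)
      ...   | (m , r′≤m , m<r , c′<Nm , Nm′≤c′) = contradiction Nm≤c
        (subst (λ k → ¬ k ≤ c) eq (no-NW corner m<r))
        where
        Nm≤c : N m ≤ c
        Nm≤c = ℕ.≤-trans (N-antitone r′≤m) (box-N dc)
        eq : suc (pred (N m)) ≡ N m
        eq = ℕ.suc-pred (N m) ⦃ >-nonZero (ℕ.≤-<-trans z≤n c′<Nm) ⦄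
        corner : OutwardCorner boxes (suc m , suc (pred (N m)))
        corner = missing-NW
          (subst (λ k → boxes (m , k)) (sym eq) (box⁺ ℕ.≤-refl (ℕ.≤-<-trans Nm≤c (ℕ.<-≤-trans (box-Λ d) (Λ-antitone (ℕ.<⇒≤ m<r))))))
          (box⁺ (ℕ.≤-trans Nm′≤c′ (ℕ.≤-pred (subst (c′ <_) (sym eq) c′<Nm)))
                (ℕ.≤-<-trans (ℕ.≤-trans ℕ.pred[n]≤n Nm≤c) (ℕ.<-≤-trans (box-Λ d) (Λ-antitone m<r))))
          (λ (_ , ¬in) → ¬in (ℕ.≤-reflexive eq))

    module _ {R : Rectangle} (bounding : IsBoundingRectangle boxes R) where
      open Rectangle R renaming (top to t; left to l; height to h; width to v)

      private
        inside : ∀ {i j} → boxes (i , j) → (t ≤ i × i < t + h) × (l ≤ j × j < l + v)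
        inside {i} {j} = proj₁ bounding {i , j}

        positive : ∀ {m k o} → m ≤ k → k < m + o → 0 < o
        positive {m} {k} {zero}  m≤k k< = contradiction (subst (k <_) (ℕ.+-identityʳ m) k<) (ℕ.≤⇒≯ m≤k)
        positive {o = suc o}     _   _  = z<s

        h-positive : 0 < h
        h-positive = let ((_ , d) , _) = connected ; ((t≤ , <t) , _) = inside d in positive t≤ <t

        v-positive : 0 < v
        v-positive = let ((_ , d) , _) = connected ; (_ , (l≤ , <l)) = inside d in positive l≤ <l

        not-pred : ∀ {m} → 0 < m → ¬ m ≤ pred m
        not-pred {suc m} _ = ℕ.<-irrefl refl

        +-suc-pred : ∀ m {o} → 0 < o → suc (m + pred o) ≡ m + o
        +-suc-pred m {suc o} _ = sym (ℕ.+-suc m o)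

        strictly-below : ∀ {k m o} → 0 < o → k < m + o → k ≢ m + pred o → k < m + pred o
        strictly-below {k} {m} {o} 0<o k< k≢ = ℕ.≤∧≢⇒< (ℕ.≤-pred (subst (k <_) (sym (+-suc-pred m 0<o)) k<)) k≢

        row-empty? : ∀ i → (∃ λ c → boxes (i , c)) ⊎ (∀ {k j} → boxes (k , j) → k ≢ i)
        row-empty? i with N i ℕ.<? Λ i
        ... | yes N<Λ = inj₁ (N i , box⁺ ℕ.≤-refl N<Λ)
        ... | no N≮Λ  = inj₂ λ { d refl → N≮Λ (ℕ.≤-<-trans (box-N d) (box-Λ d)) }

        column-empty? : ∀ j → (∃ λ r → boxes (r , j)) ⊎ (∀ {k i} → boxes (i , k) → k ≢ j)
        column-empty? j with ℕ.anyUpTo? (λ i → box? i j) (t + h)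
        ... | yes (i , _ , d) = inj₁ (i , d)
        ... | no none         = inj₂ λ { d refl → none (_ , proj₂ (proj₁ (inside d)) , d) }

        -- If the first row were empty, a rectangle of smaller height would contain the shape. The
        -- other three sides are treated alike.
        top-row : ∃ λ c → boxes (t , c)
        top-row with row-empty? t
        ... | inj₁ d   = d
        ... | inj₂ out = contradiction (proj₁ (proj₂ bounding R′ λ {x} → fits {x})) (not-pred h-positive)
          where
          R′ : Rectangle
          R′ = record { top = suc t ; left = l ; height = pred h ; width = v }
          fits : ∀ {x} → boxes x → Rectangle.interior R′ x
          fits {i , j} d = let ((t≤ , <t) , cols) = inside d in
            (ℕ.≤∧≢⇒< t≤ (out d ∘ sym) , subst (i <_) (sym (+-suc-pred t h-positive)) <t) , cols

        bottom-row : ∃ λ c → boxes (t + pred h , c)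
        bottom-row with row-empty? (t + pred h)
        ... | inj₁ d   = d
        ... | inj₂ out = contradiction (proj₁ (proj₂ bounding R′ λ {x} → fits {x})) (not-pred h-positive)
          where
          R′ : Rectangle
          R′ = record { top = t ; left = l ; height = pred h ; width = v }
          fits : ∀ {x} → boxes x → Rectangle.interior R′ x
          fits {i , j} d = let ((t≤ , <t) , cols) = inside d in (t≤ , strictly-below h-positive <t (out d)) , cols

        left-column : ∃ λ r → boxes (r , l)
        left-column with column-empty? l
        ... | inj₁ d   = d
        ... | inj₂ out = contradiction (proj₂ (proj₂ bounding R′ λ {x} → fits {x})) (not-pred v-positive)
          where
          R′ : Rectangle
          R′ = record { top = t ; left = suc l ; height = h ; width = pred v }
          fits : ∀ {x} → boxes x → Rectangle.interior R′ x
          fits {i , j} d = let (rows , (l≤ , <l)) = inside d in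
            rows , (ℕ.≤∧≢⇒< l≤ (out d ∘ sym) , subst (j <_) (sym (+-suc-pred l v-positive)) <l)

        right-column : ∃ λ r → boxes (r , l + pred v)
        right-column with column-empty? (l + pred v)
        ... | inj₁ d   = d
        ... | inj₂ out = contradiction (proj₂ (proj₂ bounding R′ λ {x} → fits {x})) (not-pred v-positive)
          where
          R′ : Rectangle
          R′ = record { top = t ; left = l ; height = h ; width = pred v }
          fits : ∀ {x} → boxes x → Rectangle.interior R′ x
          fits {i , j} d = let (rows , (l≤ , <l)) = inside d in rows , (l≤ , strictly-below v-positive <l (out d))

      bounding-positive : 0 < h × 0 < v
      bounding-positive = h-positive , v-positive

      row-nonempty : ∀ {r} → t ≤ r → r < t + h → ∃ λ c → boxes (r , c)
      -- `rows-overlap` needs a later row, so the last row is separate.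
      row-nonempty {r} t≤r r< with r ℕ.≟ t + pred h
      ... | yes refl = bottom-row
      ... | no r≢    = let (c , d , _) = rows-overlap (proj₂ top-row) (proj₂ bottom-row) t≤r (strictly-below h-positive r< r≢)
                       in c , d

      column-nonempty : ∀ {c} → l ≤ c → c < l + v → ∃ λ r → boxes (r , c)
      column-nonempty {c} l≤c c< with c ℕ.≟ l + pred v
      ... | yes refl = right-column
      ... | no c≢    = let (r , d , _) = columns-overlap (proj₂ left-column) (proj₂ right-column) l≤c (strictly-below v-positive c< c≢)
                       in r , d

      module _ .{{_ : NonZero h}} .{{_ : NonZero v}}
               (on-antidiagonal : ∀ p → OutwardCorner boxes p → OnAntidiagonal R p) {s : ℕ} (s< : s < h * v) where

        private
          <suc-/ : ∀ d .{{_ : NonZero d}} → s < suc (s / d) * d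
          <suc-/ d = subst (_< suc (s / d) * d) (sym (m≡m%n+[m/n]*n s d)) (ℕ.+-monoˡ-< (s / d * d) (m%n<n s d))

          s/h<v : s / h < v
          s/h<v = m<n*o⇒m/o<n (subst (s <_) (ℕ.*-comm h v) s<)

          column′ : v ∸ suc (s / h) + suc (s / h) ≡ v
          column′ = ℕ.m∸n+n≡m s/h<v

        -- The box (t + s / v , l + (v − 1 − s / h)) is crossed by the antidiagonal.
        crossed-unobstructed : Unobstructed (t + s / v) (l + (v ∸ suc (s / h)))
        crossed-unobstructed = record { no-NW = no-NW ; no-SE = no-SE }
          where
          open ℕ.≤-Reasoning
          no-NW : ∀ {p q} → OutwardCorner boxes (p , q) → p ≤ t + s / v → ¬ q ≤ l + (v ∸ suc (s / h))
          no-NW corner p≤ q≤ with on-antidiagonal _ corner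
          -- A corner weakly northwest of the box lies strictly above the line: `p * v` is at most
          -- `s`, and `s` is less than `suc (s / h) * h`, which together with `q * h` is at most
          -- `v * h`.
          ... | (p , q , refl , eq) = ℕ.<-irrefl eq (begin-strict
            p * v + q * h  ≤⟨ ℕ.+-monoˡ-≤ (q * h) (ℕ.*-monoˡ-≤ v (ℕ.+-cancelˡ-≤ t p (s / v) p≤)) ⟩
            s / v * v + q * h  ≤⟨ ℕ.+-monoˡ-≤ (q * h) (m/n*n≤m s v) ⟩
            s + q * h                      <⟨ ℕ.+-monoˡ-< (q * h) (<suc-/ h) ⟩
            suc (s / h) * h + q * h  ≡⟨ sym (ℕ.*-distribʳ-+ h (suc (s / h)) q) ⟩
            (suc (s / h) + q) * h  ≤⟨ ℕ.*-monoˡ-≤ h (ℕ.+-monoʳ-≤ (suc (s / h)) (ℕ.+-cancelˡ-≤ l q (v ∸ suc (s / h)) q≤)) ⟩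
            (suc (s / h) + (v ∸ suc (s / h))) * h ≡⟨ cong (_* h) (trans (ℕ.+-comm (suc (s / h)) (v ∸ suc (s / h))) column′) ⟩
            v * h  ≡⟨ ℕ.*-comm v h ⟩
            h * v  ∎)
          no-SE : ∀ {p q} → OutwardCorner boxes (p , q) → t + s / v < p → ¬ l + (v ∸ suc (s / h)) < q
          no-SE corner p> q> with on-antidiagonal _ corner
          -- Dually, `s` is at least `s / h * h` and strictly less than `p * v`.
          ... | (p , q , refl , eq) = ℕ.<-irrefl (sym eq) (begin-strict
            h * v  ≡⟨ ℕ.*-comm h v ⟩
            v * h  ≡⟨ cong (_* h) (trans (sym column′) (ℕ.+-suc (v ∸ suc (s / h)) (s / h))) ⟩
            (suc (v ∸ suc (s / h)) + s / h) * h ≤⟨ ℕ.*-monoˡ-≤ h (ℕ.+-monoˡ-≤ (s / h) (ℕ.+-cancelˡ-< l (v ∸ suc (s / h)) q q>)) ⟩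
            (q + s / h) * h  ≡⟨ ℕ.*-distribʳ-+ h q (s / h) ⟩
            q * h + s / h * h  ≤⟨ ℕ.+-monoʳ-≤ (q * h) (m/n*n≤m s h) ⟩
            q * h + s                      <⟨ ℕ.+-monoʳ-< (q * h) (<suc-/ v) ⟩
            q * h + suc (s / v) * v  ≤⟨ ℕ.+-monoʳ-≤ (q * h) (ℕ.*-monoˡ-≤ v (ℕ.+-cancelˡ-< t (s / v) p p>)) ⟩
            q * h + p * v  ≡⟨ ℕ.+-comm (q * h) (p * v) ⟩
            p * v + q * h  ∎)

        crossed-column : l + (v ∸ suc (s / h)) + suc (s / h) ≡ l + v
        crossed-column = trans (ℕ.+-assoc l (v ∸ suc (s / h)) (suc (s / h))) (cong (l +_) column′)

        crossed-box : boxes (t + s / v , l + (v ∸ suc (s / h)))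
        crossed-box = unobstructed-box crossed-unobstructed
          (proj₂ (column-nonempty (ℕ.m≤m+n l _)
            (ℕ.≤-trans (ℕ.m<m+n _ z<s) (ℕ.≤-reflexive crossed-column))))
          (proj₂ (row-nonempty (ℕ.m≤m+n t _) (ℕ.+-monoʳ-< t (m<n*o⇒m/o<n s<))))

        crossed-rectangle : ∀ {r′ c′} → boxes (t + s / v , c′) → boxes (r′ , l + (v ∸ suc (s / h))) → boxes (r′ , c′)
        crossed-rectangle = unobstructed-rectangle crossed-unobstructed crossed-box

-- Transfer between the Rothe diagram and the skew shape

module SkewVexillary (σ : SkewShape) {n : ℕ} (w : Permutation′ n) (vexillary : IsSkewVexillary w σ) where
  open SkewShape σ using (boxes)
  open Toggle n
  open Symmetry w
  open Expectation n w

  private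
    ρ = proj₁ vexillary
    γ = proj₁ (proj₂ vexillary)
    rearranged = proj₂ (proj₂ vexillary)

  -- An inversion with values `x` and `y`, `y` the larger, is the box of the Rothe diagram in the
  -- row of the position of `y` and in column `x`; `ρ` and `γ` carry it into the shape.
  row column : Letter → ℕ
  row y    = Inverse.to ρ (pos w y)
  column x = Inverse.to γ (toℕ x)

  ↔-injective : (φ : ℕ ↔ ℕ) → ∀ {i j} → Inverse.to φ i ≡ Inverse.to φ j → i ≡ j
  ↔-injective φ {i} {j} eq =
    trans (sym (Inverse.strictlyInverseʳ φ i)) (trans (cong (Inverse.from φ) eq) (Inverse.strictlyInverseʳ φ j))

  row-injective : ∀ {x y} → row x ≡ row y → x ≡ y
  row-injective eq = pos-injective w (↔-injective ρ eq)

  column-injective : ∀ {x y} → column x ≡ column y → x ≡ y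
  column-injective eq = Fin.toℕ-injective (↔-injective γ eq)

  inverted⇒rothe : ∀ {x y} → Inverted x y → Rothe w (pos w y , toℕ x)
  inverted⇒rothe {x} {y} (x<y , y-x) = w ⟨$⟩ˡ y , w ⟨$⟩ˡ x ,
    (subst₂ _<_ (pos-toℕ w y) (pos-toℕ w x) y-x , subst₂ Fin._<_ (sym (inverseʳ w)) (sym (inverseʳ w)) x<y) ,
    cong₂ _,_ (pos-toℕ w y) (cong toℕ (sym (inverseʳ w)))

  rothe⇒inverted : ∀ {i j} → Rothe w (i , j) → ∃₂ λ x y → i ≡ pos w y × j ≡ toℕ x × Inverted x y
  rothe⇒inverted (i , j , (i<j , wj<wi) , refl) = w ⟨$⟩ʳ j , w ⟨$⟩ʳ i , sym (pos-w i) , refl ,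
    wj<wi , subst₂ _<_ (sym (pos-w i)) (sym (pos-w j)) i<j
    where
    pos-w : ∀ i → pos w (w ⟨$⟩ʳ i) ≡ toℕ i
    pos-w i = trans (pos-toℕ w (w ⟨$⟩ʳ i)) (cong toℕ (inverseˡ w))

  inverted⇒box : ∀ {x y} → Inverted x y → boxes (row y , column x)
  inverted⇒box inv = Equivalence.to (rearranged _ _) (inverted⇒rothe inv)

  box⇒inverted : ∀ {x y} → boxes (row y , column x) → Inverted x y
  box⇒inverted d with rothe⇒inverted (Equivalence.from (rearranged _ _) d)
  ... | (x , y , eq , eq′ , inv) = subst₂ Inverted (sym (Fin.toℕ-injective eq′)) (sym (pos-injective w eq)) inv

  box⇒letters : ∀ {i j} → boxes (i , j) → ∃₂ λ x y → row y ≡ i × column x ≡ j × Inverted x y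
  box⇒letters {i} {j} d with rothe⇒inverted (Equivalence.from (rearranged (Inverse.from ρ i) (Inverse.from γ j))
    (subst₂ (λ i j → boxes (i , j)) (sym (Inverse.strictlyInverseˡ ρ i)) (sym (Inverse.strictlyInverseˡ γ j)) d))
  ... | (x , y , eq , eq′ , inv) = x , y ,
    trans (cong (Inverse.to ρ) (sym eq)) (Inverse.strictlyInverseˡ ρ i) ,
    trans (cong (Inverse.to γ) (sym eq′)) (Inverse.strictlyInverseˡ γ j) , inv

theorem1p3 : (σ : SkewShape) (a b : ℕ) →
    Balanced (SkewShape.boxes σ) →
    HasDimensions (SkewShape.boxes σ) a b →
    (n : ℕ) (w : Permutation′ n) → IsSkewVexillary w σ →
    CDE.IsCDE [e, w ] × CDE.edgeDensity [e, w ] ≡ (a * b) ÷ (a + b)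
theorem1p3 σ a b (connected , outward) (R , bounding , refl , refl) n w vexillary =
  Interval.cde-from-expectations n w (a * b) (a + b) (ℕ.<-≤-trans (proj₁ positive) (ℕ.m≤m+n a b))
    (λ {N} → Antidiagonal.antidiagonal-sum n w a b t₀ l₀ row column row-injective column-injective
      (λ inv → proj₁ (proj₁ bounding (inverted⇒box inv))) (λ inv → proj₂ (proj₁ bounding (inverted⇒box inv))) crossed {N})
  where
  open SkewShape σ using (boxes)
  open SkewVexillary σ w vexillary
  open Geometry σ
  open Rectangle R renaming (top to t₀; left to l₀) using ()
  open Toggle n
  open Symmetry w using (Inverted)
  open Expectation n w using (Rook□)
  positive = bounding-positive connected bounding
  instance
    _ = >-nonZero (proj₁ positive)
    _ = >-nonZero (proj₂ positive)
  crossed : ∀ {t} → t < a * b → ∃₂ λ x y → row y ≡ t₀ + t / b × column x + suc (t / a) ≡ l₀ + b × Rook□ x y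
  crossed {t} t< with box⇒letters (crossed-box connected bounding (outward R bounding) t<)
  ... | (x , y , row-y , column-x , inv) = x , y , row-y ,
    trans (cong (_+ suc (t / a)) column-x) (crossed-column connected bounding (outward R bounding) t<) , record
    { box       = inv
    -- That a row and a column span a full rectangle does not depend on the order of rows and
    -- columns, so the condition can be checked in the shape.
    ; rectangle = λ {x′} {y′} x′-y x-y′ → box⇒inverted (crossed-rectangle connected bounding (outward R bounding) t<
        (subst (λ r → boxes (r , column x′)) row-y (inverted⇒box x′-y))
        (subst (λ c → boxes (row y′ , c)) column-x (inverted⇒box x-y′)))
    }
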